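{- For every integer $d\geq 2$, let $A_d(n)$ denote the number of $d$-dimensional polycubes with $n$ cells, counted up to translation, and let $\lambda_d=\lim_{n\to\infty}A_d(n+1)/A_d(n)$. Then $\lambda_d \leq (2d-2)e + \frac{1}{2d-2}$.
   Context: A $d$-dimensional polycube of size $n$ is a set of $n$ unit cubes (cells) of the cubical lattice $\mathbb{Z}^d$ that is connected via shared $(d-1)$-dimensional faces. Two polycubes are identified if one is a translate of the other (fixed polycubes). $A_d(n)$ is the number of such polycubes of size $n$. It is known that the limit $\lambda_d=\lim_{n\to\infty}A_d(n+1)/A_d(n)$ exists and equals $\lim_{n\to\infty}A_d(n)^{1/n}$. Here $e$ is Euler's number. -}

module Defs where

open import Data.Bool using (Bool; true; false; _∧_; _∨_; not)
open import Data.Nat using (ℕ; zero; suc; _+_; _*_; _∸_; _≡ᵇ_; ∣_-_∣; _!)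
open import Data.Nat.Properties using (_!≢0)
open import Data.Integer using (+_)
open import Data.List using (List; []; _∷_; map; concatMap; upTo; filterᵇ; length; foldr)
open import Data.Bool.ListAction using (any; all)
open import Data.Vec using (Vec; []; _∷_; zipWith; toList)
open import Data.Rational using (ℚ; _/_; 0ℚ) renaming (_+_ to _+ℚ_; _*_ to _*ℚ_)

-- Cells of the cubical lattice Z^d.
-- A polycube is identified with its unique translate lying in the
-- nonnegative orthant and touching every coordinate hyperplane x_i = 0
-- (i.e. min of every coordinate is 0).  A polycube with n cells is then
-- contained in the box {0,…,n-1}^d.

Cell : ℕ → Set
Cell d = Vec ℕ d

box : (d n : ℕ) → List (Cell d)
box zero    n = [] ∷ []
box (suc d) n = concatMap (λ x → map (x ∷_) (box d n)) (upTo n)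

-- all sublists (= all subsets, since box has no duplicates)
sublists : {A : Set} → List A → List (List A)
sublists []       = [] ∷ []
sublists (x ∷ xs) = let r = sublists xs in map (x ∷_) r Data.List.++ r

dist : {d : ℕ} → Cell d → Cell d → ℕ
dist u v = foldr _+_ 0 (toList (zipWith ∣_-_∣ u v))

-- two cells share a (d-1)-dimensional face iff their L1 distance is 1
adjacent : {d : ℕ} → Cell d → Cell d → Bool
adjacent u v = dist u v ≡ᵇ 1

sameCell : {d : ℕ} → Cell d → Cell d → Bool
sameCell u v = dist u v ≡ᵇ 0

step : {d : ℕ} → List (Cell d) → List (Cell d) → List (Cell d)
step S R = filterᵇ (λ c → any (λ r → sameCell c r ∨ adjacent c r) R) S

reach : {d : ℕ} → ℕ → List (Cell d) → List (Cell d) → List (Cell d)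
reach zero    S R = R
reach (suc k) S R = reach k S (step S R)

-- S (a duplicate-free list of cells) is connected via shared faces:
-- every cell of S is reachable from the first cell of S.
connected : {d : ℕ} → List (Cell d) → Bool
connected []      = true
connected (c ∷ S) = length (reach (length S) (c ∷ S) (c ∷ [])) ≡ᵇ suc (length S)

touches : {d : ℕ} → List (Cell d) → Bool
touches {d} S = all (λ i → any (λ c → nth i (toList c) ≡ᵇ 0) S) (upTo d)
  where
  nth : ℕ → List ℕ → ℕ
  nth _       []       = 0
  nth zero    (x ∷ xs) = x
  nth (suc i) (x ∷ xs) = nth i xs

isNormalPolycube : (d n : ℕ) → List (Cell d) → Bool
isNormalPolycube d n S = (length S ≡ᵇ n) ∧ connected S ∧ touches S

A : ℕ → ℕ → ℕ
A d n = length (filterᵇ (isNormalPolycube d n) (sublists (box d n)))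

eSum : ℕ → ℚ
eSum zero    = + 1 / 1
eSum (suc N) = eSum N +ℚ (+ 1 / (suc N !)) {{suc N !≢0}}

-- (2d-2)·eSum N + 1/(2d-2), for d ≥ 2 (value for d < 2 is irrelevant)
boundApprox : ℕ → ℕ → ℚ
boundApprox (suc (suc k)) N =
  (+ (suc k + suc k) / 1) *ℚ eSum N +ℚ (+ 1 / (suc k + suc k))
boundApprox _ N = 0ℚ

ℕtoℚ : ℕ → ℚ
ℕtoℚ m = + m / 1

{-# OPTIONS --safe #-}

-- Let m = 2d − 2, w = (m + 1)ᵐ + mᵐ⁻² and B = w / mᵐ⁻¹ = m (1 + 1/m)ᵐ + 1/m.  The binomial
-- coefficients give (1 + 1/m)ᵐ ≤ Σ_{k ≤ m} 1/k!, so B ≤ (2d − 2) e + 1/(2d − 2).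
--
-- Upper bound A(n) ≤ nᵈ Bⁿ.  Explore a polycube depth first, keeping for each cell waiting to be
-- processed two perpendicular decided neighbours.  A processed cell then has m undecided neighbours,
-- and the only children not supplied with two decided neighbours of their own are those of a cell
-- continued straight ahead only; there one further cell is decided.  Weighting each new cell by
-- y = 1/m, a step contributes (1 + y)ᵐ + y².
--
-- From the n-th root to the ratio.  Partition space into blocks of side three.  In a polycube, the
-- centre of a block whose other cells are all present may be switched on or off freely; let k be the
-- number of such blocks, v the number of those switched on.  The number N(n, k, v) of polycubes
-- satisfies N(n+1, k, v+1) (v+1) = N(n, k, v) (k − v).  If (k − v)/(v + 1) exceeds B noticeably and v is
-- proportional to n, then repeated switching shows that N(n, k, v) Θʲ ≤ A(n + j) for some Θ > B and j
-- proportional to n; if v is small, then filling up blocks shows that N(n, k, v) is small as well.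
-- Both use A(n + j) ≤ Bʲ A(n) up to subexponential factors, obtained by repeatedly cutting a spanning
-- tree at a vertex into pieces of prescribed size.  All remaining classes satisfy
-- N(n+1, k, v+1) ≤ (B + ε) N(n, k, v), and summing over k and v gives the bound on A(n+1)/A(n).
module Submission where

open import Defs

-- The exponential bound alone says nothing about consecutive terms: A(n) could lie far below Bⁿ for
-- some n and jump afterwards, so A(n + j) ≤ Bʲ A(n) up to small factors needs its own argument.
-- Cutting gives it: a polycube of size n + j loses pieces of about s to 2s cells until at most n
-- cells remain, and only the pieces cut off are charged at rate B. Since s is proportional to n,
-- the number of cuts stays constant and all overcounting is polynomial in n, hence beaten by 2ˢ.
--
-- Blocks have side three because, in dimension at least two, the neighbours of the centre are
-- joined inside the block without the centre, so switching it off keeps the polycube connected. No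
-- centre belongs to the shell of a block, so switching leaves k unchanged. Small v is singled out
-- because a chain of switches must hardly change (k - v)/(v + 1).
--
-- Inequalities are kept between natural numbers, with B as the fraction `β` / `r` and slack
-- measured in units of 1/`r`: a class is steep from `β` + 2 on, the chain of switches still runs at
-- rate `β` + 1, and the third unit of `β` + 3 pays for the negligible classes.

-- Finite sums of natural numbers.

module Sums where
  open import Data.Nat using (ℕ; zero; suc; _+_; _*_; _≤_; _<_; z≤n)
  open import Data.Nat.Tactic.RingSolver using (solve-∀)
  open import Data.Nat.Properties
  open import Relation.Binary.PropositionalEquality

  *-swapˡ : ∀ x y z → x * (y * z) ≡ y * (x * z)
  *-swapˡ = solve-∀

  *-swapʳ : ∀ x y z → x * y * z ≡ x * z * y
  *-swapʳ = solve-∀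

  sumTo : ℕ → (ℕ → ℕ) → ℕ
  sumTo zero    f = 0
  sumTo (suc n) f = f n + sumTo n f

  sumTo-mono : ∀ n {f g : ℕ → ℕ} → (∀ i → i < n → f i ≤ g i) → sumTo n f ≤ sumTo n g
  sumTo-mono zero    h = z≤n
  sumTo-mono (suc n) h = +-mono-≤ (h n ≤-refl) (sumTo-mono n λ i i<n → h i (m≤n⇒m≤1+n i<n))

  sumTo-cong : ∀ n {f g : ℕ → ℕ} → (∀ i → i < n → f i ≡ g i) → sumTo n f ≡ sumTo n g
  sumTo-cong zero    h = refl
  sumTo-cong (suc n) h = cong₂ _+_ (h n ≤-refl) (sumTo-cong n λ i i<n → h i (m≤n⇒m≤1+n i<n))

  sumTo-const : ∀ n c → sumTo n (λ _ → c) ≡ n * c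
  sumTo-const zero    c = refl
  sumTo-const (suc n) c = cong (c +_) (sumTo-const n c)

  sumTo-+ : ∀ n (f g : ℕ → ℕ) → sumTo n (λ i → f i + g i) ≡ sumTo n f + sumTo n g
  sumTo-+ zero    f g = refl
  sumTo-+ (suc n) f g = trans (cong (f n + g n +_) (sumTo-+ n f g))
    (interchange (f n) (g n) (sumTo n f) (sumTo n g))
    where
    interchange : ∀ a b c e → a + b + (c + e) ≡ a + c + (b + e)
    interchange = solve-∀

  sumTo-*ˡ : ∀ n c (f : ℕ → ℕ) → sumTo n (λ i → c * f i) ≡ c * sumTo n f
  sumTo-*ˡ zero    c f = sym (*-zeroʳ c)
  sumTo-*ˡ (suc n) c f = trans (cong (c * f n +_) (sumTo-*ˡ n c f)) (sym (*-distribˡ-+ c (f n) _))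

  sumTo-≤-const : ∀ n {f : ℕ → ℕ} c → (∀ i → i < n → f i ≤ c) → sumTo n f ≤ n * c
  sumTo-≤-const n c h = ≤-trans (sumTo-mono n h) (≤-reflexive (sumTo-const n c))

-- Exponential against polynomial growth.

module Asymptotics where
  open Sums
  open import Data.Nat using (ℕ; zero; suc; _+_; _*_; _∸_; _^_; _≤_; _<_; z≤n; s≤s; _/_; NonZero; >-nonZero)
  open import Data.Nat.Properties
  open import Data.Nat.DivMod using (m≡m%n+[m/n]*n; m%n<n; m*n/n≡m; /-monoˡ-≤; m/n*n≤m)
  open import Data.Nat.Tactic.RingSolver using (solve-∀)
  open import Data.Product using (∃-syntax; _,_; proj₁; proj₂)
  open import Relation.Nullary using (yes; no)
  open import Relation.Binary.PropositionalEquality hiding (J)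

  n<2^n : ∀ n → suc n ≤ 2 ^ n
  n<2^n zero    = ≤-refl
  n<2^n (suc n) = begin
    1 + suc n      ≤⟨ +-mono-≤ (m^n>0 2 n) (n<2^n n) ⟩
    2 ^ n + 2 ^ n  ≡⟨ cong (2 ^ n +_) (sym (+-identityʳ _)) ⟩
    2 ^ suc n      ∎
    where open ≤-Reasoning

  -- The threshold is 2y with y = 2D, where 2^(2y) ≥ (y + 1)² already exceeds D (2y + 1); from there
  -- on the right side doubles at each step and the left side at most doubles.
  linear≤2^ : ∀ D → ∃[ x₀ ] (∀ x → x₀ ≤ x → D * suc x ≤ 2 ^ x)
  linear≤2^ D = y + y , λ x le → subst (λ z → D * suc z ≤ 2 ^ z) (m∸n+n≡m le) (go (x ∸ (y + y)))
    where
    open ≤-Reasoning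
    y = 2 * D
    base : ∀ D → D * suc (2 * D + 2 * D) + (3 * D + 1) ≡ suc (2 * D) * suc (2 * D)
    base = solve-∀
    double : ∀ D z → D * suc (suc z) + D * z ≡ 2 * (D * suc z)
    double = solve-∀
    go : ∀ k → D * suc (k + (y + y)) ≤ 2 ^ (k + (y + y))
    go zero = begin
      D * suc (y + y)       ≤⟨ m≤m+n _ (3 * D + 1) ⟩
      D * suc (y + y) + (3 * D + 1) ≡⟨ base D ⟩
      suc y * suc y         ≤⟨ *-mono-≤ (n<2^n y) (n<2^n y) ⟩
      2 ^ y * 2 ^ y         ≡⟨ sym (^-distribˡ-+-* 2 y y) ⟩
      2 ^ (y + y)           ∎
    go (suc k) = begin
      D * suc (suc (k + (y + y))) ≤⟨ m≤m+n _ (D * (k + (y + y))) ⟩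
      D * suc (suc (k + (y + y))) + D * (k + (y + y)) ≡⟨ double D (k + (y + y)) ⟩
      2 * (D * suc (k + (y + y))) ≤⟨ *-monoʳ-≤ 2 (go k) ⟩
      2 ^ suc (k + (y + y)) ∎

  -- With x = s / e, the base is at most C e (x + 1) ≤ 2^x by the linear case, and (2^x)^e ≤ 2^s.
  poly≤2^ : ∀ C e → ∃[ s₀ ] (∀ s → s₀ ≤ s → (C * suc s) ^ e ≤ 2 ^ s)
  poly≤2^ C zero      = 0 , λ s _ → m^n>0 2 s
  poly≤2^ C e@(suc _) = let (x₀ , h) = linear≤2^ (C * e) in x₀ * e , λ s le → bound x₀ h s le
    where
    open ≤-Reasoning
    bound : ∀ x₀ → (∀ x → x₀ ≤ x → C * e * suc x ≤ 2 ^ x) → ∀ s → x₀ * e ≤ s → (C * suc s) ^ e ≤ 2 ^ s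
    bound x₀ h s le = begin
      (C * suc s) ^ e        ≤⟨ ^-monoˡ-≤ e (*-monoʳ-≤ C s<) ⟩
      (C * (e * suc x)) ^ e  ≡⟨ cong (_^ e) (sym (*-assoc C e (suc x))) ⟩
      (C * e * suc x) ^ e    ≤⟨ ^-monoˡ-≤ e (h x (≤-trans (≤-reflexive (sym (m*n/n≡m x₀ e))) (/-monoˡ-≤ e le))) ⟩
      (2 ^ x) ^ e            ≡⟨ ^-*-assoc 2 x e ⟩
      2 ^ (x * e)            ≤⟨ ^-monoʳ-≤ 2 (m/n*n≤m s e) ⟩
      2 ^ s                  ∎
      where
      x = s / e
      s< : suc s ≤ e * suc x
      s< = begin
        suc s               ≡⟨ cong suc (m≡m%n+[m/n]*n s e) ⟩
        suc (s Data.Nat.% e) + x * e ≤⟨ +-monoˡ-≤ (x * e) (m%n<n s e) ⟩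
        e + x * e           ≡⟨ *-comm (suc x) e ⟩
        e * suc x           ∎

  *-^ : ∀ m n k → (m * n) ^ k ≡ m ^ k * n ^ k
  *-^ m n zero    = refl
  *-^ m n (suc k) = trans (cong (m * n *_) (*-^ m n k)) (interchange m n (m ^ k) (n ^ k))
    where
    interchange : ∀ a b c d → a * b * (c * d) ≡ a * c * (b * d)
    interchange = solve-∀

  -- These are the two leading terms of the binomial expansion. The inequality serves both the gain
  -- from switching and the comparison with the exponential series.
  bernoulli : ∀ β j → β ^ suc j + suc j * β ^ j ≤ suc β ^ suc j
  bernoulli β zero    = ≤-reflexive (base β)
    where
    base : ∀ β → β * 1 + 1 ≡ suc β * 1
    base = solve-∀
  bernoulli β (suc j) = begin
    β * (β * p) + suc (suc j) * (β * p)    ≤⟨ m≤m+n _ (suc j * p) ⟩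
    β * (β * p) + suc (suc j) * (β * p) + suc j * p ≡⟨ expand β j p ⟩
    suc β * (β * p + suc j * p)            ≤⟨ *-monoʳ-≤ (suc β) (bernoulli β j) ⟩
    suc β * suc β ^ suc j                  ∎
    where
    open ≤-Reasoning
    p = β ^ j
    expand : ∀ β j p → β * (β * p) + suc (suc j) * (β * p) + suc j * p ≡ suc β * (β * p + suc j * p)
    expand = solve-∀

  -- By Bernoulli, (1 + 1/β)^β ≥ 2: every β steps at rate β + 1 instead of β gain a factor 2.
  growth-gap : ∀ β → 1 ≤ β → ∀ X → 2 ^ X * β ^ (β * X) ≤ suc β ^ (β * X)
  growth-gap β@(suc b) _ X = begin
    2 ^ X * β ^ (β * X)      ≡⟨ cong (2 ^ X *_) (sym (^-*-assoc β β X)) ⟩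
    2 ^ X * (β ^ β) ^ X      ≡⟨ sym (*-^ 2 (β ^ β) X) ⟩
    (2 * β ^ β) ^ X          ≡⟨ cong (λ z → (β ^ β + z) ^ X) (+-identityʳ _) ⟩
    (β ^ β + β ^ β) ^ X      ≤⟨ ^-monoˡ-≤ X (bernoulli β b) ⟩
    (suc β ^ β) ^ X          ≡⟨ ^-*-assoc (suc β) β X ⟩
    suc β ^ (β * X)          ∎
    where open ≤-Reasoning

  m≤m*n′ : ∀ {m n} → 1 ≤ n → m ≤ m * n
  m≤m*n′ {m} {n} le = ≤-trans (≤-reflexive (sym (*-identityʳ m))) (*-monoʳ-≤ m le)

  m≤n*m′ : ∀ {m n} → 1 ≤ n → m ≤ n * m
  m≤n*m′ {m} {n} le = ≤-trans (m≤m*n′ le) (≤-reflexive (*-comm m n))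

  pos^ : ∀ {m} n → 1 ≤ m → 1 ≤ m ^ n
  pos^ n le = ≤-trans (≤-reflexive (sym (^-zeroˡ n))) (^-monoˡ-≤ n le)

  ^-mono-exp : ∀ {m j k} → 1 ≤ m → j ≤ k → m ^ j ≤ m ^ k
  ^-mono-exp {suc m} _ = ^-monoʳ-≤ (suc m)

  cancelʳ : ∀ {m n} o → 1 ≤ o → m * o ≤ n * o → m ≤ n
  cancelʳ (suc o) _ = *-cancelʳ-≤ _ _ (suc o)

  -- From the exponential bound to the ratio bound.

  -- An abstract form of the counting facts. `β` / `r` is B, expanded by a common factor that makes
  -- 1/`r` as fine as desired; `E` is the number of cells in a block; `N` counts polycubes by
  -- switchable blocks and full blocks, `V` by full blocks alone; powers (n + 2)^`g` absorb all
  -- polynomial factors.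
  module RatioBound
    (A : ℕ → ℕ) (N : ℕ → ℕ → ℕ → ℕ) (V : ℕ → ℕ → ℕ) (E g β r : ℕ)
    (1≤E : 1 ≤ E) (1≤r : 1 ≤ r) (r≤β : r ≤ β)
    (exp-bound   : ∀ n → A n * r ^ n ≤ (n + 2) ^ g * β ^ n)
    (split-bound : ∀ s M → 1 ≤ s → suc s ≤ M →
                   A M ≤ (M + 2) ^ g * sumTo (suc s) (λ i → A (suc s + i) * A (M ∸ (s + i))))
    (extension   : ∀ j n → j ≤ n → A j ≤ (n + 2) ^ g * A n)
    (flip        : ∀ n k v → N (suc n) k (suc v) * suc v ≡ N n k v * (k ∸ v))
    (N≤V         : ∀ n k v → N n k v ≤ V n v)
    (V≤A         : ∀ n v → V n v ≤ A n)
    (A≤ΣN        : ∀ n → A n ≤ sumTo (suc n) (λ k → sumTo (suc n) (λ v → N n k v)))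
    (ΣN≤A        : ∀ n K L → sumTo K (λ k → sumTo L (λ v → N n k v)) ≤ A n)
    (filling     : ∀ n v → (n ∸ E * v) * V n v ≤ E * suc v * 2 ^ E * sumTo (suc E) (λ i → V (n + i) (suc v)))
    where

    open ≤-Reasoning

    1≤β : 1 ≤ β
    1≤β = ≤-trans 1≤r r≤β

    module Growth (n s Z : ℕ) (1≤s : 1 ≤ s) (2s≤n : s + s ≤ n) (n≤Z : n + 2 ≤ Z) where

      1≤Z : 1 ≤ Z
      1≤Z = ≤-trans (≤-trans (s≤s z≤n) (m≤n+m 2 n)) n≤Z

      -- The cost of one cut: the factor of `split-bound`, the number of possible piece sizes, the
      -- factor of `exp-bound`, and one `β` for the cell that both pieces share.
      Q : ℕ
      Q = Z ^ g * Z * Z ^ g * β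

      1≤Q : 1 ≤ Q
      1≤Q = *-mono-≤ (*-mono-≤ (*-mono-≤ (pos^ g 1≤Z) 1≤Z) (pos^ g 1≤Z)) 1≤β

      bound : ℕ → ℕ → ℕ
      bound J w = Q ^ J * Z ^ g * (β ^ w * A n)

      -- This is A(M) ≤ poly · B^(M - n + 2s) · A(n) for at most `J` cuts. Each cut piece is
      -- estimated by the exponential bound and the remainder by induction, until its size is at
      -- most n and `extension` applies. The offset `s + s` in the exponent keeps it a natural
      -- number when a cut leaves fewer than n cells.
      growth : ∀ J M w → M + 2 ≤ Z → M ≤ n + J * s → M + (s + s) ≡ n + w → A M * r ^ w ≤ bound J w
      growth zero M w M≤Z M≤ eq = begin
        A M * r ^ w                    ≤⟨ *-mono-≤ (extension M n (≤-trans M≤ (≤-reflexive (+-identityʳ n)))) (^-monoˡ-≤ w r≤β) ⟩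
        (n + 2) ^ g * A n * β ^ w      ≤⟨ *-monoˡ-≤ (β ^ w) (*-monoˡ-≤ (A n) (^-monoˡ-≤ g n≤Z)) ⟩
        Z ^ g * A n * β ^ w            ≡⟨ reorder (Z ^ g) (A n) (β ^ w) ⟩
        bound 0 w                      ∎
        where
        reorder : ∀ x y z → x * y * z ≡ 1 * x * (z * y)
        reorder = solve-∀
      growth (suc J) M w M≤Z M≤ eq with M ≤? n + J * s
      ... | yes M≤′ = begin
        A M * r ^ w ≤⟨ growth J M w M≤Z M≤′ eq ⟩
        bound J w   ≤⟨ *-monoˡ-≤ (β ^ w * A n) (*-monoˡ-≤ (Z ^ g) (m≤n*m′ 1≤Q)) ⟩
        bound (suc J) w ∎
      ... | no M≰ = begin
        -- The pieces share the cut cell, so their exponents `k` and `w′` add up to `suc w`.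
        A M * r ^ w                    ≤⟨ *-monoʳ-≤ (A M) (^-mono-exp 1≤r (n≤1+n w)) ⟩
        A M * r ^ suc w                ≤⟨ *-monoˡ-≤ (r ^ suc w) (split-bound s M 1≤s s<M) ⟩
        (M + 2) ^ g * sumTo (suc s) (λ i → A (suc s + i) * A (M ∸ (s + i))) * r ^ suc w
                                       ≡⟨ into-sum ((M + 2) ^ g) _ (r ^ suc w) ⟩
        (M + 2) ^ g * (r ^ suc w * sumTo (suc s) (λ i → A (suc s + i) * A (M ∸ (s + i))))
                                       ≡⟨ cong ((M + 2) ^ g *_) (sym (sumTo-*ˡ (suc s) (r ^ suc w) _)) ⟩
        (M + 2) ^ g * sumTo (suc s) (λ i → r ^ suc w * (A (suc s + i) * A (M ∸ (s + i))))
                                       ≤⟨ *-mono-≤ (^-monoˡ-≤ g M≤Z) (sumTo-≤-const (suc s) term (λ i i< → piece i (≤-pred i<))) ⟩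
        Z ^ g * (suc s * term)         ≤⟨ *-monoʳ-≤ (Z ^ g) (*-monoˡ-≤ term s<Z) ⟩
        Z ^ g * (Z * term)             ≡⟨ collect (Z ^ g) Z β (β ^ w) (Q ^ J) (A n) ⟩
        bound (suc J) w                ∎
        where
        term : ℕ
        term = Z ^ g * (Q ^ J * Z ^ g) * (β * β ^ w * A n)
        n<M : n < M
        n<M = ≤-<-trans (m≤m+n n (J * s)) (≰⇒> M≰)
        2s<M : s + s < M
        2s<M = ≤-<-trans 2s≤n n<M
        s<M : suc s ≤ M
        s<M = ≤-trans (s≤s (m≤m+n s s)) 2s<M
        s<Z : suc s ≤ Z
        s<Z = ≤-trans s<M (≤-trans (m≤m+n M 2) M≤Z)
        into-sum : ∀ x y z → x * y * z ≡ x * (z * y)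
        into-sum = solve-∀
        collect : ∀ x z b bw q a → x * (z * (x * (q * x) * (b * bw * a))) ≡ (x * z * x * b) * q * x * (bw * a)
        collect = solve-∀
        2s<w : s + s < w
        2s<w = +-cancelˡ-< n (s + s) w (≤-trans (+-monoˡ-< (s + s) n<M) (≤-reflexive eq))
        piece : ∀ i → i ≤ s → r ^ suc w * (A (suc s + i) * A (M ∸ (s + i))) ≤ term
        piece i i≤s = begin
          r ^ suc w * (A k * A M′)              ≡⟨ cong (_* (A k * A M′)) (trans (cong (r ^_) w≡) (^-distribˡ-+-* r k w′)) ⟩
          r ^ k * r ^ w′ * (A k * A M′)         ≡⟨ pair (r ^ k) (r ^ w′) (A k) (A M′) ⟩
          A k * r ^ k * (A M′ * r ^ w′)         ≤⟨ *-mono-≤ (exp-bound k) (growth J M′ w′ (≤-trans (+-monoˡ-≤ 2 (m∸n≤m M (s + i))) M≤Z) M′≤ eq′) ⟩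
          (k + 2) ^ g * β ^ k * bound J w′      ≤⟨ *-monoˡ-≤ (bound J w′) (*-monoˡ-≤ (β ^ k) (^-monoˡ-≤ g (≤-trans (+-monoˡ-≤ 2 k≤M) M≤Z))) ⟩
          Z ^ g * β ^ k * bound J w′            ≡⟨ merge (Z ^ g) (β ^ k) (Q ^ J) (β ^ w′) (A n) ⟩
          Z ^ g * (Q ^ J * Z ^ g) * (β ^ k * β ^ w′ * A n)
            ≡⟨ cong (λ z → Z ^ g * (Q ^ J * Z ^ g) * (z * A n)) (sym (trans (cong (β ^_) w≡) (^-distribˡ-+-* β k w′))) ⟩
          term                                  ∎
          where
          k = suc s + i
          M′ = M ∸ (s + i)
          w′ = w ∸ (s + i)
          s+i≤2s : s + i ≤ s + s
          s+i≤2s = +-monoʳ-≤ s i≤s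
          w≡ : suc w ≡ k + w′
          w≡ = cong suc (sym (m+[n∸m]≡n (≤-trans s+i≤2s (<⇒≤ 2s<w))))
          k≤M : k ≤ M
          k≤M = ≤-trans (s≤s s+i≤2s) 2s<M
          M′≤ : M′ ≤ n + J * s
          M′≤ = begin
            M ∸ (s + i)              ≤⟨ ∸-mono M≤ (m≤m+n s i) ⟩
            n + (s + J * s) ∸ s      ≡⟨ cong (_∸ s) (trans (cong (n +_) (+-comm s (J * s))) (sym (+-assoc n (J * s) s))) ⟩
            n + J * s + s ∸ s        ≡⟨ m+n∸n≡m (n + J * s) s ⟩
            n + J * s                ∎
          eq′ : M′ + (s + s) ≡ n + w′
          eq′ = +-cancelʳ-≡ (s + i) (M′ + (s + s)) (n + w′) (trans (swap M′ (s + s) (s + i))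
            (trans (cong (_+ (s + s)) (m∸n+n≡m (≤-trans s+i≤2s (<⇒≤ 2s<M))))
            (trans eq (trans (cong (n +_) (sym (m∸n+n≡m (≤-trans s+i≤2s (<⇒≤ 2s<w))))) (sym (+-assoc n w′ (s + i)))))))
            where
            swap : ∀ x y z → x + y + z ≡ x + z + y
            swap = solve-∀
          pair : ∀ x y a b → x * y * (a * b) ≡ a * x * (b * y)
          pair = solve-∀
          merge : ∀ x b q c a → x * b * (q * x * (c * a)) ≡ x * (q * x) * (b * c * a)
          merge = solve-∀

    module Pattern (n₀ h K T : ℕ)
      (large : (2 * K * E * 2 ^ E + 2 * E) * h ≤ n₀)
      (A≤T : ∀ M → n₀ ≤ M → M ≤ n₀ + E * h → A M ≤ T) where

      -- While fewer than 2h blocks are full, the full blocks hold few of the M cells, so almost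
      -- every cell marks a block to fill. `large` is exactly what makes the choices outnumber the
      -- overcounting by a factor `K`.
      pattern-step : ∀ M v → n₀ ≤ M → suc v ≤ h + h → K * V M v ≤ sumTo (suc E) (λ i → V (M + i) (suc v))
      pattern-step M v n₀≤M v<2h = cancelʳ c 1≤c (begin
        K * V M v * c          ≡⟨ *-swapʳ K (V M v) c ⟩
        K * c * V M v          ≤⟨ *-monoˡ-≤ (V M v) room ⟩
        (M ∸ E * v) * V M v    ≤⟨ filling M v ⟩
        c * sumTo (suc E) (λ i → V (M + i) (suc v)) ≡⟨ *-comm c _ ⟩
        sumTo (suc E) (λ i → V (M + i) (suc v)) * c ∎)
        where
        c = E * suc v * 2 ^ E
        1≤c : 1 ≤ c
        1≤c = *-mono-≤ (*-mono-≤ 1≤E (s≤s (z≤n {v}))) (m^n>0 2 E)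
        factor : ∀ K E p h → K * (E * (h + h) * p) + E * (h + h) ≡ (2 * K * E * p + 2 * E) * h
        factor = solve-∀
        room : K * c ≤ M ∸ E * v
        room = m+n≤o⇒m≤o∸n (K * c) (begin
          K * c + E * v
            ≤⟨ +-mono-≤ (*-monoʳ-≤ K (*-monoˡ-≤ (2 ^ E) (*-monoʳ-≤ E v<2h))) (*-monoʳ-≤ E (<⇒≤ v<2h)) ⟩
          K * (E * (h + h) * 2 ^ E) + E * (h + h) ≡⟨ factor K E (2 ^ E) h ⟩
          (2 * K * E * 2 ^ E + 2 * E) * h ≤⟨ ≤-trans large n₀≤M ⟩
          M ∎)

      -- Iterating the filling step: each round gains `K` and loses `E` + 1 for the possible
      -- increases in size. Starting from v ≤ h, there is room for h rounds below 2h.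
      few-full : ∀ j M v → n₀ ≤ M → M + E * j ≤ n₀ + E * h → v + j ≤ h + h → V M v * K ^ j ≤ suc E ^ j * T
      few-full zero M v n₀≤M M≤ v≤ = begin
        V M v * 1 ≡⟨ *-identityʳ _ ⟩
        V M v     ≤⟨ V≤A M v ⟩
        A M       ≤⟨ A≤T M n₀≤M (≤-trans (m≤m+n M (E * 0)) M≤) ⟩
        T         ≡⟨ sym (+-identityʳ T) ⟩
        1 * T     ∎
      few-full (suc j) M v n₀≤M M≤ v≤ = begin
        V M v * (K * K ^ j)    ≡⟨ shuffle (V M v) K (K ^ j) ⟩
        K ^ j * (K * V M v)    ≤⟨ *-monoʳ-≤ (K ^ j) (pattern-step M v n₀≤M (≤-trans (≤-trans (s≤s (m≤m+n v j)) (≤-reflexive (sym (+-suc v j)))) v≤)) ⟩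
        K ^ j * sumTo (suc E) (λ i → V (M + i) (suc v)) ≡⟨ sym (sumTo-*ˡ (suc E) (K ^ j) _) ⟩
        sumTo (suc E) (λ i → K ^ j * V (M + i) (suc v)) ≤⟨ sumTo-≤-const (suc E) _ (λ i i<E → rec i (≤-pred i<E)) ⟩
        suc E * (suc E ^ j * T) ≡⟨ sym (*-assoc (suc E) (suc E ^ j) T) ⟩
        suc E ^ suc j * T      ∎
        where
        shuffle : ∀ x y z → x * (y * z) ≡ z * (y * x)
        shuffle = solve-∀
        rec : ∀ i → i ≤ E → K ^ j * V (M + i) (suc v) ≤ suc E ^ j * T
        rec i i≤E = ≤-trans (≤-reflexive (*-comm (K ^ j) _))
          (few-full j (M + i) (suc v) (≤-trans n₀≤M (m≤m+n M i)) (begin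
            M + i + E * j     ≡⟨ +-assoc M i (E * j) ⟩
            M + (i + E * j)   ≤⟨ +-monoʳ-≤ M (+-monoˡ-≤ (E * j) i≤E) ⟩
            M + (E + E * j)   ≡⟨ cong (M +_) (sym (*-suc E j)) ⟩
            M + E * suc j     ≤⟨ M≤ ⟩
            n₀ + E * h        ∎)
          (≤-trans (≤-reflexive (sym (+-suc v j))) v≤))

    -- By `flip`, each switch multiplies the class by (k - v)/(v + 1), which the hypothesis keeps at
    -- or above (`β` + 1)/`r` along the whole chain.
    flip-chain : ∀ m n k v → (∀ i → i < m → suc β * (suc v + i) ≤ r * (k ∸ (v + i))) →
                 N n k v * suc β ^ m ≤ r ^ m * N (n + m) k (v + m)
    flip-chain zero n k v h = ≤-reflexive (trans (*-identityʳ _)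
      (trans (cong₂ (λ a b → N a k b) (sym (+-identityʳ n)) (sym (+-identityʳ v))) (sym (+-identityʳ _))))
    flip-chain (suc m) n k v h = begin
      N n k v * (suc β * suc β ^ m)      ≡⟨ sym (*-assoc (N n k v) (suc β) _) ⟩
      N n k v * suc β * suc β ^ m        ≤⟨ *-monoˡ-≤ (suc β ^ m) one ⟩
      r * N (suc n) k (suc v) * suc β ^ m ≡⟨ *-assoc r _ _ ⟩
      r * (N (suc n) k (suc v) * suc β ^ m) ≤⟨ *-monoʳ-≤ r (flip-chain m (suc n) k (suc v) λ i i<m →
         subst (λ z → suc β * suc z ≤ r * (k ∸ z)) (+-suc v i) (h (suc i) (s≤s i<m))) ⟩
      r * (r ^ m * N (suc n + m) k (suc v + m)) ≡⟨ sym (*-assoc r _ _) ⟩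
      r ^ suc m * N (suc n + m) k (suc v + m) ≡⟨ cong₂ (λ a b → r ^ suc m * N a k b) (sym (+-suc n m)) (sym (+-suc v m)) ⟩
      r ^ suc m * N (n + suc m) k (v + suc m) ∎
      where
      one : N n k v * suc β ≤ r * N (suc n) k (suc v)
      one = cancelʳ (suc v) (s≤s z≤n) (begin
        N n k v * suc β * suc v    ≡⟨ *-assoc (N n k v) (suc β) (suc v) ⟩
        N n k v * (suc β * suc v)  ≤⟨ *-monoʳ-≤ (N n k v) (subst (λ z → suc β * suc z ≤ r * (k ∸ z)) (+-identityʳ v) (h 0 (s≤s z≤n))) ⟩
        N n k v * (r * (k ∸ v))    ≡⟨ *-swapˡ (N n k v) r _ ⟩
        r * (N n k v * (k ∸ v))    ≡⟨ cong (r *_) (sym (flip n k v)) ⟩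
        r * (N (suc n) k (suc v) * suc v) ≡⟨ sym (*-assoc r _ _) ⟩
        r * N (suc n) k (suc v) * suc v ∎)

    -- `X`: switching J s = `β` X s centres gains 2^(X s) ≥ (2 β³)^s, enough for 2^s and for the
    -- excess β^(3s) in `growth`. `Y`: h = J s (β + 1 + r) full blocks suffice for J s switches to
    -- cost at most one unit of steepness. `K`: in h fillings it pays for 2^h, for the (E + 1)^h
    -- choices of sizes and for growth by β^((E + 3) h). `L`: n ≥ L h gives the room needed for
    -- filling. `Jm` bounds the number of cuts for sizes up to n + 1 + E h and n + 1 + J s.
    -- `exponent` is the degree of the accumulated polynomial factor.
    X J Y K L Jm exponent : ℕ
    X  = 2 * (β ^ 3)
    J  = β * X
    Y  = J * (suc β + r)
    K  = 2 * suc E * β ^ (E + 3)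
    L  = 2 * K * E * 2 ^ E + 2 * E
    Jm = E * Y + J + 2
    exponent = 2 + 1 + (g + 1 + g + 1) * Jm + g

    1≤J : 1 ≤ J
    1≤J = *-mono-≤ 1≤β (*-mono-≤ (s≤s (z≤n {1})) (pos^ 3 1≤β))

    1≤Y : 1 ≤ Y
    1≤Y = *-mono-≤ 1≤J (s≤s z≤n)

    2≤L : 2 ≤ L
    2≤L = ≤-trans (*-monoʳ-≤ 2 1≤E) (m≤n+m (2 * E) (2 * K * E * 2 ^ E))

    -- s is the unit of length: h = Y s is the number of full blocks regarded as few, and J s is the
    -- number of centres to be flipped.
    module Scale (n s : ℕ) (1≤s : 1 ≤ s) (L≤n : L * (Y * s) ≤ n)
      (small : (r * β * (n + Jm * s + 2)) ^ exponent ≤ 2 ^ s) where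

      h Z m : ℕ
      h = Y * s
      Z = n + Jm * s + 2
      m = J * s

      s≤h : s ≤ h
      s≤h = m≤n*m′ 1≤Y

      2s≤n : s + s ≤ n
      2s≤n = ≤-trans (≤-trans (≤-reflexive (cong (s +_) (sym (+-identityʳ s)))) (*-mono-≤ 2≤L s≤h)) L≤n

      open Growth n s Z 1≤s 2s≤n (+-monoˡ-≤ 2 (m≤m+n n (Jm * s)))

      grow : ∀ M w → M ≤ n + Jm * s → M + (s + s) ≡ n + w → A M * r ^ w ≤ Q ^ Jm * Z ^ g * (β ^ w * A n)
      grow M w M≤ = growth Jm M w (+-monoˡ-≤ 2 M≤) M≤

      -- A class is negligible when it has at most `R` / 2^s members.
      R : ℕ
      R = Q ^ Jm * Z ^ g * A n

      within : ∀ {k} → k ≤ E * Y * s + m + (s + s) → n + k ≤ n + Jm * s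
      within {k} le = +-monoʳ-≤ n (≤-trans le (≤-reflexive (factor (E * Y) J s)))
        where
        factor : ∀ a b s → a * s + b * s + (s + s) ≡ (a + b + 2) * s
        factor = solve-∀

      -- In K^h the factors (E + 1)^h and β^((E + 3) h) cancel against the choices of sizes and the
      -- growth of `A` up to size n + 1 + E h; what remains is 2^h ≥ 2^s.
      few : ∀ v → v ≤ h → V (suc n) v * 2 ^ s ≤ R
      few v v≤h = ≤-trans (*-monoʳ-≤ (V (suc n) v) (^-monoʳ-≤ 2 s≤h)) (cancelʳ c 1≤c (begin
        V (suc n) v * 2 ^ h * c         ≡⟨ collect₁ (V (suc n) v) (2 ^ h) (suc E ^ h) _ ⟩
        V (suc n) v * (2 ^ h * suc E ^ h * (β ^ (E + 3)) ^ h) ≡⟨ cong (V (suc n) v *_) (sym (trans (*-^ (2 * suc E) (β ^ (E + 3)) h) (cong (_* (β ^ (E + 3)) ^ h) (*-^ 2 (suc E) h)))) ⟩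
        V (suc n) v * K ^ h             ≤⟨ few-full h (suc n) v ≤-refl ≤-refl (+-monoˡ-≤ h v≤h) ⟩
        suc E ^ h * T                   ≡⟨ collect₂ (suc E ^ h) (Q ^ Jm * Z ^ g) _ (A n) ⟩
        R * c                           ∎))
        where
        B T c : ℕ
        B = (β ^ (E + 3)) ^ h
        T = Q ^ Jm * Z ^ g * (B * A n)
        c = suc E ^ h * B
        1≤c : 1 ≤ c
        1≤c = *-mono-≤ (pos^ h (s≤s (z≤n {E}))) (pos^ h (pos^ (E + 3) 1≤β))
        collect₁ : ∀ v p e b → v * p * (e * b) ≡ v * (p * e * b)
        collect₁ = solve-∀
        collect₂ : ∀ e q b a → e * (q * (b * a)) ≡ q * a * (e * b)
        collect₂ = solve-∀
        A≤T : ∀ M → suc n ≤ M → M ≤ suc n + E * h → A M ≤ T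
        A≤T M n<M M≤ = begin
          A M              ≤⟨ m≤m*n′ (pos^ w 1≤r) ⟩
          A M * r ^ w      ≤⟨ grow M w M≤′ eq ⟩
          Q ^ Jm * Z ^ g * (β ^ w * A n) ≤⟨ *-monoʳ-≤ (Q ^ Jm * Z ^ g) (*-monoˡ-≤ (A n) (≤-trans (^-mono-exp 1≤β w≤) (≤-reflexive (sym (^-*-assoc β (E + 3) h))))) ⟩
          T                ∎
          where
          w = (M ∸ n) + (s + s)
          n≤M = ≤-trans (n≤1+n n) n<M
          M∸n≤ : M ∸ n ≤ suc (E * h)
          M∸n≤ = m≤n+o⇒m∸n≤o M n (≤-trans M≤ (≤-reflexive (sym (+-suc n (E * h)))))
          eq : M + (s + s) ≡ n + w
          eq = trans (cong (_+ (s + s)) (sym (m+[n∸m]≡n n≤M))) (+-assoc n (M ∸ n) (s + s))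
          w≤ : w ≤ (E + 3) * h
          w≤ = begin
            M ∸ n + (s + s)           ≤⟨ +-mono-≤ M∸n≤ (+-mono-≤ s≤h s≤h) ⟩
            suc (E * h) + (h + h)     ≤⟨ +-monoˡ-≤ (h + h) (+-monoˡ-≤ (E * h) (≤-trans 1≤s s≤h)) ⟩
            h + E * h + (h + h)       ≡⟨ factor E h ⟩
            (E + 3) * h               ∎
            where
            factor : ∀ e h → h + e * h + (h + h) ≡ (e + 3) * h
            factor = solve-∀
          M≤′ : M ≤ n + Jm * s
          M≤′ = ≤-trans (≤-reflexive (sym (m+[n∸m]≡n n≤M))) (within (begin
            M ∸ n                     ≤⟨ M∸n≤ ⟩
            suc (E * h)               ≡⟨ trans (cong suc (sym (*-assoc E Y s))) (+-comm 1 (E * Y * s)) ⟩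
            E * Y * s + 1             ≤⟨ +-mono-≤ (m≤m+n (E * Y * s) m) (≤-trans 1≤s (m≤m+n s s)) ⟩
            E * Y * s + m + (s + s)   ∎))
        open Pattern (suc n) h K T (≤-trans L≤n (n≤1+n n)) A≤T

      -- A large steep class would, after `m` switches, produce more polycubes of size n + 1 + m
      -- than `growth` allows: switching runs at rate `β` + 1, growth only at rate `β`.
      many : ∀ k v → h ≤ v → suc (suc β) * suc v ≤ r * (k ∸ v) → N (suc n) k (suc v) * 2 ^ s ≤ R
      many k v h≤v steep = cancelʳ (β ^ w) (pos^ w 1≤β) (begin
        N₁ * 2 ^ s * β ^ w              ≤⟨ *-monoʳ-≤ (N₁ * 2 ^ s) (^-mono-exp 1≤β w≤) ⟩
        N₁ * 2 ^ s * β ^ (3 * s + m)    ≡⟨ trans (*-assoc N₁ (2 ^ s) _) (cong (N₁ *_) split) ⟩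
        N₁ * (2 * β ^ 3 * β ^ J) ^ s    ≤⟨ *-monoʳ-≤ N₁ (^-monoˡ-≤ s (≤-trans (*-monoˡ-≤ (β ^ J) (≤-trans (n≤1+n X) (n<2^n X))) (growth-gap β 1≤β X))) ⟩
        N₁ * (suc β ^ J) ^ s            ≡⟨ cong (N₁ *_) (^-*-assoc (suc β) J s) ⟩
        N₁ * suc β ^ m                  ≤⟨ flip-chain m (suc n) k (suc v) chain ⟩
        r ^ m * N (suc n + m) k (suc v + m) ≤⟨ *-mono-≤ (^-mono-exp 1≤r (≤-trans (m≤n+m m 1) (m≤m+n (1 + m) (s + s)))) (≤-trans (N≤V (suc n + m) k (suc v + m)) (V≤A (suc n + m) (suc v + m))) ⟩
        r ^ w * A (suc n + m)           ≡⟨ *-comm (r ^ w) _ ⟩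
        A (suc n + m) * r ^ w           ≤⟨ grow (suc n + m) w (≤-trans (≤-reflexive (sym (+-suc n m))) (within size)) eq ⟩
        Q ^ Jm * Z ^ g * (β ^ w * A n)  ≡⟨ collect (Q ^ Jm * Z ^ g) (β ^ w) (A n) ⟩
        R * β ^ w                       ∎)
        where
        w N₁ : ℕ
        w = 1 + m + (s + s)
        N₁ = N (suc n) k (suc v)
        collect : ∀ q b a → q * (b * a) ≡ q * a * b
        collect = solve-∀
        eq : suc n + m + (s + s) ≡ n + w
        eq = solve n m s
          where
          solve : ∀ n m s → suc n + m + (s + s) ≡ n + (1 + m + (s + s))
          solve = solve-∀
        size : suc m ≤ E * Y * s + m + (s + s)
        size = begin
          suc m                ≡⟨ +-comm 1 m ⟩
          m + 1                ≤⟨ +-mono-≤ (m≤n+m m (E * Y * s)) (≤-trans 1≤s (m≤m+n s s)) ⟩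
          E * Y * s + m + (s + s) ∎
        w≤ : w ≤ 3 * s + m
        w≤ = ≤-trans (+-monoˡ-≤ (s + s) (+-monoˡ-≤ m 1≤s)) (≤-reflexive (factor s m))
          where
          factor : ∀ s m → s + m + (s + s) ≡ 3 * s + m
          factor = solve-∀
        split : 2 ^ s * β ^ (3 * s + m) ≡ (2 * β ^ 3 * β ^ J) ^ s
        split = begin-equality
          2 ^ s * β ^ (3 * s + m)              ≡⟨ cong (2 ^ s *_) (^-distribˡ-+-* β (3 * s) m) ⟩
          2 ^ s * (β ^ (3 * s) * β ^ (J * s))  ≡⟨ cong₂ (λ a b → 2 ^ s * (a * b)) (sym (^-*-assoc β 3 s)) (sym (^-*-assoc β J s)) ⟩
          2 ^ s * ((β ^ 3) ^ s * (β ^ J) ^ s)  ≡⟨ sym (*-assoc (2 ^ s) _ _) ⟩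
          2 ^ s * (β ^ 3) ^ s * (β ^ J) ^ s    ≡⟨ cong (_* (β ^ J) ^ s) (sym (*-^ 2 (β ^ 3) s)) ⟩
          (2 * β ^ 3) ^ s * (β ^ J) ^ s        ≡⟨ sym (*-^ (2 * β ^ 3) (β ^ J) s) ⟩
          (2 * β ^ 3 * β ^ J) ^ s              ∎
        chain : ∀ i → i < m → suc β * (suc (suc v) + i) ≤ r * (k ∸ (suc v + i))
        chain i i<m = begin
          suc β * (suc (suc v) + i)            ≤⟨ m+n≤o⇒m≤o∸n _ budget ⟩
          r * (k ∸ v) ∸ r * suc i              ≡⟨ sym (*-distribˡ-∸ r (k ∸ v) (suc i)) ⟩
          r * (k ∸ v ∸ suc i)                  ≡⟨ cong (r *_) (trans (∸-+-assoc k v (suc i)) (cong (k ∸_) (+-suc v i))) ⟩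
          r * (k ∸ (suc v + i))                ∎
          where
          expand : ∀ b v i r → suc b * (suc (suc v) + i) + r * suc i ≡ suc b * suc v + suc i * (suc b + r)
          expand = solve-∀
          -- Each switch lowers k - v and raises v, which costs `suc β + r`. All `m` of them cost at
          -- most h ≤ v, and so at most one unit of the steepness `β` + 2.
          budget : suc β * (suc (suc v) + i) + r * suc i ≤ r * (k ∸ v)
          budget = begin
            suc β * (suc (suc v) + i) + r * suc i   ≡⟨ expand β v i r ⟩
            suc β * suc v + suc i * (suc β + r)     ≤⟨ +-monoʳ-≤ (suc β * suc v) (*-monoˡ-≤ (suc β + r) i<m) ⟩
            suc β * suc v + J * s * (suc β + r)     ≡⟨ cong (suc β * suc v +_) (*-swapʳ J s (suc β + r)) ⟩
            suc β * suc v + h                       ≤⟨ +-monoʳ-≤ (suc β * suc v) (≤-trans h≤v (n≤1+n v)) ⟩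
            suc β * suc v + suc v                   ≡⟨ +-comm (suc β * suc v) (suc v) ⟩
            suc (suc β) * suc v                     ≤⟨ steep ⟩
            r * (k ∸ v)                             ∎

      -- Switching on a centre raises v together with n, so a class of size n + 1 is compared with
      -- the class of index v - 1 of size n. The value 0 at v = 0 is harmless, since such classes
      -- are negligible by `few`.
      previous : ℕ → ℕ → ℕ
      previous k zero    = 0
      previous k (suc v) = N n k v

      tiny : ∀ k v → N (suc n) k v * 2 ^ s ≤ R →
             2 ^ s * (r * N (suc n) k v) ≤ 2 ^ s * ((β + 2) * previous k v) + r * R
      tiny k v le = ≤-trans (≤-reflexive (rotate (2 ^ s) r (N (suc n) k v)))
        (≤-trans (*-monoʳ-≤ r le) (m≤n+m (r * R) _))
        where
        rotate : ∀ p r x → p * (r * x) ≡ r * (x * p)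
        rotate = solve-∀

      -- Three regimes: few full blocks, flat and steep. In the flat one the switching identity
      -- gives the factor `β` + 2 directly; the other two are negligible.
      class-bound : ∀ k v → 2 ^ s * (r * N (suc n) k v) ≤ 2 ^ s * ((β + 2) * previous k v) + r * R
      class-bound k v with v ≤? h
      ... | yes v≤h = tiny k v (≤-trans (*-monoˡ-≤ (2 ^ s) (N≤V (suc n) k v)) (few v v≤h))
      class-bound k zero    | no v≰h with () ← v≰h z≤n
      class-bound k (suc v) | no v≰h with r * (k ∸ v) ≤? (β + 2) * suc v
      ... | yes flat = ≤-trans (*-monoʳ-≤ (2 ^ s) (cancelʳ (suc v) (s≤s z≤n) (begin
        r * N (suc n) k (suc v) * suc v   ≡⟨ *-assoc r _ _ ⟩
        r * (N (suc n) k (suc v) * suc v) ≡⟨ cong (r *_) (flip n k v) ⟩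
        r * (N n k v * (k ∸ v))           ≡⟨ *-swapˡ r (N n k v) (k ∸ v) ⟩
        N n k v * (r * (k ∸ v))           ≤⟨ *-monoʳ-≤ (N n k v) flat ⟩
        N n k v * ((β + 2) * suc v)       ≡⟨ sym (*-assoc (N n k v) (β + 2) (suc v)) ⟩
        N n k v * (β + 2) * suc v         ≡⟨ cong (_* suc v) (*-comm (N n k v) (β + 2)) ⟩
        (β + 2) * N n k v * suc v         ∎))) (m≤m+n _ (r * R))
      ... | no steep = tiny k (suc v) (many k v (≤-pred (≰⇒> v≰h))
        (≤-trans (≤-reflexive (cong (_* suc v) (+-comm 2 β))) (<⇒≤ (≰⇒> steep))))

      sum-previous : ∀ k L → sumTo (suc L) (previous k) ≡ sumTo L (N n k)
      sum-previous k zero    = refl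
      sum-previous k (suc L) = cong (N n k L +_) (sum-previous k L)

      -- There are (n + 2)² classes at size n + 1, each with error `r * R`. The total is A(n) times
      -- a polynomial of degree `exponent` in `U`, which `small` puts below 2^s.
      remainder : (n + 2) * ((n + 2) * (r * R)) ≤ 2 ^ s * A n
      remainder = begin
        (n + 2) * ((n + 2) * (r * R))
          ≤⟨ *-mono-≤ n≤Z (*-monoˡ-≤ (r * R) n≤Z) ⟩
        Z * (Z * (r * R))
          ≡⟨ collect Z r (Q ^ Jm) (Z ^ g) (A n) ⟩
        Z * Z * r * Q ^ Jm * Z ^ g * A n
          ≤⟨ *-monoˡ-≤ (A n) (*-mono-≤ (*-mono-≤ (*-mono-≤ (*-mono-≤ Z≤U Z≤U) r≤U) Q≤U) (^-monoˡ-≤ g Z≤U)) ⟩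
        U * U * U * (U ^ (g + 1 + g + 1)) ^ Jm * U ^ g * A n
          ≡⟨ cong (_* A n) powers ⟩
        U ^ exponent * A n
          ≤⟨ *-monoˡ-≤ (A n) small ⟩
        2 ^ s * A n ∎
        where
        U = r * β * Z
        n≤Z : n + 2 ≤ Z
        n≤Z = +-monoˡ-≤ 2 (m≤m+n n (Jm * s))
        Z≤U : Z ≤ U
        Z≤U = m≤n*m′ (*-mono-≤ 1≤r 1≤β)
        r≤U : r ≤ U
        r≤U = ≤-trans (m≤m*n′ 1≤β) (m≤m*n′ 1≤Z)
        β≤U : β ≤ U
        β≤U = ≤-trans (m≤n*m′ 1≤r) (m≤m*n′ 1≤Z)
        Q≤U : Q ^ Jm ≤ (U ^ (g + 1 + g + 1)) ^ Jm
        Q≤U = ^-monoˡ-≤ Jm (≤-trans (*-mono-≤ (*-mono-≤ (*-mono-≤ (^-monoˡ-≤ g Z≤U) Z≤U) (^-monoˡ-≤ g Z≤U)) β≤U)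
          (≤-reflexive (sym (trans (^-distribˡ-+-* U (g + 1 + g) 1) (cong₂ _*_ (trans (^-distribˡ-+-* U (g + 1) g)
            (cong (_* U ^ g) (trans (^-distribˡ-+-* U g 1) (cong (U ^ g *_) (*-identityʳ U))))) (*-identityʳ U))))))
        collect : ∀ z r q p a → z * (z * (r * (q * p * a))) ≡ z * z * r * q * p * a
        collect = solve-∀
        powers : U * U * U * (U ^ (g + 1 + g + 1)) ^ Jm * U ^ g ≡ U ^ exponent
        powers = sym (trans (^-distribˡ-+-* U (3 + (g + 1 + g + 1) * Jm) g) (cong (_* U ^ g)
          (trans (^-distribˡ-+-* U 3 ((g + 1 + g + 1) * Jm))
            (cong₂ _*_ (cube U) (sym (^-*-assoc U (g + 1 + g + 1) Jm))))))
          where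
          cube : ∀ u → u * (u * (u * 1)) ≡ u * u * u
          cube = solve-∀

      -- Two units of the slack in `β` + 3 are the threshold between flat and steep classes, the
      -- third is the sum of all negligible classes.
      ratio : r * A (suc n) ≤ (β + 3) * A n
      ratio = cancelʳ (2 ^ s) (m^n>0 2 s) (begin
        r * A (suc n) * 2 ^ s
          ≤⟨ *-monoˡ-≤ (2 ^ s) (*-monoʳ-≤ r (A≤ΣN (suc n))) ⟩
        r * sumTo (2 + n) (λ k → sumTo (2 + n) (λ v → N (suc n) k v)) * 2 ^ s
          ≡⟨ push (2 + n) (2 ^ s) r (N (suc n)) ⟩
        sumTo (2 + n) (λ k → sumTo (2 + n) (λ v → 2 ^ s * (r * N (suc n) k v)))
          ≤⟨ sumTo-mono (2 + n) (λ k _ → sumTo-mono (2 + n) λ v _ → class-bound k v) ⟩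
        sumTo (2 + n) (λ k → sumTo (2 + n) (λ v → 2 ^ s * ((β + 2) * previous k v) + r * R))
          ≡⟨ add-const (2 + n) (λ k v → 2 ^ s * ((β + 2) * previous k v)) (r * R) ⟩
        sumTo (2 + n) (λ k → sumTo (2 + n) (λ v → 2 ^ s * ((β + 2) * previous k v))) + (2 + n) * ((2 + n) * (r * R))
          ≡⟨ cong (_+ (2 + n) * ((2 + n) * (r * R))) (sym (push (2 + n) (2 ^ s) (β + 2) previous)) ⟩
        (β + 2) * sumTo (2 + n) (λ k → sumTo (2 + n) (previous k)) * 2 ^ s + (2 + n) * ((2 + n) * (r * R))
          ≤⟨ +-mono-≤ (*-monoˡ-≤ (2 ^ s) (*-monoʳ-≤ (β + 2) (≤-trans (≤-reflexive (sumTo-cong (2 + n) λ k _ → sum-previous k (suc n))) (ΣN≤A n (2 + n) (suc n)))))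
               (subst (λ z → z * (z * (r * R)) ≤ 2 ^ s * A n) (+-comm n 2) remainder) ⟩
        (β + 2) * A n * 2 ^ s + 2 ^ s * A n
          ≡⟨ collect β (A n) (2 ^ s) ⟩
        (β + 3) * A n * 2 ^ s ∎)
        where
        collect : ∀ b a p → (b + 2) * a * p + p * a ≡ (b + 3) * a * p
        collect = solve-∀
        reorder : ∀ c x p → c * x * p ≡ p * (c * x)
        reorder = solve-∀
        push : ∀ W p c (f : ℕ → ℕ → ℕ) → c * sumTo W (λ k → sumTo W (f k)) * p ≡
               sumTo W (λ k → sumTo W (λ v → p * (c * f k v)))
        push W p c f = begin-equality
          c * sumTo W (λ k → sumTo W (f k)) * p
            ≡⟨ reorder c (sumTo W (λ k → sumTo W (f k))) p ⟩
          p * (c * sumTo W (λ k → sumTo W (f k)))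
            ≡⟨ cong (p *_) (sym (sumTo-*ˡ W c (λ k → sumTo W (f k)))) ⟩
          p * sumTo W (λ k → c * sumTo W (f k))
            ≡⟨ sym (sumTo-*ˡ W p (λ k → c * sumTo W (f k))) ⟩
          sumTo W (λ k → p * (c * sumTo W (f k)))
            ≡⟨ sumTo-cong W (λ k _ → trans (cong (p *_) (sym (sumTo-*ˡ W c (f k)))) (sym (sumTo-*ˡ W p (λ v → c * f k v)))) ⟩
          sumTo W (λ k → sumTo W (λ v → p * (c * f k v))) ∎
        add-const : ∀ W (f : ℕ → ℕ → ℕ) c → sumTo W (λ k → sumTo W (λ v → f k v + c)) ≡
                    sumTo W (λ k → sumTo W (f k)) + W * (W * c)
        add-const W f c = begin-equality
          sumTo W (λ k → sumTo W (λ v → f k v + c))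
            ≡⟨ sumTo-cong W (λ k _ → trans (sumTo-+ W (f k) (λ _ → c)) (cong (sumTo W (f k) +_) (sumTo-const W c))) ⟩
          sumTo W (λ k → sumTo W (f k) + W * c)
            ≡⟨ trans (sumTo-+ W (λ k → sumTo W (f k)) (λ _ → W * c)) (cong (sumTo W (λ k → sumTo W (f k)) +_) (sumTo-const W (W * c))) ⟩
          sumTo W (λ k → sumTo W (f k)) + W * (W * c) ∎

    eventual-ratio : ∃[ n₀ ] (∀ n → n₀ ≤ n → r * A (suc n) ≤ (β + 3) * A n)
    eventual-ratio = D * suc s₀ , large
      where
      -- With s = n / D, h = Y s is at most n / L, while n and all sizes in play stay linear in s,
      -- as `small` demands.
      D = L * Y
      C = r * β * (D + Jm + 2)
      s₀ = proj₁ (poly≤2^ C exponent)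
      instance
        D≢0 : NonZero D
        D≢0 = >-nonZero (*-mono-≤ (≤-trans (s≤s z≤n) 2≤L) 1≤Y)
      large : ∀ n → D * suc s₀ ≤ n → r * A (suc n) ≤ (β + 3) * A n
      large n le = Scale.ratio n s (≤-trans (s≤s z≤n) s₀<s) L≤n small
        where
        s = n / D
        s₀<s : suc s₀ ≤ s
        s₀<s = ≤-trans (≤-reflexive (sym (trans (cong (_/ D) (*-comm D (suc s₀))) (m*n/n≡m (suc s₀) D)))) (/-monoˡ-≤ D le)
        L≤n : L * (Y * s) ≤ n
        L≤n = ≤-trans (≤-reflexive (trans (sym (*-assoc L Y s)) (*-comm D s))) (m/n*n≤m n D)
        n≤ : n ≤ D * suc s
        n≤ = begin
          n                          ≡⟨ m≡m%n+[m/n]*n n D ⟩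
          n Data.Nat.% D + s * D     ≤⟨ +-monoˡ-≤ (s * D) (<⇒≤ (m%n<n n D)) ⟩
          D + s * D                  ≡⟨ *-comm (suc s) D ⟩
          D * suc s                  ∎
        Z≤ : n + Jm * s + 2 ≤ (D + Jm + 2) * suc s
        Z≤ = begin
          n + Jm * s + 2             ≤⟨ +-mono-≤ (+-mono-≤ n≤ (*-monoʳ-≤ Jm (n≤1+n s))) (m≤m*n′ {2} {suc s} (s≤s z≤n)) ⟩
          D * suc s + Jm * suc s + 2 * suc s ≡⟨ factor D Jm (suc s) ⟩
          (D + Jm + 2) * suc s       ∎
          where
          factor : ∀ a b s → a * s + b * s + 2 * s ≡ (a + b + 2) * s
          factor = solve-∀
        small : (r * β * (n + Jm * s + 2)) ^ exponent ≤ 2 ^ s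
        small = ≤-trans (^-monoˡ-≤ exponent (≤-trans (*-monoʳ-≤ (r * β) Z≤) (≤-reflexive (sym (*-assoc (r * β) _ (suc s))))))
          (proj₂ (poly≤2^ C exponent) s (≤-trans (n≤1+n s₀) s₀<s))

-- Counting with duplicate-free lists.

module Polycubes where
  open import Data.Bool using (Bool; true; false; T; _∧_; _∨_; not)
  open import Data.Bool.ListAction using (any)
  import Data.Bool.Properties as Bool
  open import Data.Bool.Properties using (T?; T-∧; T-∨)
  open import Data.Empty using (⊥)
  open import Data.Fin using (Fin; zero; suc; toℕ; fromℕ<)
  open import Data.Fin.Properties using (toℕ-fromℕ<; toℕ<n) renaming (_≟_ to _≟F_)
  open import Data.List
    using (List; []; _∷_; _++_; map; concatMap; filter; length; filterᵇ; upTo; deduplicate; allFin)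
  import Data.List.Membership.DecPropositional as DecMem
  open import Data.List.Membership.Propositional using (_∈_; _∉_; find; lose)
  open import Data.List.Membership.Propositional.Properties
    using (∈-∃++; ∈-++⁺ˡ; ∈-++⁺ʳ; ∈-++⁻; ∈-map⁺; ∈-map⁻; ∈-filter⁺; ∈-filter⁻; ∈-upTo⁺; ∈-upTo⁻;
           ∈-concatMap⁺; ∈-concatMap⁻; ∈-length; ∈-deduplicate⁺; ∈-deduplicate⁻; ∈-allFin)
  open import Data.List.Properties
    using (length-++; length-map; filter-accept; filter-reject; length-upTo; ++-assoc;
           length-filter; length-tabulate)
  open import Data.List.Relation.Binary.Permutation.Propositional
    using (_↭_; ↭-refl; ↭-sym; ↭-trans; ↭⇒↭ₛ; ↭-reflexive)
  open import Data.List.Relation.Binary.Permutation.Propositional.Properties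
    using (↭-length; ∈-resp-↭; ++⁺ˡ; ++⁺ʳ; shift; ++-comm; shifts)
  import Data.List.Relation.Binary.Permutation.Setoid.Properties as PermSetoid
  import Data.List.Relation.Unary.All as All
  open import Data.List.Relation.Unary.All using (All; []; _∷_; all?)
  import Data.List.Relation.Unary.All.Properties as AllP
  open import Data.List.Relation.Unary.All.Properties using (All¬⇒¬Any; ¬Any⇒All¬)
  open import Data.List.Relation.Unary.AllPairs using ([]; _∷_)
  open import Data.List.Relation.Unary.Any using (here; there)
  open import Data.List.Relation.Unary.Any.Properties using (any⁺; any⁻)
  import Data.List.Relation.Unary.Unique.DecPropositional.Properties as DecUniq
  open import Data.List.Relation.Unary.Unique.Propositional using (Unique)
  import Data.List.Relation.Unary.Unique.Propositional.Properties as Uniq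
  open import Data.Nat
    using (ℕ; zero; suc; _+_; _*_; _∸_; _^_; _≤_; _<_; z≤n; s≤s; _≟_; pred; ∣_-_∣; _≡ᵇ_; _⊓_; _/_;
           _%_)
  open import Data.Nat.DivMod using (m≡m%n+[m/n]*n; m%n<n; m*n/n≡m; m<n⇒m/n≡0; +-distrib-/-∣ʳ)
  open import Data.Nat.Divisibility using (divides-refl)
  open import Data.Nat.Properties
  open import Data.Nat.Tactic.RingSolver using (solve-∀)
  open import Data.Product using (∃-syntax; _×_; _,_; proj₁; proj₂)
  open import Data.Product.Properties using (≡-dec)
  open import Data.Sum using (_⊎_; inj₁; inj₂)
  open import Data.Vec using (Vec; []; _∷_; lookup; updateAt; zipWith; toList)
  import Data.Vec.Properties as Vec
  open import Function using (_∘_; id)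
  open import Function.Bundles using (Equivalence)
  open import Level using (0ℓ)
  open import Relation.Binary using (DecidableEquality)
  import Relation.Binary.Construct.Closure.ReflexiveTransitive as Star
  open import Relation.Binary.Construct.Closure.ReflexiveTransitive using (Star; ε; _◅_; _◅◅_; gmap)
  open import Relation.Binary.PropositionalEquality
  open import Relation.Nullary using (¬_; yes; no; contradiction; Dec)
  open import Relation.Nullary.Decidable using (does; ¬?; _×-dec_)
  open import Relation.Unary using (Pred; Decidable)
  open Sums
  open Asymptotics using (m≤m*n′; cancelʳ)

  private variable
    d n : ℕ
    X X′ Z Z′ : Set

  ∈-cons-remove : ∀ {x y : X} {ys zs} → y ∈ ys ++ x ∷ zs → y ≢ x → y ∈ ys ++ zs
  ∈-cons-remove {ys = ys} y∈ y≢x with ∈-++⁻ ys y∈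
  ... | inj₁ p         = ∈-++⁺ˡ p
  ... | inj₂ (here e)  = contradiction e y≢x
  ... | inj₂ (there p) = ∈-++⁺ʳ ys p

  unique-∉ : ∀ {x : X} {xs} → Unique (x ∷ xs) → x ∉ xs
  unique-∉ (x# ∷ _) = All¬⇒¬Any x#

  unique-∷ : ∀ {x : X} {xs} → x ∉ xs → Unique xs → Unique (x ∷ xs)
  unique-∷ x∉ u = ¬Any⇒All¬ _ x∉ ∷ u

  unique-tail : ∀ {x : X} {xs} → Unique (x ∷ xs) → Unique xs
  unique-tail (_ ∷ u) = u

  unique-⊆-length : ∀ {xs ys : List X} → Unique xs → (∀ {x} → x ∈ xs → x ∈ ys) →
                    length xs ≤ length ys
  unique-⊆-length {xs = []}     u sub = z≤n
  unique-⊆-length {xs = x ∷ xs} u sub with ∈-∃++ (sub (here refl))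
  ... | ys , zs , refl = begin
    suc (length xs)         ≤⟨ s≤s (unique-⊆-length (unique-tail u) sub′) ⟩
    suc (length (ys ++ zs)) ≡⟨ cong suc (length-++ ys) ⟩
    suc (length ys + length zs) ≡⟨ sym (+-suc (length ys) (length zs)) ⟩
    length ys + suc (length zs) ≡⟨ sym (length-++ ys) ⟩
    length (ys ++ x ∷ zs)   ∎
    where
    open ≤-Reasoning
    sub′ : ∀ {y} → y ∈ xs → y ∈ ys ++ zs
    sub′ y∈ = ∈-cons-remove {ys = ys} (sub (there y∈)) λ { refl → unique-∉ u y∈ }

  same-members-length : ∀ {xs ys : List X} → Unique xs → Unique ys →
    (∀ {x} → x ∈ xs → x ∈ ys) → (∀ {x} → x ∈ ys → x ∈ xs) → length xs ≡ length ys
  same-members-length u v p q = ≤-antisym (unique-⊆-length u p) (unique-⊆-length v q)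

  -- Injectivity of an encoding is expressed by a decoder, so that an upper bound on a count only
  -- needs a code from which each object is recovered.
  unique-decode-length : ∀ {xs : List X} {cs : List X′} (dec : X′ → X) → Unique xs →
    (∀ {x} → x ∈ xs → ∃[ c ] (c ∈ cs × x ≡ dec c)) → length xs ≤ length cs
  unique-decode-length {cs = cs} dec u f = subst (_ ≤_) (length-map dec cs)
    (unique-⊆-length u λ x∈ → let (c , c∈ , e) = f x∈ in
      subst (_∈ map dec cs) (sym e) (∈-map⁺ dec c∈))

  pairs : (X → List Z) → List X → List (X × Z)
  pairs f xs = concatMap (λ x → map (x ,_) (f x)) xs

  ∈-pairs⁺ : ∀ (f : X → List Z) {xs x z} → x ∈ xs → z ∈ f x → (x , z) ∈ pairs f xs
  ∈-pairs⁺ f {x ∷ xs} (here refl) z∈ = ∈-++⁺ˡ (∈-map⁺ (x ,_) z∈)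
  ∈-pairs⁺ f {y ∷ xs} (there p)   z∈ = ∈-++⁺ʳ (map (y ,_) (f y)) (∈-pairs⁺ f p z∈)

  ∈-pairs⁻ : ∀ (f : X → List Z) {xs x z} → (x , z) ∈ pairs f xs → x ∈ xs × z ∈ f x
  ∈-pairs⁻ f {y ∷ xs} p with ∈-++⁻ (map (y ,_) (f y)) p
  ... | inj₁ q with ∈-map⁻ (y ,_) q
  ...   | _ , z∈ , refl = here refl , z∈
  ∈-pairs⁻ f {y ∷ xs} p | inj₂ q = let (a , b) = ∈-pairs⁻ f q in there a , b

  pairs-unique : ∀ (f : X → List Z) {xs} → Unique xs → (∀ {x} → x ∈ xs → Unique (f x)) →
                 Unique (pairs f xs)
  pairs-unique f {[]}     u v = []
  pairs-unique f {x ∷ xs} u v =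
    Uniq.++⁺ (Uniq.map⁺ (cong proj₂) (v (here refl)))
             (pairs-unique f (unique-tail u) (v ∘ there))
             λ { (p , q) → disjoint p q }
    where
    disjoint : ∀ {w} → w ∈ map (x ,_) (f x) → w ∈ pairs f xs → ⊥
    disjoint p q with ∈-map⁻ (x ,_) p
    ... | _ , _ , refl = unique-∉ u (proj₁ (∈-pairs⁻ f q))

  pairs-length-≥ : ∀ (f : X → List Z) {xs} p → (∀ {x} → x ∈ xs → p ≤ length (f x)) →
                   p * length xs ≤ length (pairs f xs)
  pairs-length-≥ f {[]}     p h = ≤-reflexive (*-zeroʳ p)
  pairs-length-≥ f {x ∷ xs} p h = begin
    p * suc (length xs)  ≡⟨ *-suc p (length xs) ⟩
    p + p * length xs    ≤⟨ +-mono-≤ (h (here refl)) (pairs-length-≥ f p (h ∘ there)) ⟩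
    length (f x) + length (pairs f xs) ≡⟨ cong (_+ _) (sym (length-map (x ,_) (f x))) ⟩
    length (map (x ,_) (f x)) + length (pairs f xs) ≡⟨ sym (length-++ (map (x ,_) (f x))) ⟩
    length (pairs f (x ∷ xs)) ∎
    where open ≤-Reasoning

  pairs-length-≤ : ∀ (f : X → List Z) xs p → (∀ {x} → x ∈ xs → length (f x) ≤ p) →
                   length (pairs f xs) ≤ p * length xs
  pairs-length-≤ f []       p h = z≤n
  pairs-length-≤ f (x ∷ xs) p h = begin
    length (pairs f (x ∷ xs)) ≡⟨ length-++ (map (x ,_) (f x)) ⟩
    length (map (x ,_) (f x)) + length (pairs f xs) ≡⟨ cong (_+ _) (length-map (x ,_) (f x)) ⟩
    length (f x) + length (pairs f xs) ≤⟨ +-mono-≤ (h (here refl)) (pairs-length-≤ f xs p (h ∘ there)) ⟩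
    p + p * length xs    ≡⟨ sym (*-suc p (length xs)) ⟩
    p * suc (length xs)  ∎
    where open ≤-Reasoning

  -- Incidences (x, z) are at least p for each x and are decoded from incidences (y, w), at most r
  -- for each y.
  double-count : ∀ {xs : List X} {ys : List X′} (f : X → List Z) (g : X′ → List Z′) p r
    (dec : X′ × Z′ → X × Z) → Unique xs →
    (∀ {x} → x ∈ xs → Unique (f x) × p ≤ length (f x)) →
    (∀ {y} → y ∈ ys → length (g y) ≤ r) →
    (∀ {x z} → x ∈ xs → z ∈ f x →
       ∃[ y ] ∃[ w ] (y ∈ ys × w ∈ g y × (x , z) ≡ dec (y , w))) →
    p * length xs ≤ r * length ys
  double-count {ys = ys} f g p r dec u hf hg h =
    ≤-trans (pairs-length-≥ f p (proj₂ ∘ hf))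
    (≤-trans (unique-decode-length dec (pairs-unique f u (proj₁ ∘ hf))
      λ { {x , z} xz∈ → let (x∈ , z∈) = ∈-pairs⁻ f xz∈
                            (y , w , y∈ , w∈ , e) = h x∈ z∈
                        in (y , w) , ∈-pairs⁺ g y∈ w∈ , e })
    (pairs-length-≤ g ys r hg))

  module _ {P : Pred X 0ℓ} (P? : Decidable P) where

    length-filter-split : ∀ xs →
      length (filter P? xs) + length (filter (¬? ∘ P?) xs) ≡ length xs
    length-filter-split [] = refl
    length-filter-split (x ∷ xs) with P? x
    ... | yes _ = cong suc (length-filter-split xs)
    ... | no _  = trans (+-suc _ _) (cong suc (length-filter-split xs))

    filter-unique : ∀ {xs} → Unique xs → Unique (filter P? xs)
    filter-unique = Uniq.filter⁺ P?

  module _ (f : X → ℕ) where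

    private
      class : ℕ → List X → List X
      class i = filter (λ x → f x ≟ i)

      class-∷-no : ∀ K {x xs} → K ≤ f x →
        sumTo K (λ i → length (class i (x ∷ xs))) ≡ sumTo K (λ i → length (class i xs))
      class-∷-no K {x} {xs} le = sumTo-cong K same
        where
        same : ∀ i → i < K → length (class i (x ∷ xs)) ≡ length (class i xs)
        same i i<K = cong length (filter-reject (λ x → f x ≟ i) λ { refl → <⇒≱ i<K le })

      class-∷-yes : ∀ K {x xs} → f x < K →
        sumTo K (λ i → length (class i (x ∷ xs))) ≡ suc (sumTo K (λ i → length (class i xs)))
      class-∷-yes (suc K) {x} {xs} (s≤s lt) with f x ≟ K
      ... | yes refl = cong₂ _+_ (cong length (filter-accept (λ x → f x ≟ K) refl))
                                 (class-∷-no (f x) ≤-refl)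
      ... | no ne    = trans (cong₂ _+_ (cong length (filter-reject (λ x → f x ≟ K) ne))
                                        (class-∷-yes K (≤∧≢⇒< lt ne)))
                             (+-suc _ _)

    sum-classes : ∀ K xs → (∀ {x} → x ∈ xs → f x < K) →
                  sumTo K (λ i → length (class i xs)) ≡ length xs
    sum-classes K []       h = trans (sumTo-const K 0) (*-zeroʳ K)
    sum-classes K (x ∷ xs) h = trans (class-∷-yes K (h (here refl)))
                                     (cong suc (sum-classes K xs (h ∘ there)))

    sum-classes-≤ : ∀ K xs → sumTo K (λ i → length (class i xs)) ≤ length xs
    sum-classes-≤ K []       = ≤-reflexive (trans (sumTo-const K 0) (*-zeroʳ K))
    sum-classes-≤ K (x ∷ xs) with K ≤? f x
    ... | yes le = ≤-trans (≤-reflexive (class-∷-no K le)) (m≤n⇒m≤1+n (sum-classes-≤ K xs))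
    ... | no nle = ≤-trans (≤-reflexive (class-∷-yes K (≰⇒> nle))) (s≤s (sum-classes-≤ K xs))

  -- Cells, connected sets and spanning trees

  _≟c_ : DecidableEquality (Cell d)
  _≟c_ = Vec.≡-dec _≟_

  module _ {d : ℕ} where
    open DecMem (_≟c_ {d}) public using (_∈?_)

  record Adj (u v : Cell d) : Set where
    constructor adj
    field dist≡1 : dist u v ≡ 1

  ∣n-suc[n]∣≡1 : ∀ n → ∣ n - suc n ∣ ≡ 1
  ∣n-suc[n]∣≡1 zero    = refl
  ∣n-suc[n]∣≡1 (suc n) = ∣n-suc[n]∣≡1 n

  dist-refl : (u : Cell d) → dist u u ≡ 0
  dist-refl []      = refl
  dist-refl (x ∷ u) = cong₂ _+_ (∣n-n∣≡0 x) (dist-refl u)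

  dist-sym : (u v : Cell d) → dist u v ≡ dist v u
  dist-sym []      []      = refl
  dist-sym (x ∷ u) (y ∷ v) = cong₂ _+_ (∣-∣-comm x y) (dist-sym u v)

  dist-zero : (u v : Cell d) → dist u v ≡ 0 → u ≡ v
  dist-zero []      []      e = refl
  dist-zero (x ∷ u) (y ∷ v) e =
    cong₂ _∷_ (∣m-n∣≡0⇒m≡n (m+n≡0⇒m≡0 ∣ x - y ∣ e)) (dist-zero u v (m+n≡0⇒n≡0 ∣ x - y ∣ e))

  dist-shift : (a u v : Cell d) → dist (zipWith _+_ a u) (zipWith _+_ a v) ≡ dist u v
  dist-shift []      []      []      = refl
  dist-shift (z ∷ a) (x ∷ u) (y ∷ v) = cong₂ _+_ (∣m+n-m+o∣≡∣n-o∣ z x y) (dist-shift a u v)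

  lookup-dist : (u v : Cell d) (i : Fin d) → ∣ lookup u i - lookup v i ∣ ≤ dist u v
  lookup-dist (x ∷ u) (y ∷ v) zero    = m≤m+n ∣ x - y ∣ (dist u v)
  lookup-dist (x ∷ u) (y ∷ v) (suc i) = m≤n⇒m≤o+n ∣ x - y ∣ (lookup-dist u v i)

  adj-sym : {u v : Cell d} → Adj u v → Adj v u
  adj-sym {u = u} {v} (adj e) = adj (trans (dist-sym v u) e)

  Dir : ℕ → Set
  Dir d = Fin d × Bool

  -- Moving down is the identity on a zero coordinate.
  move : Dir d → Cell d → Cell d
  move (i , true)  x = updateAt x i suc
  move (i , false) x = updateAt x i pred

  dist⇒move : (u v : Cell d) → dist u v ≡ 1 → ∃[ c ] v ≡ move c u
  dist⇒move []      []      ()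
  dist⇒move (x ∷ u) (y ∷ v) e with ∣ x - y ∣ in eq
  ... | zero with dist⇒move u v e | ∣m-n∣≡0⇒m≡n {x} {y} eq
  ...   | (i , true)  , v≡ | refl = (suc i , true)  , cong (x ∷_) v≡
  ...   | (i , false) , v≡ | refl = (suc i , false) , cong (x ∷_) v≡
  dist⇒move (x ∷ u) (y ∷ v) e | suc zero with dist-zero u v (suc-injective e) | neighbour x y eq
    where
    neighbour : ∀ a b → ∣ a - b ∣ ≡ 1 → b ≡ suc a ⊎ b ≡ pred a
    neighbour zero    (suc zero)    _ = inj₁ refl
    neighbour (suc zero) zero       _ = inj₂ refl
    neighbour (suc a) (suc b)       q with neighbour a b q
    ... | inj₁ refl = inj₁ refl
    neighbour (suc (suc a)) (suc b) q | inj₂ refl = inj₂ refl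
    neighbour (suc zero) (suc b)    q | inj₂ refl = contradiction q λ ()
  ... | refl | inj₁ refl = (zero , true)  , refl
  ... | refl | inj₂ refl = (zero , false) , refl
  dist⇒move (x ∷ u) (y ∷ v) () | suc (suc _)

  adj⇒move : {u v : Cell d} → Adj u v → ∃[ c ] v ≡ move c u
  adj⇒move {u = u} {v} (adj e) = dist⇒move u v e

  move⇒dist : (c : Dir d) (u : Cell d) → move c u ≡ u ⊎ dist u (move c u) ≡ 1
  move⇒dist (zero , true)  (x ∷ u) = inj₂ (cong₂ _+_ (∣n-suc[n]∣≡1 x) (dist-refl u))
  move⇒dist (zero , false) (zero ∷ u)  = inj₁ refl
  move⇒dist (zero , false) (suc x ∷ u) = inj₂ (cong₂ _+_ (trans (∣-∣-comm (suc x) x) (∣n-suc[n]∣≡1 x)) (dist-refl u))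
  move⇒dist (suc i , true)  (x ∷ u) with move⇒dist (i , true) u
  ... | inj₁ e = inj₁ (cong (x ∷_) e)
  ... | inj₂ e = inj₂ (cong₂ _+_ (∣n-n∣≡0 x) e)
  move⇒dist (suc i , false) (x ∷ u) with move⇒dist (i , false) u
  ... | inj₁ e = inj₁ (cong (x ∷_) e)
  ... | inj₂ e = inj₂ (cong₂ _+_ (∣n-n∣≡0 x) e)

  move⇒adj : (c : Dir d) (u : Cell d) → move c u ≡ u ⊎ Adj u (move c u)
  move⇒adj c u with move⇒dist c u
  ... | inj₁ e = inj₁ e
  ... | inj₂ e = inj₂ (adj e)

  -- Membership is demanded of every cell after the first one, so that chains compose without
  -- repeating conditions and reversal needs it of the start only.
  Link : (Cell d → Set) → Cell d → Cell d → Set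
  Link M = Star (λ u v → M v × Adj u v)

  Conn : (Cell d → Set) → Set
  Conn M = ∀ {x y} → M x → M y → Link M x y

  link-mono : {M M′ : Cell d → Set} → (∀ {z} → M z → M′ z) → ∀ {x y} → Link M x y → Link M′ x y
  link-mono f = Star.map λ (m , a) → f m , a

  link-sym : {M : Cell d → Set} → ∀ {x y} → M x → Link M x y → Link M y x
  link-sym mx ε              = ε
  link-sym mx ((mz , a) ◅ p) = link-sym mz p ◅◅ ((mx , adj-sym a) ◅ ε)

  conn-resp : {M M′ : Cell d → Set} → (∀ {z} → M z → M′ z) → (∀ {z} → M′ z → M z) →
              Conn M → Conn M′
  conn-resp f g h x y = link-mono f (h (g x) (g y))

  conn-from : {M : Cell d → Set} {r : Cell d} → M r → (∀ {x} → M x → Link M r x) → Conn M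
  conn-from mr h mx my = link-sym mr (h mx) ◅◅ h my

  conn-∪ : {M M′ : Cell d → Set} {z : Cell d} → Conn M → Conn M′ → M z → M′ z →
           Conn (λ x → M x ⊎ M′ x)
  conn-∪ h h′ m m′ = conn-from (inj₁ m) λ
    { (inj₁ mx) → link-mono inj₁ (h m mx)
    ; (inj₂ mx) → link-mono inj₂ (h′ m′ mx) }

  unique-⊆-full : {xs ys : List (Cell d)} → Unique xs → (∀ {x} → x ∈ xs → x ∈ ys) →
                  length ys ≤ length xs → ∀ {y} → y ∈ ys → y ∈ xs
  unique-⊆-full {xs = xs} u sub le {y} y∈ with y ∈? xs
  ... | yes p = p
  ... | no ¬p = contradiction
    (unique-⊆-length (unique-∷ ¬p u) λ { (here refl) → y∈ ; (there q) → sub q })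
    (<⇒≱ (s≤s le))

  ∈-box⁺ : ∀ {d n} {c : Cell d} → (∀ i → lookup c i < n) → c ∈ box d n
  ∈-box⁺ {c = []}    h = here refl
  ∈-box⁺ {suc d} {n} {x ∷ c} h = ∈-concatMap⁺ (λ x → map (x ∷_) (box d n))
    (lose (∈-upTo⁺ (h zero)) (∈-map⁺ (x ∷_) (∈-box⁺ (h ∘ suc))))

  ∈-box⁻ : ∀ {d n} {c : Cell d} → c ∈ box d n → ∀ i → lookup c i < n
  ∈-box⁻ {suc d} {n} c∈ i with find (∈-concatMap⁻ (λ x → map (x ∷_) (box d n)) {xs = upTo n} c∈)
  ... | x , x∈ , q with ∈-map⁻ (x ∷_) q
  ∈-box⁻ c∈ zero    | x , x∈ , q | c , c∈′ , refl = ∈-upTo⁻ x∈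
  ∈-box⁻ c∈ (suc i) | x , x∈ , q | c , c∈′ , refl = ∈-box⁻ c∈′ i

  concatMap-unique : {Y : Set} (f : X → List Y) {xs : List X} → Unique xs → (∀ x → Unique (f x)) →
    (∀ {x x′ y} → y ∈ f x → y ∈ f x′ → x ≡ x′) → Unique (concatMap f xs)
  concatMap-unique f {[]}     u v w = []
  concatMap-unique f {x ∷ xs} u v w =
    Uniq.++⁺ (v x) (concatMap-unique f (unique-tail u) v w) λ { (p , q) →
      let (x′ , x′∈ , q′) = find (∈-concatMap⁻ f {xs = xs} q)
      in unique-∉ u (subst (_∈ xs) (sym (w p q′)) x′∈) }

  box-unique : ∀ d n → Unique (box d n)
  box-unique zero    n = [] ∷ []
  box-unique (suc d) n = concatMap-unique (λ x → map (x ∷_) (box d n)) (Uniq.upTo⁺ n)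
    (λ x → Uniq.map⁺ Vec.∷-injectiveʳ (box-unique d n))
    λ {x} {x′} p q → let (_ , _ , e) = ∈-map⁻ (x ∷_) p ; (_ , _ , e′) = ∈-map⁻ (x′ ∷_) q
                     in Vec.∷-injectiveˡ (trans (sym e) e′)

  length-concatMap : {Y : Set} (f : X → List Y) (xs : List X) (k : ℕ) → (∀ x → length (f x) ≡ k) →
                     length (concatMap f xs) ≡ length xs * k
  length-concatMap f []       k h = refl
  length-concatMap f (x ∷ xs) k h =
    trans (length-++ (f x)) (cong₂ _+_ (h x) (length-concatMap f xs k h))

  length-box : ∀ d n → length (box d n) ≡ n ^ d
  length-box zero    n = refl
  length-box (suc d) n = trans
    (length-concatMap (λ x → map (x ∷_) (box d n)) (upTo n) (n ^ d)
      λ x → trans (length-map (x ∷_) (box d n)) (length-box d n))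
    (cong (_* n ^ d) (length-upTo n))

  length-sublists : (xs : List X) → length (sublists xs) ≡ 2 ^ length xs
  length-sublists []       = refl
  length-sublists (x ∷ xs) = trans (length-++ (map (x ∷_) (sublists xs)))
    (cong₂ _+_ (trans (length-map (x ∷_) (sublists xs)) (length-sublists xs))
               (trans (length-sublists xs) (sym (+-identityʳ _))))

  sublists-⊆ : (xs : List X) {S : List X} → S ∈ sublists xs → ∀ {x} → x ∈ S → x ∈ xs
  sublists-⊆ []       (here refl) ()
  sublists-⊆ (y ∷ xs) S∈ x∈ with ∈-++⁻ (map (y ∷_) (sublists xs)) S∈
  ... | inj₂ q = there (sublists-⊆ xs q x∈)
  ... | inj₁ q with ∈-map⁻ (y ∷_) q
  sublists-⊆ (y ∷ xs) S∈ (here e)   | inj₁ q | S′ , S′∈ , refl = here e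
  sublists-⊆ (y ∷ xs) S∈ (there x∈) | inj₁ q | S′ , S′∈ , refl = there (sublists-⊆ xs S′∈ x∈)

  ∷-injʳ : {x : X} {xs ys : List X} → x ∷ xs ≡ x ∷ ys → xs ≡ ys
  ∷-injʳ refl = refl

  sublists-unique : {xs : List X} → Unique xs → Unique (sublists xs)
  sublists-unique {xs = []}     u = [] ∷ []
  sublists-unique {xs = x ∷ xs} u =
    Uniq.++⁺ (Uniq.map⁺ ∷-injʳ ih) ih λ { (p , q) →
      let (S , S∈ , e) = ∈-map⁻ (x ∷_) p
      in unique-∉ u (sublists-⊆ xs q (subst (x ∈_) (sym e) (here refl))) }
    where ih = sublists-unique (unique-tail u)

  filter∈sublists : {P : X → Set} (P? : ∀ x → Dec (P x)) (xs : List X) → filter P? xs ∈ sublists xs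
  filter∈sublists P? []       = here refl
  filter∈sublists P? (x ∷ xs) with P? x
  ... | yes _ = ∈-++⁺ˡ (∈-map⁺ (x ∷_) (filter∈sublists P? xs))
  ... | no _  = ∈-++⁺ʳ (map (x ∷_) (sublists xs)) (filter∈sublists P? xs)

  sublist-elements : {xs S : List X} → Unique xs → S ∈ sublists xs → Unique S
  sublist-elements {xs = []}     u (here refl) = []
  sublist-elements {xs = x ∷ xs} u S∈ with ∈-++⁻ (map (x ∷_) (sublists xs)) S∈
  ... | inj₂ q = sublist-elements (unique-tail u) q
  ... | inj₁ q with ∈-map⁻ (x ∷_) q
  ...   | S′ , S′∈ , refl = unique-∷ (unique-∉ u ∘ sublists-⊆ xs S′∈) (sublist-elements (unique-tail u) S′∈)

  filter-cong-∈ : {P Q : X → Set} (P? : ∀ x → Dec (P x)) (Q? : ∀ x → Dec (Q x)) (xs : List X) →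
    (∀ {x} → x ∈ xs → P x → Q x) → (∀ {x} → x ∈ xs → Q x → P x) → filter P? xs ≡ filter Q? xs
  filter-cong-∈ P? Q? []       f g = refl
  filter-cong-∈ P? Q? (x ∷ xs) f g with P? x
  ... | yes p = trans (cong (x ∷_) (filter-cong-∈ P? Q? xs (f ∘ there) (g ∘ there)))
                      (sym (filter-accept Q? (f (here refl) p)))
  ... | no ¬p = trans (filter-cong-∈ P? Q? xs (f ∘ there) (g ∘ there))
                      (sym (filter-reject Q? (¬p ∘ g (here refl))))

  sublist-filter : {xs S : List (Cell d)} → Unique xs → S ∈ sublists xs → filter (_∈? S) xs ≡ S
  sublist-filter {xs = []}     u (here refl) = refl
  sublist-filter {xs = x ∷ xs} u S∈ with ∈-++⁻ (map (x ∷_) (sublists xs)) S∈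
  ... | inj₂ q = trans (filter-reject (_∈? _) (unique-∉ u ∘ sublists-⊆ xs q))
                       (sublist-filter (unique-tail u) q)
  ... | inj₁ q with ∈-map⁻ (x ∷_) q
  ...   | S′ , S′∈ , refl = trans (filter-accept (_∈? (x ∷ S′)) (here refl))
    (cong (x ∷_) (trans
      (filter-cong-∈ (_∈? (x ∷ S′)) (_∈? S′) xs
        (λ { z∈ (here refl) → contradiction z∈ (unique-∉ u) ; z∈ (there p) → p }) λ _ → there)
      (sublist-filter (unique-tail u) S′∈)))

  -- The box fixes an order of the cells, the one in which `sublists` lists its members; equal sets
  -- of cells thus get equal lists.
  canon : ∀ n → List (Cell d) → List (Cell d)
  canon n X = filter (_∈? X) (box _ n)

  canon-cong : ∀ n {X Y : List (Cell d)} → (∀ {c} → c ∈ X → c ∈ Y) → (∀ {c} → c ∈ Y → c ∈ X) →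
               canon n X ≡ canon n Y
  canon-cong n f g = filter-cong-∈ (_∈? _) (_∈? _) (box _ n) (λ _ → f) (λ _ → g)

  unique-resp-↭ : {xs ys : List X} → xs ↭ ys → Unique xs → Unique ys
  unique-resp-↭ {X = X} p = PermSetoid.Unique-resp-↭ (setoid X) (↭⇒↭ₛ p)

  -- Children are attached one at a time. A tree is thus a binary composition, and cutting it yields
  -- pieces whose sizes differ by less than a factor two, whatever the degrees.
  data Tree : Cell d → List (Cell d) → Set where
    single : (x : Cell d) → Tree x (x ∷ [])
    attach : ∀ {x y : Cell d} {xs ys} → Tree x xs → Tree y ys → Adj x y → Tree y (xs ++ ys)

  root∈ : {r : Cell d} {xs : List (Cell d)} → Tree r xs → r ∈ xs
  root∈ (single _)                = here refl
  root∈ (attach {xs = xs} _ t _)  = ∈-++⁺ʳ xs (root∈ t)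

  tree-insert : {r y z : Cell d} {xs : List (Cell d)} → Tree r xs → y ∈ xs → Adj z y →
                ∃[ ys ] (Tree r ys × ys ↭ z ∷ xs)
  tree-insert {z = z} (single x) (here refl) a = z ∷ x ∷ [] , attach (single z) (single x) a , ↭-refl
  tree-insert {z = z} (attach {xs = xs} {ys} t u b) y∈ a with ∈-++⁻ xs y∈
  ... | inj₁ p = let (zs , t′ , perm) = tree-insert t p a
                 in zs ++ ys , attach t′ u b , ++⁺ʳ ys perm
  ... | inj₂ p = let (zs , u′ , perm) = tree-insert u p a
                 in xs ++ zs , attach t u′ b , ↭-trans (++⁺ˡ xs perm) (shift z xs ys)

  tree-link : {r : Cell d} {xs : List (Cell d)} → Tree r xs → ∀ {x} → x ∈ xs → Link (_∈ xs) r x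
  tree-link (single x) (here refl) = ε
  tree-link (attach {xs = xs} t u a) x∈ with ∈-++⁻ xs x∈
  ... | inj₂ p = link-mono (∈-++⁺ʳ xs) (tree-link u p)
  ... | inj₁ p = (∈-++⁺ˡ (root∈ t) , adj-sym a) ◅ link-mono ∈-++⁺ˡ (tree-link t p)

  tree-conn : {r : Cell d} {xs : List (Cell d)} → Tree r xs → Conn (_∈ xs)
  tree-conn t = conn-from (root∈ t) (tree-link t)

  exit : {M : Cell d → Set} {ys : List (Cell d)} → ∀ {x y} → Link M x y → x ∈ ys → y ∉ ys →
         ∃[ w ] ∃[ z ] (w ∈ ys × M z × z ∉ ys × Adj z w)
  exit ε x∈ y∉ = contradiction x∈ y∉
  exit {ys = ys} (_◅_ {i = x} {j = z} (mz , a) p) x∈ y∉ with z ∈? ys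
  ... | yes z∈ = exit p z∈ y∉
  ... | no z∉  = x , z , x∈ , mz , z∉ , adj-sym a

  spanning-tree : {r : Cell d} {X : List (Cell d)} → Conn (_∈ X) → r ∈ X →
    ∃[ ys ] (Tree r ys × Unique ys × (∀ {z} → z ∈ ys → z ∈ X) × (∀ {z} → z ∈ X → z ∈ ys))
  spanning-tree {r = r} {X} conn r∈ =
    grow (length X) (single r) ([] ∷ []) (λ { (here refl) → r∈ }) (n≤1+n _)
    where
    grow : ∀ k {ys} → Tree r ys → Unique ys → (∀ {z} → z ∈ ys → z ∈ X) → length X ≤ length ys + k →
      ∃[ ys ] (Tree r ys × Unique ys × (∀ {z} → z ∈ ys → z ∈ X) × (∀ {z} → z ∈ X → z ∈ ys))
    grow zero    {ys} t u sub le = ys , t , u , sub ,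
      unique-⊆-full u sub (≤-trans le (≤-reflexive (+-identityʳ _)))
    grow (suc k) {ys} t u sub le with all? (_∈? ys) X
    ... | yes full = ys , t , u , sub , All.lookup full
    ... | no ¬full = let (y , y∈ , y∉) = find (AllP.¬All⇒Any¬ (_∈? ys) X ¬full)
                         (w , z , w∈ , z∈ , z∉ , a) = exit (conn r∈ y∈) (root∈ t) y∉
                         (zs , t′ , perm) = tree-insert t w∈ a
                     in grow k t′ (uniq perm z∉) (in-X perm z∈)
                          (subst (λ l → length X ≤ l + k) (sym (↭-length perm))
                            (≤-trans le (≤-reflexive (+-suc (length ys) k))))
      where
      uniq : ∀ {z zs} → zs ↭ z ∷ ys → z ∉ ys → Unique zs
      uniq perm z∉ = unique-resp-↭ (↭-sym perm) (unique-∷ z∉ u)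
      in-X : ∀ {z zs} → zs ↭ z ∷ ys → z ∈ X → ∀ {x} → x ∈ zs → x ∈ X
      in-X perm z∈ x∈ with ∈-resp-↭ perm x∈
      ... | here refl = z∈
      ... | there p   = sub p

  -- The index bounds the number of hops.
  data Path (M : Cell d → Set) : ℕ → Cell d → Cell d → Set where
    done : ∀ {k x} → Path M k x x
    hop : ∀ {k x y z} → M z → Adj x z → Path M k z y → Path M (suc k) x y

  path-cast : ∀ {M : Cell d → Set} {j k x y} → j ≡ k → Path M j x y → Path M k x y
  path-cast refl p = p

  path-weaken : ∀ {M : Cell d → Set} j {k x y} → Path M k x y → Path M (j + k) x y
  path-weaken j done         = done
  path-weaken j {suc k} (hop m a p) = path-cast (sym (+-suc j k)) (hop m a (path-weaken j p))

  path-trans : ∀ {M : Cell d → Set} {j k x y z} → Path M j x y → Path M k y z → Path M (j + k) x z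
  path-trans {j = j} done q = path-weaken j q
  path-trans (hop m a p) q = hop m a (path-trans p q)

  path-mono : ∀ {M M′ : Cell d → Set} → (∀ {z} → M z → M′ z) → ∀ {k x y} → Path M k x y → Path M′ k x y
  path-mono f done         = done
  path-mono f (hop m a p) = hop (f m) a (path-mono f p)

  tree-size : {r : Cell d} {xs : List (Cell d)} → Tree r xs → ∃[ k ] length xs ≡ suc k
  tree-size (single x) = 0 , refl
  tree-size (attach {xs = xs} {ys} t u _) =
    let (k , e) = tree-size t in k + length ys , trans (length-++ xs) (cong (_+ length ys) e)

  -- A tree with k + 1 cells joins any two of them within k hops. This makes the search in
  -- `connected` complete and confines normal polycubes to the box.
  tree-path : ∀ {r : Cell d} {xs k x y} → Tree r xs → length xs ≡ suc k → x ∈ xs → y ∈ xs → Path (_∈ xs) k x y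
  tree-path (single x) refl (here refl) (here refl) = done
  tree-path {k = k} (attach {xs = xs} {ys} t u a) e x∈ y∈
    with tree-size t | tree-size u | ∈-++⁻ xs x∈ | ∈-++⁻ xs y∈
  ... | i , ei | j , ej | px | py = path-cast (suc-injective total) (go px py)
    where
    total : suc (i + suc j) ≡ suc k
    total = trans (sym (cong₂ _+_ ei ej)) (trans (sym (length-++ xs)) e)
    go : ∀ {x y} → x ∈ xs ⊎ x ∈ ys → y ∈ xs ⊎ y ∈ ys → Path (_∈ xs ++ ys) (i + suc j) x y
    go (inj₁ p) (inj₁ q) = path-cast (+-comm (suc j) i)
      (path-weaken (suc j) (path-mono ∈-++⁺ˡ (tree-path t ei p q)))
    go (inj₂ p) (inj₂ q) = path-cast (sym (+-suc i j))
      (path-weaken (suc i) (path-mono (∈-++⁺ʳ xs) (tree-path u ej p q)))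
    go (inj₁ p) (inj₂ q) = path-trans (path-mono ∈-++⁺ˡ (tree-path t ei p (root∈ t)))
      (hop (∈-++⁺ʳ xs (root∈ u)) a (path-mono (∈-++⁺ʳ xs) (tree-path u ej (root∈ u) q)))
    go (inj₂ p) (inj₁ q) = path-cast (trans (+-suc j i) (trans (cong suc (+-comm j i)) (sym (+-suc i j))))
      (path-trans (path-mono (∈-++⁺ʳ xs) (tree-path u ej p (root∈ u)))
        (hop (∈-++⁺ˡ (root∈ t)) (adj-sym a) (path-mono ∈-++⁺ˡ (tree-path t ei (root∈ t) q))))

  path-lookup : ∀ {M : Cell d → Set} {k x y} (i : Fin d) → Path M k x y →
                lookup y i ≤ lookup x i + k
  path-lookup i done = m≤m+n _ _
  path-lookup {k = suc k} {x} {y} i (hop {z = z} _ a p) = begin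
    lookup y i            ≤⟨ path-lookup i p ⟩
    lookup z i + k        ≤⟨ +-monoˡ-≤ k near ⟩
    lookup x i + 1 + k    ≡⟨ +-assoc (lookup x i) 1 k ⟩
    lookup x i + suc k    ∎
    where
    open ≤-Reasoning
    near : lookup z i ≤ lookup x i + 1
    near = ≤-trans (m≤n+∣m-n∣ (lookup z i) (lookup x i))
      (+-monoʳ-≤ (lookup x i) (≤-trans (lookup-dist z x i) (≤-reflexive (Adj.dist≡1 (adj-sym a)))))

  -- Polycubes in normal position

  opaque
    polycubes : (d n : ℕ) → List (List (Cell d))
    polycubes d n = filterᵇ (isNormalPolycube d n) (sublists (box d n))

    length-polycubes : ∀ d n → length (polycubes d n) ≡ A d n
    length-polycubes d n = refl

  record Normal (d n : ℕ) (X : List (Cell d)) : Set where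
    field
      unique : Unique X
      size   : length X ≡ n
      conn   : Conn (_∈ X)
      touch  : ∀ i → ∃[ c ] (c ∈ X × lookup c i ≡ 0)

  T-step⁻ : {x y : Cell d} → T (sameCell x y ∨ adjacent x y) → x ≡ y ⊎ Adj y x
  T-step⁻ {x = x} {y} t with Equivalence.to (T-∨ {sameCell x y}) t
  ... | inj₁ s = inj₁ (dist-zero x y (≡ᵇ⇒≡ _ _ s))
  ... | inj₂ a = inj₂ (adj-sym (adj (≡ᵇ⇒≡ _ _ a)))

  T-step⁺ : {x y : Cell d} → x ≡ y ⊎ Adj y x → T (sameCell x y ∨ adjacent x y)
  T-step⁺ {x = x} {y} (inj₁ refl) = Equivalence.from (T-∨ {sameCell x y}) (inj₁ (≡⇒≡ᵇ _ _ (dist-refl x)))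
  T-step⁺ {x = x} {y} (inj₂ a)    = Equivalence.from (T-∨ {sameCell x y}) (inj₂ (≡⇒≡ᵇ _ _ (Adj.dist≡1 (adj-sym a))))

  ∈-step⁻ : (S R : List (Cell d)) → ∀ {x} → x ∈ step S R → x ∈ S × ∃[ r ] (r ∈ R × (x ≡ r ⊎ Adj r x))
  ∈-step⁻ S R {x} x∈ with ∈-filter⁻ (λ c → T? (any (λ r → sameCell c r ∨ adjacent c r) R)) {xs = S} x∈
  ... | x∈S , t with find (any⁻ (λ r → sameCell x r ∨ adjacent x r) R t)
  ...   | r , r∈ , t′ = x∈S , r , r∈ , T-step⁻ t′

  ∈-step⁺ : (S R : List (Cell d)) → ∀ {x r} → x ∈ S → r ∈ R → x ≡ r ⊎ Adj r x → x ∈ step S R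
  ∈-step⁺ S R {x} x∈ r∈ h = ∈-filter⁺ (λ c → T? (any (λ r → sameCell c r ∨ adjacent c r) R)) x∈
    (any⁺ (λ r → sameCell x r ∨ adjacent x r) (lose r∈ (T-step⁺ h)))

  reach-sound : ∀ k {S R : List (Cell d)} {c} → Unique S → Unique R →
    (∀ {x} → x ∈ R → x ∈ S × Link (_∈ S) c x) →
    Unique (reach k S R) × (∀ {x} → x ∈ reach k S R → x ∈ S × Link (_∈ S) c x)
  reach-sound zero    uS uR h = uR , h
  reach-sound (suc k) {S} {R} {c} uS uR h = reach-sound k uS (filter-unique _ uS) λ x∈ →
    let (x∈S , r , r∈ , e) = ∈-step⁻ S R x∈ in x∈S , extend x∈S (proj₂ (h r∈)) e
    where
    extend : ∀ {x r} → x ∈ S → Link (_∈ S) c r → x ≡ r ⊎ Adj r x → Link (_∈ S) c x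
    extend x∈ p (inj₁ refl) = p
    extend x∈ p (inj₂ a)    = p ◅◅ ((x∈ , a) ◅ ε)

  reach-complete : ∀ k {S R : List (Cell d)} {x y} → x ∈ R → x ∈ S → Path (_∈ S) k x y → y ∈ reach k S R
  reach-complete zero    x∈R x∈S done         = x∈R
  reach-complete (suc k) x∈R x∈S done         =
    reach-complete k (∈-step⁺ _ _ x∈S x∈R (inj₁ refl)) x∈S done
  reach-complete (suc k) x∈R x∈S (hop z∈ a p) =
    reach-complete k (∈-step⁺ _ _ z∈ x∈R (inj₂ a)) z∈ p

  singleton-link : {c : Cell d} {S : List (Cell d)} →
    ∀ {x} → x ∈ c ∷ [] → x ∈ c ∷ S × Link (_∈ c ∷ S) c x
  singleton-link (here refl) = here refl , ε

  connected⁻ : (S : List (Cell d)) → Unique S → T (connected S) → Conn (_∈ S)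
  connected⁻ []      u t ()
  connected⁻ (c ∷ S) u t = conn-from (here refl) λ x∈ →
    proj₂ (sound (unique-⊆-full uniq (proj₁ ∘ sound) (≤-reflexive (sym (≡ᵇ⇒≡ _ _ t))) x∈))
    where
    both  = reach-sound (length S) {R = c ∷ []} u ([] ∷ []) singleton-link
    uniq  = proj₁ both
    sound = proj₂ both

  conn-path : {S : List (Cell d)} {x y : Cell d} {k : ℕ} → Unique S → Conn (_∈ S) → length S ≡ suc k →
              x ∈ S → y ∈ S → Path (_∈ S) k x y
  conn-path u conn e x∈ y∈ =
    let (ys , t , v , f , g) = spanning-tree conn x∈
    in path-mono f (tree-path t (trans (same-members-length v u f g) e) (g x∈) (g y∈))

  connected⁺ : (S : List (Cell d)) → Unique S → Conn (_∈ S) → T (connected S)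
  connected⁺ []      u conn = _
  connected⁺ (c ∷ S) u conn = ≡⇒≡ᵇ _ _ (same-members-length
    (proj₁ sound) u (proj₁ ∘ proj₂ sound)
    λ y∈ → reach-complete (length S) (here refl) (here refl) (conn-path u conn refl (here refl) y∈))
    where sound = reach-sound (length S) {R = c ∷ []} u ([] ∷ []) singleton-link

  module _ (zero-at : ℕ → List ℕ → Bool) (at-zero : ∀ x xs → zero-at 0 (x ∷ xs) ≡ (x ≡ᵇ 0))
    (at-suc : ∀ i x xs → zero-at (suc i) (x ∷ xs) ≡ zero-at i xs) where

    zero-at-lookup : ∀ {d} (c : Cell d) (i : Fin d) → zero-at (toℕ i) (toList c) ≡ (lookup c i ≡ᵇ 0)
    zero-at-lookup (x ∷ c) zero    = at-zero x (toList c)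
    zero-at-lookup (x ∷ c) (suc i) = trans (at-suc (toℕ i) x (toList c)) (zero-at-lookup c i)

    zero-at⁻ : ∀ {d} (c : Cell d) (i : Fin d) {j l} → T (zero-at j l) → j ≡ toℕ i → l ≡ toList c →
               lookup c i ≡ 0
    zero-at⁻ c i t refl refl = ≡ᵇ⇒≡ _ _ (subst T (zero-at-lookup c i) t)

    zero-at⁺ : ∀ {d} (c : Cell d) (i : Fin d) {j l} → ¬ T (zero-at j l) → j ≡ toℕ i → l ≡ toList c →
               lookup c i ≢ 0
    zero-at⁺ c i ¬t refl refl e = ¬t (subst T (sym (zero-at-lookup c i)) (≡⇒≡ᵇ _ _ e))

  -- The coordinate lookup inside `touches` is local to that definition and cannot be named: it is
  -- the solution of the placeholder below, determined by the uses of `coordinate-zero`.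
  mutual
    coordinate-zero : List (Cell d) → ℕ → List ℕ → Bool
    coordinate-zero S j l = _

    touches⁻ : (S : List (Cell d)) → T (touches S) → ∀ i → ∃[ c ] (c ∈ S × lookup c i ≡ 0)
    touches⁻ {d} S t i with toℕ i in eqi | All.lookup (AllP.all⁺ _ (upTo d) t) (∈-upTo⁺ (toℕ<n i))
    ... | j | tj with find (any⁻ _ S tj)
    ...   | c , c∈ , tc with toList c in eqc
    ...     | l = c , c∈ , zero-at⁻ (coordinate-zero S) (λ _ _ → refl) (λ _ _ _ → refl) c i {j} {l} tc
                             (sym eqi) (sym eqc)

  touches⁺ : (S : List (Cell d)) → (∀ i → ∃[ c ] (c ∈ S × lookup c i ≡ 0)) → T (touches S)
  touches⁺ {d} S h with T? (touches S)
  ... | yes t = t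
  ... | no ¬t with find (AllP.¬All⇒Any¬ (λ _ → T? _) (upTo d) (¬t ∘ AllP.all⁻ _))
  ...   | j , j∈ , ¬tj with h (fromℕ< (∈-upTo⁻ j∈))
  ...     | c , c∈ , e with AllP.¬Any⇒All¬ S (¬tj ∘ any⁺ _)
  ...       | none = contradiction e
    (zero-at⁺ (coordinate-zero S) (λ _ _ → refl) (λ _ _ _ → refl) c _ (All.lookup none c∈)
      (sym (toℕ-fromℕ< (∈-upTo⁻ j∈))) refl)

  polycount : ℕ → ℕ → ℕ
  polycount d n = length (polycubes d n)

  opaque
    unfolding polycubes

    polycubes-unique : ∀ d n → Unique (polycubes d n)
    polycubes-unique d n = filter-unique _ (sublists-unique (box-unique d n))

    polycube-sublist : ∀ {d n S} → S ∈ polycubes d n → S ∈ sublists (box d n)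
    polycube-sublist {d} {n} S∈ = proj₁ (∈-filter⁻ (T? ∘ isNormalPolycube d n) {xs = sublists (box d n)} S∈)

    polycube-normal : ∀ {d n S} → S ∈ polycubes d n → Normal d n S
    polycube-normal {d} {n} {S} S∈ = record
      { unique = u
      ; size   = ≡ᵇ⇒≡ _ _ (proj₁ (Equivalence.to (T-∧ {length S ≡ᵇ n}) t))
      ; conn   = connected⁻ S u (proj₁ (Equivalence.to (T-∧ {connected S}) t′))
      ; touch  = touches⁻ S (proj₂ (Equivalence.to (T-∧ {connected S}) t′)) }
      where
      u : Unique S
      u = sublist-elements (box-unique d n) (polycube-sublist S∈)
      t : T (isNormalPolycube d n S)
      t = proj₂ (∈-filter⁻ (T? ∘ isNormalPolycube d n) {xs = sublists (box d n)} S∈)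
      t′ : T (connected S ∧ touches S)
      t′ = proj₂ (Equivalence.to (T-∧ {length S ≡ᵇ n}) t)

  polycube-canon : ∀ {d n S X} → S ∈ polycubes d n → (∀ {c} → c ∈ X → c ∈ S) → (∀ {c} → c ∈ S → c ∈ X) →
                   canon n X ≡ S
  polycube-canon {d} {n} S∈ f g =
    trans (canon-cong n f g) (sublist-filter (box-unique d n) (polycube-sublist S∈))

  polycube-≡ : ∀ {d n S S′} → S ∈ polycubes d n → S′ ∈ polycubes d n →
    (∀ {c} → c ∈ S → c ∈ S′) → (∀ {c} → c ∈ S′ → c ∈ S) → S ≡ S′
  polycube-≡ S∈ S′∈ f g = trans (sym (polycube-canon S∈ id id)) (polycube-canon S′∈ f g)

  -- Every coordinate vanishes at some cell of the polycube, and any other cell is at most n - 1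
  -- hops away from it.
  normal-box : ∀ {d n X} → Normal d n X → ∀ {c} → c ∈ X → c ∈ box d n
  normal-box {n = n} {X} N {c} c∈ = ∈-box⁺ λ i → bound i (Normal.touch N i)
    where
    open Normal N
    bound : ∀ i → ∃[ b ] (b ∈ X × lookup b i ≡ 0) → lookup c i < n
    bound i (b , b∈ , e) with length X in eq
    ... | zero  = contradiction (∈-length c∈) λ p → <⇒≢ p (sym eq)
    ... | suc k = subst (lookup c i <_) (trans (sym eq) size)
      (s≤s (≤-trans (path-lookup i (conn-path unique conn eq b∈ c∈)) (≤-reflexive (cong (_+ k) e))))

  module _ {d n : ℕ} {X : List (Cell d)} (N : Normal d n X) where
    open Normal N

    ∈-canon⁺ : ∀ {c} → c ∈ X → c ∈ canon n X
    ∈-canon⁺ c∈ = ∈-filter⁺ (_∈? X) (normal-box N c∈) c∈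

    ∈-canon⁻ : ∀ {c} → c ∈ canon n X → c ∈ X
    ∈-canon⁻ c∈ = proj₂ (∈-filter⁻ (_∈? X) {xs = box d n} c∈)

    opaque
      unfolding polycubes

      canon-polycube : canon n X ∈ polycubes d n
      canon-polycube = ∈-filter⁺ (T? ∘ isNormalPolycube d n) (filter∈sublists (_∈? X) (box d n))
        (Equivalence.from (T-∧ {length (canon n X) ≡ᵇ n})
          ( ≡⇒≡ᵇ _ _ (trans (same-members-length u unique ∈-canon⁻ ∈-canon⁺) size)
          , Equivalence.from (T-∧ {connected (canon n X)})
            ( connected⁺ (canon n X) u (conn-resp ∈-canon⁺ ∈-canon⁻ conn)
            , touches⁺ (canon n X) λ i → let (c , c∈ , e) = touch i in c , ∈-canon⁺ c∈ , e)))
        where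
        u : Unique (canon n X)
        u = filter-unique (_∈? X) (box-unique d n)

  -- Extending and splitting polycubes

  argmax : (f : X → ℕ) (x : X) (xs : List X) → ∃[ r ] (r ∈ x ∷ xs × ∀ {c} → c ∈ x ∷ xs → f c ≤ f r)
  argmax f x [] = x , here refl , λ { (here refl) → ≤-refl }
  argmax f x (y ∷ xs) with argmax f y xs
  ... | r , r∈ , h with f x ≤? f r
  ...   | yes le = r , there r∈ , λ { (here refl) → le ; (there p) → h p }
  ...   | no nle = x , here refl , λ { (here refl) → ≤-refl ; (there p) → ≤-trans (h p) (<⇒≤ (≰⇒> nle)) }

  polycubes-zero : ∀ {S} → S ∉ polycubes (suc d) 0
  polycubes-zero {S = S} S∈ with Normal.touch (polycube-normal S∈) zero
  ... | c , c∈ , _ = contradiction (∈-length c∈) λ p → <⇒≢ p (sym (Normal.size (polycube-normal S∈)))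

  box-mono : ∀ {c : Cell d} {j n} → j ≤ n → c ∈ box d j → c ∈ box d n
  box-mono le c∈ = ∈-box⁺ λ i → <-≤-trans (∈-box⁻ c∈ i) le

  link-snoc : {M : Cell d → Set} {x y z : Cell d} → Link M x y → M z → Adj y z → Link M x z
  link-snoc p m a = p ◅◅ ((m , a) ◅ ε)

  height : Cell (suc d) → ℕ
  height (x ∷ _) = x

  raise : ℕ → Cell (suc d) → Cell (suc d)
  raise i (x ∷ c) = suc i + x ∷ c

  ray : Cell (suc d) → ℕ → List (Cell (suc d))
  ray r k = map (λ i → raise i r) (upTo k)

  ∈-ray⁻ : (r : Cell (suc d)) (k : ℕ) → ∀ {z} → z ∈ ray r k → ∃[ i ] (i < k × z ≡ raise i r)
  ∈-ray⁻ r k z∈ = let (i , i∈ , e) = ∈-map⁻ (λ i → raise i r) z∈ in i , ∈-upTo⁻ i∈ , e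

  raise-height : ∀ i (r : Cell (suc d)) → height r < height (raise i r)
  raise-height i (x ∷ r) = s≤s (m≤n+m x i)

  raise-injective : ∀ {i j} (r : Cell (suc d)) → raise i r ≡ raise j r → i ≡ j
  raise-injective (x ∷ r) e = suc-injective (+-cancelʳ-≡ x _ _ (Vec.∷-injectiveˡ e))

  adj-raise : ∀ i (r : Cell (suc d)) → Adj (raise i r) (raise (suc i) r)
  adj-raise i (x ∷ r) = adj (cong₂ _+_ (∣n-suc[n]∣≡1 (i + x)) (dist-refl r))

  adj-raise₀ : (r : Cell (suc d)) → Adj r (raise 0 r)
  adj-raise₀ (x ∷ r) = adj (cong₂ _+_ (∣n-suc[n]∣≡1 x) (dist-refl r))

  -- A cell of greatest first coordinate supports a ray of any length, which can be cut off again.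
  polycount-extension : ∀ d j n → j ≤ n → polycount (suc d) j ≤ n ^ suc d * polycount (suc d) n
  polycount-extension d j n j≤n = ≤-trans
    (unique-decode-length {cs = codes} dec (polycubes-unique (suc d) j) encode)
    (pairs-length-≤ (λ _ → box (suc d) n) (polycubes (suc d) n) (n ^ suc d) λ _ → ≤-reflexive (length-box (suc d) n))
    where
    k = n ∸ j
    codes : List (List (Cell (suc d)) × Cell (suc d))
    codes = pairs (λ _ → box (suc d) n) (polycubes (suc d) n)
    dec : List (Cell (suc d)) × Cell (suc d) → List (Cell (suc d))
    dec (P , r) = canon j (filter (λ c → ¬? (c ∈? ray r k)) P)
    encode : ∀ {S} → S ∈ polycubes (suc d) j → ∃[ c ] (c ∈ codes × S ≡ dec c)
    encode {[]}    S∈ = contradiction (subst (λ i → [] ∈ polycubes (suc d) i) (sym (Normal.size (polycube-normal S∈))) S∈) polycubes-zero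
    encode {S@(c₀ ∷ S′)} S∈ with argmax height c₀ S′
    ... | r , r∈ , top = (canon n Y , r)
        , ∈-pairs⁺ (λ _ → box (suc d) n) (canon-polycube NY) (box-mono j≤n (sublists-⊆ (box _ j) (polycube-sublist S∈) r∈))
        , sym (polycube-canon S∈ back forth)
      where
      open Normal (polycube-normal S∈)
      Y = ray r k ++ S
      apart : ∀ {z} → z ∈ ray r k → z ∉ S
      apart z∈ z∈S with ∈-ray⁻ r k z∈
      ... | i , _ , refl = <⇒≱ (raise-height i r) (top z∈S)
      climb : ∀ i → i < k → Link (_∈ Y) r (raise i r)
      climb zero    i<k = (∈-++⁺ˡ (∈-map⁺ _ (∈-upTo⁺ i<k)) , adj-raise₀ r) ◅ ε
      climb (suc i) i<k = link-snoc (climb i (<-trans (n<1+n i) i<k)) (∈-++⁺ˡ (∈-map⁺ _ (∈-upTo⁺ i<k))) (adj-raise i r)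
      links : ∀ {z} → z ∈ Y → Link (_∈ Y) r z
      links z∈ with ∈-++⁻ (ray r k) z∈
      ... | inj₂ p = link-mono (∈-++⁺ʳ (ray r k)) (conn r∈ p)
      ... | inj₁ p with ∈-ray⁻ r k p
      ...   | i , i<k , refl = climb i i<k
      NY : Normal (suc d) n Y
      NY = record
        { unique = Uniq.++⁺ (Uniq.map⁺ (raise-injective r) (Uniq.upTo⁺ k)) unique λ { (p , q) → apart p q }
        ; size   = trans (length-++ (ray r k)) (trans (cong₂ _+_ (trans (length-map _ (upTo k)) (length-upTo k)) size) (m∸n+n≡m j≤n))
        ; conn   = conn-from (∈-++⁺ʳ (ray r k) r∈) links
        ; touch  = λ i → let (c , c∈ , e) = touch i in c , ∈-++⁺ʳ (ray r k) c∈ , e }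
      back : ∀ {c} → c ∈ filter (λ c → ¬? (c ∈? ray r k)) (canon n Y) → c ∈ S
      back c∈ with ∈-filter⁻ (λ c → ¬? (c ∈? ray r k)) {xs = canon n Y} c∈
      ... | c∈Y , c∉ with ∈-++⁻ (ray r k) (∈-canon⁻ NY c∈Y)
      ...   | inj₁ p = contradiction p c∉
      ...   | inj₂ p = p
      forth : ∀ {c} → c ∈ S → c ∈ filter (λ c → ¬? (c ∈? ray r k)) (canon n Y)
      forth c∈ = ∈-filter⁺ (λ c → ¬? (c ∈? ray r k)) (∈-canon⁺ NY (∈-++⁺ʳ (ray r k) c∈)) λ p → apart p c∈

  unique-++ʳ : ∀ (xs : List X) {ys} → Unique (xs ++ ys) → Unique ys
  unique-++ʳ []       u = u
  unique-++ʳ (x ∷ xs) u = unique-++ʳ xs (unique-tail u)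

  unique-++ˡ : ∀ (xs : List X) {ys} → Unique (xs ++ ys) → Unique xs
  unique-++ˡ []       u = []
  unique-++ˡ (x ∷ xs) u = unique-∷ (unique-∉ u ∘ ∈-++⁺ˡ) (unique-++ˡ xs (unique-tail u))

  unique-++-disjoint : ∀ (xs : List X) {ys} → Unique (xs ++ ys) → ∀ {x} → x ∈ xs → x ∉ ys
  unique-++-disjoint (x ∷ xs) u (here refl) y∈ = unique-∉ u (∈-++⁺ʳ xs y∈)
  unique-++-disjoint (x ∷ xs) u (there p)   y∈ = unique-++-disjoint xs (unique-tail u) p y∈

  -- The piece `qs` keeps its root `q`, which also stays in `rs`, so both parts are connected and
  -- their sizes add up to one more than the whole.
  record Split (t : ℕ) (r : Cell d) (xs : List (Cell d)) : Set where
    field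
      {q}        : Cell d
      {qs rest rs} : List (Cell d)
      q-tree     : Tree q qs
      r-tree     : Tree r rs
      q-rest     : qs ↭ q ∷ rest
      q∈rs       : q ∈ rs
      cover      : rest ++ rs ↭ xs
      large      : t ≤ length qs
      small      : length qs < t + t

  ∈-↭ : {x : X} {xs : List X} → x ∈ xs → ∃[ ys ] xs ↭ x ∷ ys
  ∈-↭ {x = x} x∈ with ∈-∃++ x∈
  ... | ys , zs , refl = ys ++ zs , shift x ys zs

  -- Descend into a component that still has at least t cells. Roots are never removed, so the cut
  -- component can be put back in reduced form at its old place.
  tree-split : ∀ t {r : Cell d} {xs} → 2 ≤ t → Tree r xs → t ≤ length xs → Split t r xs
  tree-split t 2≤t (single x) le = contradiction (≤-trans 2≤t le) λ { (s≤s ()) }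
  tree-split t 2≤t (attach {y = y} {xs} {ys} T U a) le with t ≤? length xs | t ≤? length ys
  ... | yes p | _ = record
    { q-tree = q-tree ; r-tree = attach r-tree U a ; q-rest = q-rest ; q∈rs = ∈-++⁺ˡ q∈rs
    ; cover = ↭-trans (++-assoc-↭ rest _ ys) (++⁺ʳ ys cover) ; large = large ; small = small }
    where
    open Split (tree-split t 2≤t T p)
    ++-assoc-↭ : ∀ (as bs cs : List (Cell _)) → as ++ (bs ++ cs) ↭ (as ++ bs) ++ cs
    ++-assoc-↭ as bs cs = ↭-reflexive (sym (++-assoc as bs cs))
  ... | no _ | yes p = record
    { q-tree = q-tree ; r-tree = attach T r-tree a ; q-rest = q-rest ; q∈rs = ∈-++⁺ʳ xs q∈rs
    ; cover = ↭-trans (shifts rest xs) (++⁺ˡ xs cover) ; large = large ; small = small }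
    where open Split (tree-split t 2≤t U p)
  -- Both components are smaller than t, hence the whole is smaller than 2t: it is cut off entirely,
  -- leaving only its root behind.
  ... | no p | no p′ = record
    { q-tree = attach T U a ; r-tree = single y ; q-rest = proj₂ found ; q∈rs = here refl
    ; cover = ↭-trans (++-comm (proj₁ found) (y ∷ [])) (↭-sym (proj₂ found))
    ; large = le
    ; small = subst (_< t + t) (sym (length-++ xs)) (+-mono-< (≰⇒> p) (≰⇒> p′)) }
    where found = ∈-↭ (∈-++⁺ʳ xs (root∈ U))

  minima : (c : Cell d) (xs : List (Cell d)) → Cell d
  minima c []       = c
  minima c (x ∷ xs) = zipWith _⊓_ x (minima c xs)

  minima-≤ : (c : Cell d) (xs : List (Cell d)) → ∀ {z} → z ∈ c ∷ xs → ∀ i → lookup (minima c xs) i ≤ lookup z i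
  minima-≤ c []       (here refl) i = ≤-refl
  minima-≤ c (x ∷ xs) z∈ i rewrite Vec.lookup-zipWith _⊓_ i x (minima c xs) with z∈
  ... | here refl         = ≤-trans (m⊓n≤n _ _) (minima-≤ c xs (here refl) i)
  ... | there (here refl) = m⊓n≤m _ _
  ... | there (there p)   = ≤-trans (m⊓n≤n _ _) (minima-≤ c xs (there p) i)

  minima-attained : (c : Cell d) (xs : List (Cell d)) → ∀ i →
    ∃[ z ] (z ∈ c ∷ xs × lookup z i ≡ lookup (minima c xs) i)
  minima-attained c []       i = c , here refl , refl
  minima-attained c (x ∷ xs) i with minima-attained c xs i | ⊓-sel (lookup x i) (lookup (minima c xs) i)
  ... | z , z∈ , e | inj₁ s = x , there (here refl) , sym (trans (Vec.lookup-zipWith _⊓_ i x _) s)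
  ... | z , z∈ , e | inj₂ s = z , lift z∈ , trans e (sym (trans (Vec.lookup-zipWith _⊓_ i x _) s))
    where
    lift : z ∈ c ∷ xs → z ∈ c ∷ x ∷ xs
    lift (here p)  = here p
    lift (there p) = there (there p)

  ∸-restore : (a c : Cell d) → (∀ i → lookup a i ≤ lookup c i) → zipWith _+_ a (zipWith _∸_ c a) ≡ c
  ∸-restore []      []      h = refl
  ∸-restore (x ∷ a) (y ∷ c) h = cong₂ _∷_ (m+[n∸m]≡n (h zero)) (∸-restore a c (h ∘ suc))

  record Translate (d N : ℕ) (X : List (Cell d)) : Set where
    field
      base   : Cell d
      base∈  : base ∈ box d N
      shape  : List (Cell d)
      shape∈ : shape ∈ polycubes d (length X)
      from   : ∀ {c} → c ∈ map (zipWith _+_ base) shape → c ∈ X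
      to     : ∀ {c} → c ∈ X → c ∈ map (zipWith _+_ base) shape

  normalise : ∀ {d N} (X : List (Cell d)) {x : Cell d} → x ∈ X → Unique X → Conn (_∈ X) →
              (∀ {c} → c ∈ X → c ∈ box d N) → Translate d N X
  normalise {d} {N} X@(c₀ ∷ X′) _ uniq conn inbox = record
    { base = a
    ; base∈ = ∈-box⁺ λ i → ≤-<-trans (minima-≤ c₀ X′ (here refl) i) (∈-box⁻ (inbox (here refl)) i)
    ; shape = canon (length X) X₀
    ; shape∈ = canon-polycube N₀
    ; from = λ z∈ → let (w , w∈ , e) = ∈-map⁻ (zipWith _+_ a) z∈
                        (c , c∈ , e′) = ∈-map⁻ down (∈-canon⁻ N₀ w∈)
                    in subst (_∈ X) (sym (trans e (trans (cong (zipWith _+_ a) e′) (restore c∈)))) c∈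
    ; to = λ {c} c∈ → subst (_∈ map (zipWith _+_ a) (canon (length X) X₀)) (restore c∈)
                        (∈-map⁺ (zipWith _+_ a) (∈-canon⁺ N₀ (∈-map⁺ down c∈))) }
    where
    a = minima c₀ X′
    down : Cell d → Cell d
    down c = zipWith _∸_ c a
    X₀ = map down X
    restore : ∀ {c} → c ∈ X → zipWith _+_ a (down c) ≡ c
    restore {c} c∈ = ∸-restore a c (minima-≤ c₀ X′ c∈)
    down-link : ∀ {x y} → x ∈ X → Link (_∈ X) x y → Link (_∈ X₀) (down x) (down y)
    down-link x∈ ε = ε
    down-link {x} x∈ (_◅_ {j = z} (z∈ , adj e) p) =
      (∈-map⁺ down z∈ , adj (trans (sym (dist-shift a (down x) (down z)))
        (trans (cong₂ dist (restore x∈) (restore z∈)) e))) ◅ down-link z∈ p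
    conn₀ : Conn (_∈ X₀)
    conn₀ x∈ y∈ with ∈-map⁻ down x∈ | ∈-map⁻ down y∈
    ... | _ , p , refl | _ , q , refl = down-link p (conn p q)
    unique-map : ∀ {xs} → (∀ {c} → c ∈ xs → c ∈ X) → Unique xs → Unique (map down xs)
    unique-map {[]}     sub u = []
    unique-map {x ∷ xs} sub u = unique-∷ fresh (unique-map (sub ∘ there) (unique-tail u))
      where
      fresh : down x ∉ map down xs
      fresh p with ∈-map⁻ down p
      ... | y , y∈ , e = unique-∉ u (subst (_∈ xs) (trans (sym (restore (sub (there y∈))))
        (trans (cong (zipWith _+_ a) (sym e)) (restore (sub (here refl))))) y∈)
    N₀ : Normal d (length X) X₀
    N₀ = record
      { unique = unique-map id uniq
      ; size   = length-map down X
      ; conn   = conn₀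
      ; touch  = λ i → let (z , z∈ , e) = minima-attained c₀ X′ i in
          down z , ∈-map⁺ down z∈ , trans (Vec.lookup-zipWith _∸_ i z a) (trans (cong (_∸ lookup a i) e) (n∸n≡0 (lookup a i))) }

  concatTo : ℕ → (ℕ → List X) → List X
  concatTo zero    f = []
  concatTo (suc n) f = f n ++ concatTo n f

  length-concatTo : ∀ n (f : ℕ → List X) → length (concatTo n f) ≡ sumTo n (λ i → length (f i))
  length-concatTo zero    f = refl
  length-concatTo (suc n) f = trans (length-++ (f n)) (cong (length (f n) +_) (length-concatTo n f))

  ∈-concatTo⁺ : ∀ {n i} (f : ℕ → List X) {x} → i < n → x ∈ f i → x ∈ concatTo n f
  ∈-concatTo⁺ {n = suc n} {i} f i<n x∈ with i ≟ n
  ... | yes refl = ∈-++⁺ˡ x∈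
  ... | no ne    = ∈-++⁺ʳ (f n) (∈-concatTo⁺ f (≤∧≢⇒< (≤-pred i<n) ne) x∈)

  ∈-concatTo⁻ : ∀ n (f : ℕ → List X) {x} → x ∈ concatTo n f → ∃[ i ] (i < n × x ∈ f i)
  ∈-concatTo⁻ (suc n) f x∈ with ∈-++⁻ (f n) x∈
  ... | inj₁ p = n , ≤-refl , p
  ... | inj₂ p = let (i , i<n , q) = ∈-concatTo⁻ n f p in i , m≤n⇒m≤1+n i<n , q

  -- The spanning tree is cut with t = s + 1, so the piece has s + 1 + i cells with i ≤ s. Both
  -- pieces are normalised, and the two factors M^d record the translations that put them back.
  polycount-split : ∀ d s M → 1 ≤ s → suc s ≤ M →
    polycount d M ≤ (M ^ d * M ^ d) * sumTo (suc s) (λ i → polycount d (suc s + i) * polycount d (M ∸ (s + i)))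
  polycount-split d s M 1≤s s<M = ≤-trans
    (unique-decode-length {cs = concatTo (suc s) codes} dec (polycubes-unique d M) encode)
    (≤-trans (≤-reflexive (length-concatTo (suc s) codes))
      (≤-trans (sumTo-mono (suc s) (λ i _ → codes-length i))
        (≤-reflexive (sumTo-*ˡ (suc s) (M ^ d * M ^ d) _))))
    where
    Code : Set
    Code = (List (Cell d) × List (Cell d)) × (Cell d × Cell d)
    codes : ℕ → List Code
    codes i = pairs (λ _ → pairs (λ _ → box d M) (box d M))
                    (pairs (λ _ → polycubes d (M ∸ (s + i))) (polycubes d (suc s + i)))
    codes-length : ∀ i → length (codes i) ≤ M ^ d * M ^ d * (polycount d (suc s + i) * polycount d (M ∸ (s + i)))
    codes-length i = ≤-trans
      (pairs-length-≤ (λ _ → pairs (λ _ → box d M) (box d M)) (pairs (λ _ → polycubes d (M ∸ (s + i))) (polycubes d (suc s + i))) (M ^ d * M ^ d) λ _ → ≤-trans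
        (pairs-length-≤ (λ _ → box d M) (box d M) (M ^ d) λ _ → ≤-reflexive (length-box d M))
        (≤-reflexive (cong (M ^ d *_) (length-box d M))))
      (*-monoʳ-≤ (M ^ d * M ^ d) (≤-trans
        (pairs-length-≤ (λ _ → polycubes d (M ∸ (s + i))) (polycubes d (suc s + i)) (polycount d (M ∸ (s + i))) λ _ → ≤-refl)
        (≤-reflexive (*-comm (polycount d (M ∸ (s + i))) (polycount d (suc s + i))))))
    dec : Code → List (Cell d)
    dec ((Q , R) , (a , b)) = canon M (map (zipWith _+_ a) Q ++ map (zipWith _+_ b) R)
    encode : ∀ {S} → S ∈ polycubes d M → ∃[ c ] (c ∈ concatTo (suc s) codes × S ≡ dec c)
    encode {[]} S∈ = contradiction (subst (suc s ≤_) (sym (Normal.size (polycube-normal S∈))) s<M) λ ()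
    encode {S@(c₀ ∷ _)} S∈ with spanning-tree (Normal.conn (polycube-normal S∈)) (here refl)
    ... | xs , t , u , ⊆S , S⊆ = ((QT.shape , RT.shape) , (QT.base , RT.base))
        , ∈-concatTo⁺ codes (s≤s i≤s) (∈-pairs⁺ _
            (∈-pairs⁺ _ (subst (λ k → QT.shape ∈ polycubes d k) size-q QT.shape∈)
                        (subst (λ k → RT.shape ∈ polycubes d k) size-r RT.shape∈))
            (∈-pairs⁺ _ QT.base∈ RT.base∈))
        , sym (polycube-canon S∈ back forth)
      where
      len : length xs ≡ M
      len = trans (same-members-length u (Normal.unique (polycube-normal S∈)) ⊆S S⊆) (Normal.size (polycube-normal S∈))
      open Split (tree-split (suc s) (s≤s 1≤s) t (subst (suc s ≤_) (sym len) s<M))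
      inbox : ∀ {c} → c ∈ S → c ∈ box d M
      inbox = sublists-⊆ (box d M) (polycube-sublist S∈)
      u′ : Unique (rest ++ rs)
      u′ = unique-resp-↭ (↭-sym cover) u
      rs⊆ : ∀ {c} → c ∈ rs → c ∈ S
      rs⊆ c∈ = ⊆S (∈-resp-↭ cover (∈-++⁺ʳ rest c∈))
      qs⊆ : ∀ {c} → c ∈ qs → c ∈ S
      qs⊆ c∈ with ∈-resp-↭ q-rest c∈
      ... | here refl = rs⊆ q∈rs
      ... | there p   = ⊆S (∈-resp-↭ cover (∈-++⁺ˡ p))
      u-rs : Unique rs
      u-rs = unique-++ʳ rest u′
      u-qs : Unique qs
      u-qs = unique-resp-↭ (↭-sym q-rest) (unique-∷ (λ p → unique-++-disjoint rest u′ p q∈rs) (unique-++ˡ rest u′))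
      module QT = Translate (normalise {N = M} qs (root∈ q-tree) u-qs (tree-conn q-tree) (inbox ∘ qs⊆))
      module RT = Translate (normalise {N = M} rs (root∈ r-tree) u-rs (tree-conn r-tree) (inbox ∘ rs⊆))
      i = length qs ∸ suc s
      size-q : length qs ≡ suc s + i
      size-q = sym (m+[n∸m]≡n large)
      i≤s : i ≤ s
      i≤s = m≤n+o⇒m∸n≤o (length qs) (suc s) (≤-pred (subst (length qs <_) (cong suc (+-suc s s)) small))
      size-r : length rs ≡ M ∸ (s + i)
      size-r = trans (sym (m+n∸m≡n (length rest) (length rs)))
        (cong₂ _∸_ (trans (sym (length-++ rest)) (trans (↭-length cover) len))
                   (suc-injective (trans (sym (↭-length q-rest)) size-q)))
      back : ∀ {c} → c ∈ map (zipWith _+_ QT.base) QT.shape ++ map (zipWith _+_ RT.base) RT.shape → c ∈ S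
      back c∈ with ∈-++⁻ (map (zipWith _+_ QT.base) QT.shape) c∈
      ... | inj₁ p = qs⊆ (QT.from p)
      ... | inj₂ p = rs⊆ (RT.from p)
      forth : ∀ {c} → c ∈ S → c ∈ map (zipWith _+_ QT.base) QT.shape ++ map (zipWith _+_ RT.base) RT.shape
      forth c∈ with ∈-++⁻ rest (∈-resp-↭ (↭-sym cover) (S⊆ c∈))
      ... | inj₁ p = ∈-++⁺ˡ (QT.to (∈-resp-↭ (↭-sym q-rest) (there p)))
      ... | inj₂ p = ∈-++⁺ʳ _ (RT.to p)

  -- Blocks of side three

  block : Cell d → Cell d
  block = Data.Vec.map (_/ 3)

  place : Cell d → Cell d → Cell d
  place = zipWith (λ y o → o + y * 3)

  cells : Cell d → List (Cell d)
  cells b = map (place b) (box _ 3)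

  center : Cell d → Cell d
  center = Data.Vec.map (λ y → 1 + y * 3)

  ring : Cell d → List (Cell d)
  ring b = filter (λ x → ¬? (x ≟c center b)) (cells b)

  o+y*3/3 : ∀ o y → o < 3 → (o + y * 3) / 3 ≡ y
  o+y*3/3 o y o<3 = trans (+-distrib-/-∣ʳ o {y * 3} {3} (divides-refl y))
    (cong₂ _+_ (m<n⇒m/n≡0 o<3) (m*n/n≡m y 3))

  block-place : (b o : Cell d) → (∀ i → lookup o i < 3) → block (place b o) ≡ b
  block-place []      []      h = refl
  block-place (y ∷ b) (o ∷ os) h = cong₂ _∷_ (o+y*3/3 o y (h zero)) (block-place b os (h ∘ suc))

  place-block : (x : Cell d) → place (block x) (Data.Vec.map (_% 3) x) ≡ x
  place-block []      = refl
  place-block (x ∷ c) = cong₂ _∷_ (sym (m≡m%n+[m/n]*n x 3)) (place-block c)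

  ∈-cells⁺ : ∀ {b x : Cell d} → block x ≡ b → x ∈ cells b
  ∈-cells⁺ {x = x} refl = subst (_∈ cells (block x)) (place-block x)
    (∈-map⁺ (place (block x)) (∈-box⁺ λ i → subst (_< 3) (sym (Vec.lookup-map i (_% 3) x)) (m%n<n (lookup x i) 3)))

  ∈-cells⁻ : ∀ {b x : Cell d} → x ∈ cells b → block x ≡ b
  ∈-cells⁻ {b = b} x∈ with ∈-map⁻ (place b) x∈
  ... | o , o∈ , refl = block-place b o (∈-box⁻ o∈)

  place-injective : (b : Cell d) {o o′ : Cell d} → place b o ≡ place b o′ → o ≡ o′
  place-injective []      {[]}     {[]}      e = refl
  place-injective (y ∷ b) {o ∷ os} {o′ ∷ os′} e =
    cong₂ _∷_ (+-cancelʳ-≡ (y * 3) o o′ (Vec.∷-injectiveˡ e)) (place-injective b (Vec.∷-injectiveʳ e))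

  cells-unique : (b : Cell d) → Unique (cells b)
  cells-unique b = Uniq.map⁺ (place-injective b) (box-unique _ 3)

  length-cells : (b : Cell d) → length (cells b) ≡ 3 ^ d
  length-cells {d} b = trans (length-map (place b) (box d 3)) (length-box d 3)

  block-center : (b : Cell d) → block (center b) ≡ b
  block-center []      = refl
  block-center (y ∷ b) = cong₂ _∷_ (o+y*3/3 1 y (s≤s (s≤s z≤n))) (block-center b)

  ∈-ring⁺ : ∀ {b x : Cell d} → block x ≡ b → x ≢ center b → x ∈ ring b
  ∈-ring⁺ e ne = ∈-filter⁺ (λ x → ¬? (x ≟c center _)) (∈-cells⁺ e) ne

  ∈-ring⁻ : ∀ {b x : Cell d} → x ∈ ring b → block x ≡ b × x ≢ center b
  ∈-ring⁻ {b = b} x∈ = let (p , q) = ∈-filter⁻ (λ x → ¬? (x ≟c center b)) {xs = cells b} x∈ in ∈-cells⁻ p , q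

  lookup-center : (b : Cell d) (i : Fin d) → lookup (center b) i ≡ 1 + lookup b i * 3
  lookup-center b i = Vec.lookup-map i _ b

  axis : Dir d → Fin d
  axis = proj₁

  shift₁ : Bool → ℕ → ℕ
  shift₁ true  = suc
  shift₁ false = pred

  move-updateAt : (c : Dir d) (x : Cell d) → move c x ≡ updateAt x (axis c) (shift₁ (proj₂ c))
  move-updateAt (i , true)  x = refl
  move-updateAt (i , false) x = refl

  lookup-move : (c : Dir d) (x : Cell d) → lookup (move c x) (axis c) ≡ shift₁ (proj₂ c) (lookup x (axis c))
  lookup-move c x = trans (cong (λ z → lookup z (axis c)) (move-updateAt c x)) (Vec.lookup∘updateAt (axis c) x)

  lookup-move-other : ∀ {i} (c : Dir d) (x : Cell d) → i ≢ axis c → lookup (move c x) i ≡ lookup x i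
  lookup-move-other {i = i} c x ne =
    trans (cong (λ z → lookup z i) (move-updateAt c x)) (Vec.lookup∘updateAt′ i (axis c) ne x)

  move-comm : (a c : Dir d) (x : Cell d) → axis a ≢ axis c → move a (move c x) ≡ move c (move a x)
  move-comm (i , s) (j , t) x ne = begin
    move (i , s) (move (j , t) x)                     ≡⟨ move-updateAt (i , s) _ ⟩
    updateAt (move (j , t) x) i (shift₁ s)            ≡⟨ cong (λ z → updateAt z i (shift₁ s)) (move-updateAt (j , t) x) ⟩
    updateAt (updateAt x j (shift₁ t)) i (shift₁ s)   ≡⟨ Vec.updateAt-commutes i j ne x ⟩
    updateAt (updateAt x i (shift₁ s)) j (shift₁ t)   ≡⟨ cong (λ z → updateAt z j (shift₁ t)) (sym (move-updateAt (i , s) x)) ⟩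
    updateAt (move (i , s) x) j (shift₁ t)            ≡⟨ sym (move-updateAt (j , t) _) ⟩
    move (j , t) (move (i , s) x)                     ∎
    where open ≡-Reasoning

  move-adj : (c : Dir d) (x : Cell d) → move c x ≢ x → Adj x (move c x)
  move-adj c x ne with move⇒adj c x
  ... | inj₁ e = contradiction e ne
  ... | inj₂ a = a

  module _ {d : ℕ} (b : Cell d) where

    -- Cells agreeing with the centre in the coordinate of c: moving along c keeps them in the block.
    central-move : (c : Dir d) (x : Cell d) → lookup x (axis c) ≡ lookup (center b) (axis c) → block x ≡ b →
                   block (move c x) ≡ b × lookup (move c x) (axis c) ≢ lookup (center b) (axis c)
    central-move c@(i , s) x e bx =
        trans (cong block (move-updateAt c x))
          (trans (Vec.map-updateAt {f = _/ 3} {g = shift₁ s} {h = id} x i (same s)) (trans (Vec.updateAt-id i _) bx))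
      , λ q → differ s (trans (sym (lookup-move c x)) (trans q (sym e)))
      where
      y = lookup b i
      at : lookup x i ≡ 1 + y * 3
      at = trans e (lookup-center b i)
      same : ∀ s → shift₁ s (lookup x i) / 3 ≡ lookup x i / 3
      same s rewrite at = trans (near s) (sym (o+y*3/3 1 y (s≤s (s≤s z≤n))))
        where
        near : ∀ s → shift₁ s (1 + y * 3) / 3 ≡ y
        near true  = o+y*3/3 2 y ≤-refl
        near false = o+y*3/3 0 y (s≤s z≤n)
      differ : ∀ s → shift₁ s (lookup x i) ≢ lookup x i
      differ s rewrite at = diff s
        where
        diff : ∀ s → shift₁ s (1 + y * 3) ≢ 1 + y * 3
        diff true  q = 1+n≢n q
        diff false q = 1+n≢n (sym q)

    ≢-center : ∀ {i} {x : Cell d} → lookup x i ≢ lookup (center b) i → x ≢ center b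
    ≢-center ne refl = ne refl

    neighbour∈ring : (c : Dir d) → move c (center b) ∈ ring b
    neighbour∈ring c = let (p , q) = central-move c (center b) refl (block-center b) in ∈-ring⁺ p (≢-center q)

    corner∈ring : (a c : Dir d) → axis a ≢ axis c → move c (move a (center b)) ∈ ring b
    corner∈ring a c ne =
      let (p , _) = central-move a (center b) refl (block-center b)
          (p′ , q′) = central-move c (move a (center b)) (lookup-move-other a (center b) (ne ∘ sym)) p
      in ∈-ring⁺ p′ (≢-center q′)

    module _ {M : Cell d → Set} (ring⊆ : ∀ {x} → x ∈ ring b → M x) where

      -- The two neighbours are joined through the cell reached from the centre by both moves, which
      -- lies in the shell.
      perpendicular-link : (a c : Dir d) → axis a ≢ axis c → Link M (move a (center b)) (move c (center b))
      perpendicular-link a c ne =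
        (ring⊆ (corner∈ring a c ne) , move-adj c _ (apart a c ne))
        ◅ (ring⊆ (neighbour∈ring c) , adj-sym (subst (Adj (move c (center b))) (move-comm a c _ ne)
            (move-adj a _ (apart c a (ne ∘ sym)))))
        ◅ ε
        where
        apart : ∀ a c → axis a ≢ axis c → move c (move a (center b)) ≢ move a (center b)
        apart a c ne e = proj₂ (central-move c (move a (center b)) off (proj₁ (central-move a (center b) refl (block-center b))))
          (trans (cong (λ z → lookup z (axis c)) e) off)
          where off = lookup-move-other a (center b) (ne ∘ sym)

      -- Neighbours on one axis are joined by way of a neighbour on another axis, which exists
      -- because d ≥ 2.
      neighbour-link : 2 ≤ d → ∀ {x y} → Adj (center b) x → Adj (center b) y → Link M x y
      neighbour-link 2≤d p q with adj⇒move p | adj⇒move q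
      ... | a , refl | c , refl with other-axis 2≤d (axis a) | axis a ≟F axis c
        where
        other-axis : 2 ≤ d → (i : Fin d) → ∃[ j ] i ≢ j
        other-axis (s≤s (s≤s _)) zero    = suc zero , λ ()
        other-axis (s≤s (s≤s _)) (suc i) = zero , λ ()
      ... | _ | no ne = perpendicular-link a c ne
      ... | j , ne | yes e = perpendicular-link a (j , true) ne ◅◅
                             perpendicular-link (j , true) c (λ e′ → ne (trans e (sym e′)))

  -- Each visit to `c` enters from one of its neighbours and leaves to another; `bypass` replaces
  -- these two hops.
  link-without : ∀ {c : Cell d} {S : List (Cell d)} {M : Cell d → Set} → (∀ {z} → z ∈ S → z ≢ c → M z) →
    (∀ {x y} → Adj c x → Adj c y → Link M x y) →
    ∀ {x y} → x ≢ c → y ≢ c → Link (_∈ S) x y → Link M x y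
  link-without {c = c} keep bypass x≢ y≢ ε = ε
  link-without {c = c} keep bypass x≢ y≢ (_◅_ {j = z} (z∈ , a) p) with z ≟c c
  ... | no z≢ = (keep z∈ z≢ , a) ◅ link-without keep bypass z≢ y≢ p
  link-without {c = c} keep bypass x≢ y≢ ((z∈ , a) ◅ ε) | yes refl = contradiction refl y≢
  link-without {c = c} keep bypass x≢ y≢ ((z∈ , a) ◅ _◅_ {j = w} (w∈ , a′) p) | yes refl =
    bypass (adj-sym a) a′ ◅◅ link-without keep bypass w≢ y≢ p
    where
    w≢ : w ≢ c
    w≢ refl = contradiction (trans (sym (dist-refl c)) (Adj.dist≡1 a′)) λ ()

  block-conn : (b : Cell d) → Conn (λ z → block z ≡ b)
  block-conn b = conn-from (at-corner b) (to-corner b _)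
    where
    corner : ∀ {d} → Cell d → Cell d
    corner = Data.Vec.map (_* 3)
    at-corner : ∀ {d} (b : Cell d) → block (corner b) ≡ b
    at-corner []      = refl
    at-corner (y ∷ b) = cong₂ _∷_ (o+y*3/3 0 y (s≤s z≤n)) (at-corner b)
    prefix : ∀ {d} {y x} {b c c′ : Cell d} → x / 3 ≡ y → Link (λ z → block z ≡ b) c c′ →
             Link (λ z → block z ≡ y ∷ b) (x ∷ c) (x ∷ c′)
    prefix {x = x} e = gmap (x ∷_) λ { (m , adj a) → cong₂ _∷_ e m , adj (cong₂ _+_ (∣n-n∣≡0 x) a) }
    climb : ∀ {d} {b c : Cell d} y o → o < 3 → block c ≡ b → Link (λ z → block z ≡ y ∷ b) (y * 3 ∷ c) (o + y * 3 ∷ c)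
    climb y zero    o<3 e = ε
    climb {c = c} y (suc o) o<3 e = link-snoc (climb y o (<-trans (n<1+n o) o<3) e)
      (cong₂ _∷_ (o+y*3/3 (suc o) y o<3) e) (adj (cong₂ _+_ (∣n-suc[n]∣≡1 (o + y * 3)) (dist-refl c)))
    to-corner : ∀ {d} (b x : Cell d) → block x ≡ b → Link (λ z → block z ≡ b) (corner b) x
    to-corner []      []      e = ε
    to-corner (y ∷ b) (x ∷ c) refl = prefix (o+y*3/3 0 y (s≤s z≤n)) (to-corner b c refl)
      ◅◅ subst (λ z → Link (λ w → block w ≡ x / 3 ∷ block c) (y * 3 ∷ c) (z ∷ c)) (sym (m≡m%n+[m/n]*n x 3)) (climb y (x % 3) (m%n<n x 3) refl)

  -- A finite supply of candidates: a full block meets `S`, and so does a block whose shell lies in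
  -- `S`, the shell being nonempty in positive dimension.
  touched : List (Cell d) → List (Cell d)
  touched S = deduplicate _≟c_ (map block S)

  Full Ring : Cell d → List (Cell d) → Set
  Full b S = All (_∈ S) (cells b)
  Ring b S = All (_∈ S) (ring b)

  full? : (S : List (Cell d)) (b : Cell d) → Dec (Full b S)
  full? S b = all? (_∈? S) (cells b)

  ring? : (S : List (Cell d)) (b : Cell d) → Dec (Ring b S)
  ring? S b = all? (_∈? S) (ring b)

  fulls slots : List (Cell d) → List (Cell d)
  fulls S = filter (full? S) (touched S)
  slots S = filter (ring? S) (touched S)

  touched-unique : (S : List (Cell d)) → Unique (touched S)
  touched-unique S = DecUniq.deduplicate-! _≟c_ (map block S)

  ∈-touched⁺ : ∀ {S : List (Cell d)} {x} → x ∈ S → block x ∈ touched S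
  ∈-touched⁺ x∈ = ∈-deduplicate⁺ _≟c_ (∈-map⁺ block x∈)

  length-touched : (S : List (Cell d)) → length (touched S) ≤ length S
  length-touched S = subst (length (touched S) ≤_) (length-map block S)
    (unique-⊆-length (touched-unique S) (∈-deduplicate⁻ _≟c_ (map block S)))

  full-center : ∀ {b} {S : List (Cell d)} → Full b S → center b ∈ S
  full-center {b = b} f = All.lookup f (∈-cells⁺ (block-center b))

  full⇒ring : ∀ {b} {S : List (Cell d)} → Full b S → Ring b S
  full⇒ring {b = b} f = All.tabulate λ z∈ → All.lookup f (∈-cells⁺ (proj₁ (∈-ring⁻ z∈)))

  ∈-fulls⁺ : ∀ {b} {S : List (Cell d)} → Full b S → b ∈ fulls S
  ∈-fulls⁺ {b = b} {S} f = ∈-filter⁺ (full? S) (subst (_∈ touched S) (block-center b) (∈-touched⁺ (full-center f))) f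

  ∈-fulls⁻ : ∀ {b} {S : List (Cell d)} → b ∈ fulls S → Full b S
  ∈-fulls⁻ {S = S} b∈ = proj₂ (∈-filter⁻ (full? S) {xs = touched S} b∈)

  ∈-slots⁺ : ∀ {b} {S : List (Cell (suc d))} → Ring b S → b ∈ slots S
  ∈-slots⁺ {b = b} {S} f = ∈-filter⁺ (ring? S)
    (subst (_∈ touched S) (proj₁ (∈-ring⁻ x∈)) (∈-touched⁺ (All.lookup f x∈))) f
    where
    x∈ : move (zero , true) (center b) ∈ ring b
    x∈ = neighbour∈ring b (zero , true)

  ∈-slots⁻ : ∀ {b} {S : List (Cell d)} → b ∈ slots S → Ring b S
  ∈-slots⁻ {S = S} b∈ = proj₂ (∈-filter⁻ (ring? S) {xs = touched S} b∈)

  -- The common part of switching on one centre and of filling a whole block: only the block `b`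
  -- changes, and it becomes full, so the number of full blocks rises by exactly one.
  record Refill (b : Cell d) (S S′ : List (Cell d)) : Set where
    field
      grows  : ∀ {z} → z ∈ S → z ∈ S′
      inside : ∀ {z} → z ∈ S′ → z ∈ S ⊎ block z ≡ b
      filled : Full b S′
      unfilled : ¬ Full b S

    fulls-suc : length (fulls S′) ≡ suc (length (fulls S))
    fulls-suc = same-members-length (filter-unique _ (touched-unique S′))
      (unique-∷ (unfilled ∘ ∈-fulls⁻) (filter-unique _ (touched-unique S))) fwd bwd
      where
      fwd : ∀ {x} → x ∈ fulls S′ → x ∈ b ∷ fulls S
      fwd {x} x∈ with x ≟c b
      ... | yes refl = here refl
      ... | no ne    = there (∈-fulls⁺ (All.tabulate λ z∈ → old (∈-cells⁻ z∈) (inside (All.lookup (∈-fulls⁻ x∈) z∈))))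
        where
        old : ∀ {z} → block z ≡ x → z ∈ S ⊎ block z ≡ b → z ∈ S
        old e (inj₁ z∈) = z∈
        old e (inj₂ e′) = contradiction (trans (sym e) e′) ne
      bwd : ∀ {x} → x ∈ b ∷ fulls S → x ∈ fulls S′
      bwd (here refl) = ∈-fulls⁺ filled
      bwd (there x∈)  = ∈-fulls⁺ (All.map grows (∈-fulls⁻ x∈))

  record Flip (b : Cell d) (S S′ : List (Cell d)) : Set where
    field
      grows  : ∀ {z} → z ∈ S → z ∈ S′
      inside : ∀ {z} → z ∈ S′ → z ∈ S ⊎ z ≡ center b
      added  : center b ∈ S′
      absent : center b ∉ S
      around : Ring b S

    refill : Refill b S S′
    refill = record
      { grows = grows
      ; inside = λ z∈ → weaken (inside z∈)
      ; filled = All.tabulate fill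
      ; unfilled = absent ∘ full-center }
      where
      weaken : ∀ {z} → z ∈ S ⊎ z ≡ center b → z ∈ S ⊎ block z ≡ b
      weaken (inj₁ p)    = inj₁ p
      weaken (inj₂ refl) = inj₂ (block-center b)
      fill : ∀ {z} → z ∈ cells b → z ∈ S′
      fill {z} z∈ with z ≟c center b
      ... | yes refl = added
      ... | no ne    = grows (All.lookup around (∈-ring⁺ (∈-cells⁻ z∈) ne))

  -- The only changed cell is a centre, and a centre lies in the shell of neither its own block nor
  -- any other block.
  slots-flip : ∀ {b} {S S′ : List (Cell (suc d))} → Flip b S S′ → length (slots S) ≡ length (slots S′)
  slots-flip {b = b} {S} {S′} F = same-members-length
    (filter-unique _ (touched-unique S)) (filter-unique _ (touched-unique S′))
    (λ x∈ → ∈-slots⁺ (All.map grows (∈-slots⁻ x∈)))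
    (λ x∈ → ∈-slots⁺ (All.tabulate λ z∈ → old (∈-ring⁻ z∈) (inside (All.lookup (∈-slots⁻ x∈) z∈))))
    where
    open Flip F
    old : ∀ {x z} → block z ≡ x × z ≢ center x → z ∈ S ⊎ z ≡ center b → z ∈ S
    old _          (inj₁ z∈)   = z∈
    old (e , ne)   (inj₂ refl) = contradiction (cong center (trans (sym (block-center b)) e)) ne

  fulls≤slots : (S : List (Cell (suc d))) → length (filter (full? S) (slots S)) ≡ length (fulls S)
  fulls≤slots S = same-members-length
    (filter-unique _ (filter-unique _ (touched-unique S))) (filter-unique _ (touched-unique S))
    (λ x∈ → ∈-fulls⁺ {S = S} (proj₂ (∈-filter⁻ (full? S) {xs = slots S} x∈)))
    (λ x∈ → ∈-filter⁺ (full? S) (∈-slots⁺ (full⇒ring (∈-fulls⁻ {S = S} x∈))) (∈-fulls⁻ x∈))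

  length-empty-slots : (S : List (Cell (suc d))) →
    length (filter (¬? ∘ full? S) (slots S)) ≡ length (slots S) ∸ length (fulls S)
  length-empty-slots S = trans (sym (m+n∸m≡n (length (filter (full? S) (slots S))) _))
    (cong₂ _∸_ (length-filter-split (full? S) (slots S)) (fulls≤slots S))

  without : Cell d → List (Cell d) → List (Cell d)
  without c = filter λ x → ¬? (x ≟c c)

  ∈-without⁺ : ∀ {c x : Cell d} {S} → x ∈ S → x ≢ c → x ∈ without c S
  ∈-without⁺ {c = c} = ∈-filter⁺ λ x → ¬? (x ≟c c)

  ∈-without⁻ : ∀ {c x : Cell d} S → x ∈ without c S → x ∈ S × x ≢ c
  ∈-without⁻ {c = c} S = ∈-filter⁻ (λ x → ¬? (x ≟c c)) {xs = S}

  module _ {d n : ℕ} {b : Cell (suc d)} {S : List (Cell (suc d))}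
    (N : Normal (suc d) n S) (around : Ring b S) (absent : center b ∉ S) where
    private
      open Normal N
      c = center b
      nbr = move (zero , true) c
      nbr∈ : nbr ∈ S
      nbr∈ = All.lookup around (neighbour∈ring b (zero , true))

    add-center : Normal (suc d) (suc n) (c ∷ S)
    add-center = record
      { unique = unique-∷ absent unique
      ; size   = cong suc size
      ; conn   = conn-from (there nbr∈) λ
          { (here refl) → (here refl , adj-sym (move-adj (zero , true) c
                            (proj₂ (∈-ring⁻ {b = b} (neighbour∈ring b (zero , true)))))) ◅ ε
          ; (there p)   → link-mono there (conn nbr∈ p) }
      ; touch  = λ i → let (z , z∈ , e) = touch i in z , there z∈ , e }

    add-center-flip : Flip b S (canon (suc n) (c ∷ S))
    add-center-flip = record
      { grows  = λ z∈ → ∈-canon⁺ add-center (there z∈)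
      ; inside = λ z∈ → split (∈-canon⁻ add-center z∈)
      ; added  = ∈-canon⁺ add-center (here refl)
      ; absent = absent
      ; around = around }
      where
      split : ∀ {z} → z ∈ c ∷ S → z ∈ S ⊎ z ≡ c
      split (here e)  = inj₂ e
      split (there p) = inj₁ p

  module _ {d n : ℕ} {b : Cell (suc d)} {S : List (Cell (suc d))}
    (N : Normal (suc d) (suc n) S) (2≤d : 2 ≤ suc d) (full : Full b S) where
    private
      open Normal N
      c = center b
      D = without c S
      ring⊆ : ∀ {x} → x ∈ ring b → x ∈ D
      ring⊆ x∈ = let (e , ne) = ∈-ring⁻ {b = b} x∈ in ∈-without⁺ (All.lookup full (∈-cells⁺ e)) ne

    remove-center : Normal (suc d) n D
    remove-center = record
      { unique = filter-unique _ unique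
      ; size   = suc-injective (trans (same-members-length (unique-∷ (λ p → proj₂ (∈-without⁻ S p) refl) (filter-unique _ unique)) unique
          (λ { (here refl) → full-center full ; (there p) → proj₁ (∈-without⁻ S p) }) restore) size)
      ; conn   = λ x∈ y∈ → let (p , p′) = ∈-without⁻ S x∈ ; (q , q′) = ∈-without⁻ S y∈ in
          link-without ∈-without⁺ (neighbour-link b ring⊆ 2≤d) p′ q′ (conn p q)
      ; touch  = λ i → let (z , z∈ , e) = touch i in z , ∈-without⁺ z∈ (positive e) , e }
      where
      restore : ∀ {x} → x ∈ S → x ∈ c ∷ D
      restore {x} x∈ with x ≟c c
      ... | yes refl = here refl
      ... | no ne    = there (∈-without⁺ x∈ ne)
      -- Coordinates of a centre are 1 modulo 3, hence nonzero: removing it leaves every coordinate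
      -- hyperplane touched, and no translation shifts the partition into blocks.
      positive : ∀ {i z} → lookup z i ≡ 0 → z ≢ c
      positive {i} e refl = contradiction (trans (sym (lookup-center b i)) e) λ ()

    remove-center-flip : Flip b (canon n D) S
    remove-center-flip = record
      { grows  = λ z∈ → proj₁ (∈-without⁻ S (∈-canon⁻ remove-center z∈))
      ; inside = split
      ; added  = full-center full
      ; absent = λ p → proj₂ (∈-without⁻ S (∈-canon⁻ remove-center p)) refl
      ; around = All.tabulate λ z∈ → ∈-canon⁺ remove-center (ring⊆ z∈) }
      where
      split : ∀ {z} → z ∈ S → z ∈ canon n D ⊎ z ≡ c
      split {z} z∈ with z ≟c c
      ... | yes e = inj₂ e
      ... | no ne = inj₁ (∈-canon⁺ remove-center (∈-without⁺ z∈ ne))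

  strata : (d n k v : ℕ) → List (List (Cell d))
  strata d n k v = filter (λ S → length (fulls S) ≟ v) (filter (λ S → length (slots S) ≟ k) (polycubes d n))

  with-fulls : (d n v : ℕ) → List (List (Cell d))
  with-fulls d n v = filter (λ S → length (fulls S) ≟ v) (polycubes d n)

  ∈-strata⁻ : ∀ {d n k v S} → S ∈ strata d n k v →
              S ∈ polycubes d n × length (slots S) ≡ k × length (fulls S) ≡ v
  ∈-strata⁻ {d} {n} {k} {v} S∈ =
    let (p , q) = ∈-filter⁻ (λ S → length (fulls S) ≟ v) {xs = filter (λ S → length (slots S) ≟ k) (polycubes d n)} S∈
        (p′ , q′) = ∈-filter⁻ (λ S → length (slots S) ≟ k) {xs = polycubes d n} p
    in p′ , q′ , q

  ∈-strata⁺ : ∀ {d n k v S} → S ∈ polycubes d n → length (slots S) ≡ k → length (fulls S) ≡ v → S ∈ strata d n k v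
  ∈-strata⁺ {d} {n} {k} {v} p q r =
    ∈-filter⁺ (λ S → length (fulls S) ≟ v) (∈-filter⁺ (λ S → length (slots S) ≟ k) p q) r

  ∈-with-fulls⁻ : ∀ {d n v S} → S ∈ with-fulls d n v → S ∈ polycubes d n × length (fulls S) ≡ v
  ∈-with-fulls⁻ {d} {n} {v} = ∈-filter⁻ (λ S → length (fulls S) ≟ v) {xs = polycubes d n}

  strata-unique : ∀ d n k v → Unique (strata d n k v)
  strata-unique d n k v = filter-unique _ (filter-unique _ (polycubes-unique d n))

  module _ (d n k v : ℕ) (2≤d : 2 ≤ suc d) where
    private
      Config = List (Cell (suc d))
      lower = strata (suc d) n k v
      upper = strata (suc d) (suc n) k (suc v)
      empties : Config → List (Cell (suc d))
      empties S = filter (¬? ∘ full? S) (slots S)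

      length-empties : ∀ {S} → S ∈ lower → length (empties S) ≡ k ∸ v
      length-empties {S} S∈ = let (_ , q , r) = ∈-strata⁻ S∈ in trans (length-empty-slots S) (cong₂ _∸_ q r)

      up : Config × Cell (suc d) → Config × Cell (suc d)
      up (S , b) = canon (suc n) (center b ∷ S) , b

      down : Config × Cell (suc d) → Config × Cell (suc d)
      down (S , b) = canon n (without (center b) S) , b

      going-up : ∀ {S b} → S ∈ lower → b ∈ empties S →
        ∃[ S′ ] ∃[ b′ ] (S′ ∈ upper × b′ ∈ fulls S′ × (S , b) ≡ down (S′ , b′))
      going-up {S} {b} S∈ b∈ = S′ , b
        , ∈-strata⁺ (canon-polycube N′) (trans (sym (slots-flip F)) slots≡)
            (trans (Refill.fulls-suc (Flip.refill F)) (cong suc fulls≡))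
        , ∈-fulls⁺ (Refill.filled (Flip.refill F))
        , cong (_, b) (sym (polycube-canon S∈P
            (λ z∈ → let (p , q) = ∈-without⁻ S′ z∈ in old (Flip.inside F p) q)
            (λ z∈ → ∈-without⁺ (Flip.grows F z∈) λ { refl → absent z∈ })))
        where
        S∈P : S ∈ polycubes (suc d) n
        S∈P = proj₁ (∈-strata⁻ S∈)
        slots≡ : length (slots S) ≡ k
        slots≡ = proj₁ (proj₂ (∈-strata⁻ S∈))
        fulls≡ : length (fulls S) ≡ v
        fulls≡ = proj₂ (proj₂ (∈-strata⁻ S∈))
        split = ∈-filter⁻ (¬? ∘ full? S) {xs = slots S} b∈
        around : Ring b S
        around = ∈-slots⁻ {S = S} (proj₁ split)
        absent : center b ∉ S
        absent c∈ = proj₂ split (All.tabulate λ {z} z∈ → member z z∈)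
          where
          member : ∀ z → z ∈ cells b → z ∈ S
          member z z∈ with z ≟c center b
          ... | yes refl = c∈
          ... | no ne    = All.lookup around (∈-ring⁺ (∈-cells⁻ z∈) ne)
        N′ = add-center (polycube-normal S∈P) around absent
        S′ = canon (suc n) (center b ∷ S)
        F : Flip b S S′
        F = add-center-flip (polycube-normal S∈P) around absent
        old : ∀ {z} → z ∈ S ⊎ z ≡ center b → z ≢ center b → z ∈ S
        old (inj₁ p) q = p
        old (inj₂ p) q = contradiction p q

      going-down : ∀ {S b} → S ∈ upper → b ∈ fulls S →
        ∃[ S′ ] ∃[ b′ ] (S′ ∈ lower × b′ ∈ empties S′ × (S , b) ≡ up (S′ , b′))
      going-down {S} {b} S∈ b∈ = S′ , b
        , ∈-strata⁺ (canon-polycube N′) (trans (slots-flip F) slots≡)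
            (suc-injective (trans (sym (Refill.fulls-suc (Flip.refill F))) fulls≡))
        , ∈-filter⁺ (¬? ∘ full? S′) (∈-slots⁺ (Flip.around F)) (Flip.absent F ∘ full-center)
        , cong (_, b) (sym (polycube-canon S∈P
            (λ { (here refl) → Flip.added F ; (there p) → Flip.grows F p })
            (λ z∈ → new (Flip.inside F z∈))))
        where
        S∈P : S ∈ polycubes (suc d) (suc n)
        S∈P = proj₁ (∈-strata⁻ S∈)
        slots≡ : length (slots S) ≡ k
        slots≡ = proj₁ (proj₂ (∈-strata⁻ S∈))
        fulls≡ : length (fulls S) ≡ suc v
        fulls≡ = proj₂ (proj₂ (∈-strata⁻ S∈))
        full : Full b S
        full = ∈-fulls⁻ b∈
        N′ = remove-center (polycube-normal S∈P) 2≤d full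
        S′ = canon n (without (center b) S)
        F : Flip b S′ S
        F = remove-center-flip (polycube-normal S∈P) 2≤d full
        new : ∀ {z} → z ∈ S′ ⊎ z ≡ center b → z ∈ center b ∷ S′
        new (inj₁ p) = there p
        new (inj₂ p) = here p

    -- Switching is a bijection between smaller polycubes with a marked empty slot, of which each
    -- has k - v, and larger ones with a marked full block, of which each has v + 1.
    strata-flip : length upper * suc v ≡ length lower * (k ∸ v)
    strata-flip = ≤-antisym
      (subst₂ _≤_ (*-comm (suc v) (length upper)) (*-comm (k ∸ v) (length lower))
        (double-count fulls empties (suc v) (k ∸ v) up (strata-unique _ _ k (suc v))
          (λ {S} S∈ → filter-unique _ (touched-unique S) , ≤-reflexive (sym (proj₂ (proj₂ (∈-strata⁻ S∈)))))
          (λ S∈ → ≤-reflexive (length-empties S∈)) going-down))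
      (subst₂ _≤_ (*-comm (k ∸ v) (length lower)) (*-comm (suc v) (length upper))
        (double-count empties fulls (k ∸ v) (suc v) down (strata-unique _ _ k v)
          (λ {S} S∈ → filter-unique _ (filter-unique _ (touched-unique S)) , ≤-reflexive (sym (length-empties S∈)))
          (λ S∈ → ≤-reflexive (proj₂ (proj₂ (∈-strata⁻ S∈)))) going-up))

  strata≤with-fulls : ∀ d n k v → length (strata d n k v) ≤ length (with-fulls d n v)
  strata≤with-fulls d n k v = unique-⊆-length (strata-unique d n k v) λ S∈ →
    let (p , _ , r) = ∈-strata⁻ S∈ in ∈-filter⁺ (λ S → length (fulls S) ≟ v) p r

  with-fulls≤ : ∀ d n v → length (with-fulls d n v) ≤ polycount d n
  with-fulls≤ d n v = length-filter (λ S → length (fulls S) ≟ v) (polycubes d n)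

  polycount≤Σstrata : ∀ d n → polycount d n ≤ sumTo (suc n) (λ k → sumTo (suc n) (λ v → length (strata d n k v)))
  polycount≤Σstrata d n = ≤-reflexive (sym (trans
    (sumTo-cong (suc n) (λ k _ → sum-classes (length ∘ fulls) (suc n) (filter (λ S → length (slots S) ≟ k) (polycubes d n))
      λ S∈ → few _ (full? _) (proj₁ (∈-filter⁻ (λ S → length (slots S) ≟ k) {xs = polycubes d n} S∈))))
    (sum-classes (length ∘ slots) (suc n) (polycubes d n) λ S∈ → few _ (ring? _) S∈)))
    where
    few : ∀ S {P : Cell d → Set} (P? : ∀ b → Dec (P b)) → S ∈ polycubes d n → length (filter P? (touched S)) < suc n
    few S P? S∈ = s≤s (≤-trans (length-filter P? (touched S))
      (≤-trans (length-touched S) (≤-reflexive (Normal.size (polycube-normal S∈)))))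

  Σstrata≤polycount : ∀ d n K L → sumTo K (λ k → sumTo L (λ v → length (strata d n k v))) ≤ polycount d n
  Σstrata≤polycount d n K L = ≤-trans
    (sumTo-mono K λ k _ → sum-classes-≤ (length ∘ fulls) L (filter (λ S → length (slots S) ≟ k) (polycubes d n)))
    (sum-classes-≤ (length ∘ slots) K (polycubes d n))

  module _ (d n v : ℕ) where
    private
      E = 3 ^ d
      Config = List (Cell d)
      Mark = (Cell d × List (Cell d)) × Cell d
      fillable : Config → List (Cell d)
      fillable S = filter (λ x → ¬? (full? S (block x))) S
      filled : List Config
      filled = concatTo (suc E) λ i → with-fulls d (n + i) (suc v)
      contents : Cell d → List (List (Cell d) × Cell d)
      contents b = pairs (λ _ → cells b) (sublists (cells b))
      marks : Config → List (Cell d × (List (Cell d) × Cell d))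
      marks S = pairs contents (fulls S)
      outside : Cell d → List (Cell d) → List (Cell d)
      outside b = filter (λ z → ¬? (block z ≟c b))
      dec : Config × (Cell d × (List (Cell d) × Cell d)) → Config × Cell d
      dec (S , (b , (C , x))) = canon n (outside b S ++ C) , x

      length-fillable : ∀ {S} → S ∈ with-fulls d n v → n ∸ E * v ≤ length (fillable S)
      length-fillable {S} S∈ = m≤n+o⇒m∸n≤o n (E * v) (begin
        n                                 ≡⟨ sym (Normal.size (polycube-normal (proj₁ member))) ⟩
        length S                          ≡⟨ sym (length-filter-split (full? S ∘ block) S) ⟩
        length (filter (full? S ∘ block) S) + length (fillable S)
          ≤⟨ +-monoˡ-≤ (length (fillable S)) (unique-⊆-length (filter-unique _ (Normal.unique (polycube-normal (proj₁ member)))) in-full) ⟩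
        length (concatMap cells (fulls S)) + length (fillable S)
          ≡⟨ cong (_+ length (fillable S)) (trans (length-concatMap cells (fulls S) E length-cells) (trans (cong (_* E) (proj₂ member)) (*-comm v E))) ⟩
        E * v + length (fillable S)       ∎)
        where
        open ≤-Reasoning
        member = ∈-with-fulls⁻ S∈
        in-full : ∀ {x} → x ∈ filter (full? S ∘ block) S → x ∈ concatMap cells (fulls S)
        in-full x∈ = ∈-concatMap⁺ cells (lose (∈-fulls⁺ (proj₂ (∈-filter⁻ (full? S ∘ block) {xs = S} x∈))) (∈-cells⁺ refl))

      length-marks : ∀ {S} → S ∈ filled → length (marks S) ≤ E * suc v * 2 ^ E
      length-marks {S} S∈ with ∈-concatTo⁻ (suc E) (λ i → with-fulls d (n + i) (suc v)) S∈
      ... | i , _ , S∈′ = ≤-trans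
        (pairs-length-≤ contents (fulls S) (E * 2 ^ E) λ {b} _ → ≤-trans
          (pairs-length-≤ (λ _ → cells b) (sublists (cells b)) E λ _ → ≤-reflexive (length-cells b))
          (≤-reflexive (cong (E *_) (trans (length-sublists (cells b)) (cong (2 ^_) (length-cells b))))))
        (≤-reflexive (trans (cong (E * 2 ^ E *_) (proj₂ (∈-with-fulls⁻ S∈′)))
          (trans (*-assoc E (2 ^ E) (suc v)) (trans (cong (E *_) (*-comm (2 ^ E) (suc v))) (sym (*-assoc E (suc v) (2 ^ E)))))))

      fill : ∀ {S x} → S ∈ with-fulls d n v → x ∈ fillable S →
        ∃[ S′ ] ∃[ w ] (S′ ∈ filled × w ∈ marks S′ × (S , x) ≡ dec (S′ , w))
      fill {S} {x} S∈ x∈ = S′ , (b , (C , x))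
        , ∈-concatTo⁺ (λ i → with-fulls d (n + i) (suc v)) (s≤s i≤E)
            (∈-filter⁺ (λ S → length (fulls S) ≟ suc v) (canon-polycube NY)
              (trans (Refill.fulls-suc refill) (cong suc (proj₂ member))))
        , ∈-pairs⁺ contents (∈-fulls⁺ (Refill.filled refill))
            (∈-pairs⁺ (λ _ → cells b) (filter∈sublists (_∈? S) (cells b)) (∈-cells⁺ refl))
        , cong (_, x) (sym (polycube-canon (proj₁ member) back forth))
        where
        member = ∈-with-fulls⁻ S∈
        open Normal (polycube-normal (proj₁ member))
        b = block x
        x∈S : x ∈ S
        x∈S = proj₁ (∈-filter⁻ (λ x → ¬? (full? S (block x))) {xs = S} x∈)
        not-full : ¬ Full b S
        not-full = proj₂ (∈-filter⁻ (λ x → ¬? (full? S (block x))) {xs = S} x∈)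
        Y = outside b S ++ cells b
        C = filter (_∈? S) (cells b)
        outside⁻ : ∀ X {z} → z ∈ outside b X → z ∈ X × block z ≢ b
        outside⁻ X = ∈-filter⁻ (λ z → ¬? (block z ≟c b)) {xs = X}
        S⊆Y : ∀ {z} → z ∈ S → z ∈ Y
        S⊆Y {z} z∈ with block z ≟c b
        ... | yes e = ∈-++⁺ʳ (outside b S) (∈-cells⁺ e)
        ... | no ne = ∈-++⁺ˡ (∈-filter⁺ (λ z → ¬? (block z ≟c b)) z∈ ne)
        Y⊆ : ∀ {z} → z ∈ Y → z ∈ S ⊎ block z ≡ b
        Y⊆ z∈ with ∈-++⁻ (outside b S) z∈
        ... | inj₁ p = inj₁ (proj₁ (outside⁻ S p))
        ... | inj₂ p = inj₂ (∈-cells⁻ p)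
        u-Y : Unique Y
        u-Y = Uniq.++⁺ (filter-unique _ unique) (cells-unique b) λ { (p , q) → proj₂ (outside⁻ S p) (∈-cells⁻ q) }
        i = length Y ∸ n
        i≤E : i ≤ E
        i≤E = m≤n+o⇒m∸n≤o (length Y) n (≤-trans (≤-reflexive (length-++ (outside b S)))
          (+-mono-≤ (≤-trans (length-filter _ S) (≤-reflexive size)) (≤-reflexive (length-cells b))))
        NY : Normal d (n + i) Y
        NY = record
          { unique = u-Y
          ; size   = sym (m+[n∸m]≡n (subst (_≤ length Y) size (unique-⊆-length unique S⊆Y)))
          ; conn   = conn-resp (λ { (inj₁ p) → S⊆Y p ; (inj₂ e) → ∈-++⁺ʳ (outside b S) (∈-cells⁺ e) }) Y⊆
                       (conn-∪ conn (block-conn b) x∈S refl)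
          ; touch  = λ j → let (z , z∈ , e) = touch j in z , S⊆Y z∈ , e }
        S′ = canon (n + i) Y
        refill : Refill b S S′
        refill = record
          { grows = λ z∈ → ∈-canon⁺ NY (S⊆Y z∈)
          ; inside = λ z∈ → Y⊆ (∈-canon⁻ NY z∈)
          ; filled = All.tabulate λ z∈ → ∈-canon⁺ NY (∈-++⁺ʳ (outside b S) z∈)
          ; unfilled = not-full }
        back : ∀ {z} → z ∈ outside b S′ ++ C → z ∈ S
        back z∈ with ∈-++⁻ (outside b S′) z∈
        ... | inj₂ p = proj₂ (∈-filter⁻ (_∈? S) {xs = cells b} p)
        ... | inj₁ p with outside⁻ S′ p
        ...   | q , ne with Refill.inside refill q
        ...     | inj₁ r = r
        ...     | inj₂ e = contradiction e ne
        forth : ∀ {z} → z ∈ S → z ∈ outside b S′ ++ C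
        forth {z} z∈ with block z ≟c b
        ... | yes e = ∈-++⁺ʳ (outside b S′) (∈-filter⁺ (_∈? S) (∈-cells⁺ e) z∈)
        ... | no ne = ∈-++⁺ˡ (∈-filter⁺ (λ z → ¬? (block z ≟c b)) (Refill.grows refill z∈) ne)

    -- A cell x in a block that is not full is marked and its block filled; full blocks hold at most
    -- E v cells, so n - E v marks exist. To undo this it suffices to know which of the v + 1 full
    -- blocks it was, its former contents (2^E possibilities) and the place of x (E possibilities).
    filling-bound : (n ∸ E * v) * length (with-fulls d n v) ≤
                    E * suc v * 2 ^ E * sumTo (suc E) (λ i → length (with-fulls d (n + i) (suc v)))
    filling-bound = ≤-trans
      (double-count fillable marks (n ∸ E * v) (E * suc v * 2 ^ E) dec (filter-unique _ (polycubes-unique d n))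
        (λ S∈ → filter-unique _ (Normal.unique (polycube-normal (proj₁ (∈-with-fulls⁻ S∈))))
                , length-fillable S∈)
        length-marks fill)
      (≤-reflexive (cong (E * suc v * 2 ^ E *_) (length-concatTo (suc E) λ i → with-fulls d (n + i) (suc v))))

  -- Counting by twigs

  opp : Dir d → Dir d
  opp (i , s) = i , not s

  opp-opp : (c : Dir d) → opp (opp c) ≡ c
  opp-opp (i , true)  = refl
  opp-opp (i , false) = refl

  opp-move : (c : Dir d) (x : Cell d) → move c x ≢ x → move (opp c) (move c x) ≡ x
  opp-move (i , true)      x       ne = trans (Vec.updateAt-updateAt i x) (Vec.updateAt-id i x)
  opp-move (zero , false)  (zero ∷ x)  ne = contradiction refl ne
  opp-move (zero , false)  (suc y ∷ x) ne = refl
  opp-move (suc i , false) (y ∷ x) ne = cong (y ∷_) (opp-move (i , false) x λ e → ne (cong (y ∷_) e))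

  same-axis : (a c : Dir d) → axis c ≡ axis a → c ≡ a ⊎ c ≡ opp a
  same-axis (i , true)  (_ , true)  refl = inj₁ refl
  same-axis (i , true)  (_ , false) refl = inj₂ refl
  same-axis (i , false) (_ , true)  refl = inj₂ refl
  same-axis (i , false) (_ , false) refl = inj₁ refl

  _≟d_ : DecidableEquality (Dir d)
  _≟d_ = ≡-dec _≟F_ Bool._≟_

  dirs : ∀ d → List (Dir d)
  dirs d = concatMap (λ i → (i , true) ∷ (i , false) ∷ []) (allFin d)

  ∈-dirs : (c : Dir d) → c ∈ dirs d
  ∈-dirs (i , true)  = ∈-concatMap⁺ _ (lose (∈-allFin i) (here refl))
  ∈-dirs (i , false) = ∈-concatMap⁺ _ (lose (∈-allFin i) (there (here refl)))

  dirs-unique : ∀ d → Unique (dirs d)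
  dirs-unique d = concatMap-unique _ (Uniq.allFin⁺ d) (λ i → ((λ ()) ∷ []) ∷ [] ∷ [])
    λ p q → trans (sym (first p)) (first q)
    where
    first : ∀ {i : Fin d} {c} → c ∈ (i , true) ∷ (i , false) ∷ [] → axis c ≡ i
    first (here refl)         = refl
    first (there (here refl)) = refl

  length-dirs : ∀ d → length (dirs d) ≡ d * 2
  length-dirs d = trans (length-concatMap (λ i → (i , true) ∷ (i , false) ∷ []) (allFin d) 2 λ _ → refl)
    (cong (_* 2) (length-tabulate {n = d} id))

  others : (a b : Dir d) → List (Dir d)
  others {d} a b = filter (λ c → ¬? (c ≟d b)) (filter (λ c → ¬? (axis c ≟F axis a)) (dirs d))

  ∈-others⁻ : (a b : Dir d) → ∀ {c} → c ∈ others a b → axis c ≢ axis a × c ≢ b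
  ∈-others⁻ {d} a b c∈ =
    let (p , q) = ∈-filter⁻ (λ c → ¬? (c ≟d b)) {xs = filter (λ c → ¬? (axis c ≟F axis a)) (dirs d)} c∈
    in proj₂ (∈-filter⁻ (λ c → ¬? (axis c ≟F axis a)) {xs = dirs d} p) , q

  ∈-others⁺ : (a b : Dir d) → ∀ {c} → axis c ≢ axis a → c ≢ b → c ∈ others a b
  ∈-others⁺ a b {c} p q =
    ∈-filter⁺ (λ c → ¬? (c ≟d b)) (∈-filter⁺ (λ c → ¬? (axis c ≟F axis a)) (∈-dirs c) p) q

  -- The direction to the parent, the one straight ahead and the decided direction `b` are three
  -- distinct directions outside the list.
  length-others : (a b : Dir d) → axis a ≢ axis b → 3 + length (others a b) ≤ d * 2
  length-others {d} a b ne = subst (3 + length (others a b) ≤_) (length-dirs d)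
    (unique-⊆-length {xs = a ∷ opp a ∷ b ∷ others a b} (unique-∷ a∉ (unique-∷ opp∉ (unique-∷ b∉
      (filter-unique _ (filter-unique _ (dirs-unique d)))))) λ _ → ∈-dirs _)
    where
    b∉ : b ∉ others a b
    b∉ p = proj₂ (∈-others⁻ a b p) refl
    opp∉ : opp a ∉ b ∷ others a b
    opp∉ (here e)  = ne (cong proj₁ e)
    opp∉ (there p) = proj₁ (∈-others⁻ a b p) refl
    a∉ : a ∉ opp a ∷ b ∷ others a b
    a∉ (here e)          = contradiction (cong proj₂ e) (Bool.not-¬ refl)
    a∉ (there (here e))  = ne (cong axis e)
    a∉ (there (there p)) = proj₁ (∈-others⁻ a b p) refl

  Known : List (Cell d) → List (Cell d) → Cell d → Set
  Known occ emp z = z ∈ occ ⊎ z ∈ emp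

  known-mono : {occ emp occ′ emp′ : List (Cell d)} → (∀ {z} → z ∈ occ → z ∈ occ′) → (∀ {z} → z ∈ emp → z ∈ emp′) →
               ∀ {z} → Known occ emp z → Known occ′ emp′ z
  known-mono f g (inj₁ p) = inj₁ (f p)
  known-mono f g (inj₂ p) = inj₂ (g p)

  -- Decided once the cells of the list have been processed.
  Settled : (Cell d → Set) → List (Cell d) → Cell d → Set
  Settled K pre w = K w ⊎ ∃[ z ] (z ∈ pre × ∃[ c ] w ≡ move c z)

  -- When x is reached, the two perpendicular directions a (towards the parent) and b lead to decided
  -- cells, and so does every further step off the axis of a from the parent.
  record Context (K : Cell d → Set) (pre : List (Cell d)) (x : Cell d) : Set where
    field
      known  : K x
      a b    : Dir d
      perp   : axis a ≢ axis b
      parent : K (move a x)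
      around : ∀ c → axis c ≢ axis a → Settled K pre (move c (move a x))
      extra  : Settled K pre (move b x)

  -- `pre` holds the cells processed earlier than the head of the list. A cell deeper in the stack
  -- may rely on the neighbours of those above it, since these are decided by the time it is
  -- reached.
  data Contexts (K : Cell d → Set) : List (Cell d) → List (Cell d) → Set where
    []  : ∀ {pre} → Contexts K pre []
    _∷_ : ∀ {pre x xs} → Context K pre x → Contexts K (x ∷ pre) xs → Contexts K pre (x ∷ xs)

  contexts-mono : {K K′ : Cell d → Set} {pre pre′ : List (Cell d)} → (∀ {z} → K z → K′ z) →
    (∀ {w} → Settled K pre w → Settled K′ pre′ w) → ∀ {xs} → Contexts K pre xs → Contexts K′ pre′ xs
  contexts-mono f g []       = []
  contexts-mono {K = K} {K′} {pre} {pre′} f g (_∷_ {x = x} C Cs) = record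
    { known = f known ; a = a ; b = b ; perp = perp ; parent = f parent
    ; around = λ c ne → g (around c ne) ; extra = g extra } ∷ contexts-mono f g′ Cs
    where
    open Context C
    g′ : ∀ {w} → Settled K (x ∷ pre) w → Settled K′ (x ∷ pre′) w
    g′ (inj₁ k) = inj₁ (f k)
    g′ (inj₂ (z , here e , m)) = inj₂ (z , here e , m)
    g′ (inj₂ (z , there z∈ , m)) with g (inj₂ (z , z∈ , m))
    ... | inj₁ k                  = inj₁ k
    ... | inj₂ (y , y∈ , m′)      = inj₂ (y , there y∈ , m′)

  contexts-++ : {K : Cell d → Set} {pre : List (Cell d)} → ∀ {xs ys} → Contexts K pre xs →
    (∀ {pre′} → (∀ {z} → z ∈ xs → z ∈ pre′) → (∀ {z} → z ∈ pre → z ∈ pre′) → Contexts K pre′ ys) →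
    Contexts K pre (xs ++ ys)
  contexts-++ []       h = h (λ ()) id
  contexts-++ (C ∷ Cs) h = C ∷ contexts-++ Cs λ f g →
    h (λ { (here refl) → g (here refl) ; (there p) → f p }) (g ∘ there)

  module Count (d n m₂ : ℕ) (r : Cell d) (dim : d * 2 ≡ 4 + m₂) where

    m w : ℕ
    m = 2 + m₂
    w = suc m ^ m + m ^ m₂

    record Family (occ emp : List (Cell d)) (u : ℕ) (xs : List (List (Cell d))) : Set where
      field
        uniq-xs  : Unique xs
        valid    : ∀ {P} → P ∈ xs → P ∈ polycubes d n
        occupied : ∀ {P} → P ∈ xs → ∀ {c} → c ∈ occ → c ∈ P
        empty    : ∀ {P} → P ∈ xs → ∀ {c} → c ∈ emp → c ∉ P
        uniq-occ : Unique occ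
        size     : length occ + u ≡ n
        root     : r ∈ occ

    -- With y = 1/m this reads |xs| yᵘ ≤ F / M, where u is the number of cells not yet placed.
    record Bound (M F u : ℕ) (xs : List (List (Cell d))) : Set where
      constructor bound
      field ineq : length xs * M ≤ F * m ^ u

    open ≤-Reasoning

    weaken : ∀ {M F G u xs} → Bound M F u xs → F * m ≤ G → Bound (M * m) G u xs
    weaken {M} {F} {G} {u} {xs} (bound h) le = bound (begin
      length xs * (M * m)    ≡⟨ sym (*-assoc (length xs) M m) ⟩
      length xs * M * m      ≤⟨ *-monoˡ-≤ m h ⟩
      F * m ^ u * m          ≡⟨ *-swapʳ F (m ^ u) m ⟩
      F * m * m ^ u          ≤⟨ *-monoˡ-≤ (m ^ u) le ⟩
      G * m ^ u              ∎)

    bound-cast : ∀ {M F G u xs} → F ≡ G → Bound M F u xs → Bound M G u xs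
    bound-cast refl B = B

    -- The family splits according to whether it contains `z`. An occupied `z` uses up one
    -- outstanding cell and so has weight y, giving F₀/M + y F₁/M; if `z` was decided before, the
    -- first term alone suffices.
    branch : ∀ {occ emp u xs} z {M F₀ F₁} → Family occ emp u xs →
      (∀ {emp′ xs′} → Family occ emp′ u xs′ → (∀ {y} → y ∈ emp → y ∈ emp′) → Known occ emp′ z → Bound M F₀ u xs′) →
      (∀ {u′ xs′} → ¬ Known occ emp z → u ≡ suc u′ → Family (z ∷ occ) emp u′ xs′ → Bound M F₁ u′ xs′) →
      Bound (M * m) (F₀ * m + F₁) u xs
    branch {occ} {emp} {u} {xs} z {M} {F₀} {F₁} Fam out in′ with z ∈? occ | z ∈? emp
    ... | yes p | _     = weaken (out Fam id (inj₁ p)) (m≤m+n _ _)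
    ... | no _  | yes p = weaken (out Fam id (inj₂ p)) (m≤m+n _ _)
    ... | no z∉occ | no z∉emp = bound (begin
      length xs * (M * m)    ≡⟨ sym (*-assoc (length xs) M m) ⟩
      length xs * M * m      ≡⟨ cong (λ l → l * M * m) (sym (length-filter-split (z ∈?_) xs)) ⟩
      (length ins + length outs) * M * m
                             ≡⟨ cong (_* m) (*-distribʳ-+ M (length ins) (length outs)) ⟩
      (length ins * M + length outs * M) * m
                             ≡⟨ *-distribʳ-+ m (length ins * M) (length outs * M) ⟩
      length ins * M * m + length outs * M * m
                             ≤⟨ +-mono-≤ (ins-bound u refl) (*-monoˡ-≤ m (Bound.ineq (out outs-family there (inj₂ (here refl))))) ⟩
      F₁ * m ^ u + F₀ * m ^ u * m
                             ≡⟨ collect F₀ F₁ (m ^ u) m ⟩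
      (F₀ * m + F₁) * m ^ u  ∎)
      where
      open Family Fam
      ins outs : List (List (Cell d))
      ins  = filter (z ∈?_) xs
      outs = filter (¬? ∘ (z ∈?_)) xs
      ins⁻ : ∀ {P} → P ∈ ins → P ∈ xs × z ∈ P
      ins⁻ = ∈-filter⁻ (z ∈?_)
      outs⁻ : ∀ {P} → P ∈ outs → P ∈ xs × z ∉ P
      outs⁻ = ∈-filter⁻ (¬? ∘ (z ∈?_))
      collect : ∀ a b c e → b * c + a * c * e ≡ (a * e + b) * c
      collect = solve-∀
      outs-family : Family occ (z ∷ emp) u outs
      outs-family = record
        { uniq-xs = filter-unique _ uniq-xs ; valid = valid ∘ proj₁ ∘ outs⁻ ; occupied = occupied ∘ proj₁ ∘ outs⁻
        ; empty = λ { P∈ (here refl) → proj₂ (outs⁻ P∈) ; P∈ (there p) → empty (proj₁ (outs⁻ P∈)) p }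
        ; uniq-occ = uniq-occ ; size = size ; root = root }
      fits : ∀ {P} → P ∈ ins → suc (length occ) ≤ n
      fits P∈ = subst (suc (length occ) ≤_) (Normal.size (polycube-normal (valid (proj₁ (ins⁻ P∈)))))
        (unique-⊆-length (unique-∷ z∉occ uniq-occ) λ
          { (here refl) → proj₂ (ins⁻ P∈) ; (there p) → occupied (proj₁ (ins⁻ P∈)) p })
      ins-bound : ∀ u′ → u ≡ u′ → length ins * M * m ≤ F₁ * m ^ u
      -- No cell is outstanding, so a member containing the new cell `z` would have more than n
      -- cells.
      ins-bound zero refl with ins in eq
      ... | []    = z≤n
      ... | P ∷ _ = contradiction (fits (subst (P ∈_) (sym eq) (here refl)))
                      (<⇒≱ (s≤s (≤-reflexive (sym (trans (sym (+-identityʳ _)) size)))))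
      ins-bound (suc u′) refl = begin
        length ins * M * m    ≤⟨ *-monoˡ-≤ m (Bound.ineq (in′ unknown refl ins-family)) ⟩
        F₁ * m ^ u′ * m       ≡⟨ trans (*-assoc F₁ (m ^ u′) m) (cong (F₁ *_) (*-comm (m ^ u′) m)) ⟩
        F₁ * m ^ suc u′       ∎
        where
        unknown : ¬ Known occ emp z
        unknown (inj₁ p) = z∉occ p
        unknown (inj₂ p) = z∉emp p
        ins-family : Family (z ∷ occ) emp u′ ins
        ins-family = record
          { uniq-xs = filter-unique _ uniq-xs ; valid = valid ∘ proj₁ ∘ ins⁻
          ; occupied = λ { P∈ (here refl) → proj₂ (ins⁻ P∈) ; P∈ (there p) → occupied (proj₁ (ins⁻ P∈)) p }
          ; empty = empty ∘ proj₁ ∘ ins⁻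
          ; uniq-occ = unique-∷ z∉occ uniq-occ
          ; size = trans (sym (+-suc (length occ) u′)) size
          ; root = there root }

    Closed : (Cell d → Set) → Cell d → Set
    Closed K z = ∀ c → K (move c z)

    -- `f` counts the cells still to be processed: those on the stack and those not yet found. As w
    -- / mᵐ = (1 + y)ᵐ + y² with y = 1/m, the bound grants each of them one such factor.
    Claim : ℕ → Set
    Claim f = ∀ {occ emp stack u xs} → Family occ emp u xs → Contexts (Known occ emp) [] stack →
      (∀ {z} → z ∈ occ → z ∈ stack ⊎ Closed (Known occ emp) z) → u + length stack ≡ f →
      Bound (m ^ (m * f)) (w ^ f) u xs

    -- With every neighbour of an occupied cell decided, no chain inside a member can leave `occ`;
    -- connectedness then forces each member to be `occ` itself.
    exhausted : ∀ {occ emp u xs} → Family occ emp u xs → (∀ {z} → z ∈ occ → Closed (Known occ emp) z) →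
                length xs ≤ 1
    exhausted {occ} {emp} {u} {xs} Fam closed = at-most-one xs uniq-xs λ P∈ Q∈ →
      polycube-≡ (valid P∈) (valid Q∈) (λ p → occupied Q∈ (inside P∈ p)) (λ q → occupied P∈ (inside Q∈ q))
      where
      open Family Fam
      follow : ∀ {P} → P ∈ xs → ∀ {y z} → y ∈ occ → Link (_∈ P) y z → z ∈ occ
      follow P∈ y∈ ε = y∈
      follow P∈ y∈ ((z∈ , a) ◅ p) with adj⇒move a
      ... | c , refl with closed y∈ c
      ...   | inj₁ q = follow P∈ q p
      ...   | inj₂ q = contradiction z∈ (empty P∈ q)
      inside : ∀ {P} → P ∈ xs → ∀ {z} → z ∈ P → z ∈ occ
      inside P∈ z∈ = follow P∈ root (Normal.conn (polycube-normal (valid P∈)) (occupied P∈ root) z∈)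
      at-most-one : ∀ ys → Unique ys → (∀ {P Q} → P ∈ ys → Q ∈ ys → P ≡ Q) → length ys ≤ 1
      at-most-one []           U h = z≤n
      at-most-one (_ ∷ [])     U h = ≤-refl
      at-most-one (P ∷ Q ∷ _)  U h = contradiction (subst (_∈ Q ∷ _) (h (there (here refl)) (here refl)) (here refl)) (unique-∉ U)

    base : ∀ {f occ emp u xs} → Family occ emp u xs → (∀ {z} → z ∈ occ → z ∈ [] ⊎ Closed (Known occ emp) z) →
           Bound (m ^ (m * f)) (w ^ f) u xs
    base {f} {u = u} {xs} Fam closed = bound (begin
      length xs * m ^ (m * f) ≤⟨ *-monoˡ-≤ (m ^ (m * f)) (exhausted Fam λ z∈ → finished {K = Known _ _} (closed z∈)) ⟩
      1 * m ^ (m * f)         ≡⟨ trans (*-identityˡ _) (sym (^-*-assoc m m f)) ⟩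
      (m ^ m) ^ f             ≤⟨ ^-monoˡ-≤ f (≤-trans (^-monoˡ-≤ m (n≤1+n m)) (m≤m+n (suc m ^ m) (m ^ m₂))) ⟩
      w ^ f                   ≤⟨ m≤m*n′ (m^n>0 m u) ⟩
      w ^ f * m ^ u           ∎)
      where
      finished : ∀ {z K} → z ∈ [] ⊎ Closed K z → Closed K z
      finished (inj₂ c) = c

    module Step {f : ℕ} (claim : Claim f) {occ₀ emp₀ : List (Cell d)} {x : Cell d} {rest : List (Cell d)}
      (C : Context (Known occ₀ emp₀) [] x) (Cs : Contexts (Known occ₀ emp₀) (x ∷ []) rest) where

      open Context C

      unsettle : ∀ {w} → Settled (Known occ₀ emp₀) [] w → Known occ₀ emp₀ w
      unsettle (inj₁ k) = k

      straight : Cell d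
      straight = move (opp a) x

      ω : ℕ
      ω = w ^ f

      record Grown (occ emp : List (Cell d)) : Set where
        field
          occ-grows : ∀ {z} → z ∈ occ₀ → z ∈ occ
          emp-grows : ∀ {z} → z ∈ emp₀ → z ∈ emp

        grows : ∀ {z} → Known occ₀ emp₀ z → Known occ emp z
        grows = known-mono occ-grows emp-grows

      Status : (Cell d → Set) → List (Cell d) → Cell d → Set
      Status K top z = z ∈ top ⊎ z ∈ rest ⊎ z ≡ x ⊎ Closed K z

      promote : ∀ {occ emp top top′} → Grown occ emp → (∀ {z} → z ∈ top → z ∈ top′) →
                ∀ {z} → Status (Known occ₀ emp₀) top z → Status (Known occ emp) top′ z
      promote G f (inj₁ p)               = inj₁ (f p)
      promote G f (inj₂ (inj₁ p))        = inj₂ (inj₁ p)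
      promote G f (inj₂ (inj₂ (inj₁ e))) = inj₂ (inj₂ (inj₁ e))
      promote G f (inj₂ (inj₂ (inj₂ c))) = inj₂ (inj₂ (inj₂ λ e → Grown.grows G (c e)))

      -- Once `x` is closed, whatever was settled only through `x` is known outright, so the
      -- contexts of `rest` hold below any new cells put on top: this is what permits the
      -- depth-first order.
      finish : ∀ {occ emp u xs top} → Family occ emp u xs → Grown occ emp → Closed (Known occ emp) x →
        Contexts (Known occ emp) [] top →
        (∀ {z} → z ∈ occ → Status (Known occ emp) top z) →
        u + (length top + length rest) ≡ f → Bound (m ^ (m * f)) ω u xs
      finish {occ} {emp} {top = top} Fam G closed tops status eq = claim Fam
        (contexts-++ tops λ _ _ → contexts-mono (Grown.grows G) now Cs)
        (λ z∈ → combine (status z∈))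
        (trans (cong (_ +_) (length-++ top)) eq)
        where
        now : ∀ {pre w} → Settled (Known occ₀ emp₀) (x ∷ []) w → Settled (Known occ emp) pre w
        now (inj₁ k)                      = inj₁ (Grown.grows G k)
        now (inj₂ (_ , here refl , c , refl)) = inj₁ (closed c)
        combine : ∀ {z} → Status (Known occ emp) top z → z ∈ top ++ rest ⊎ Closed (Known occ emp) z
        combine (inj₁ p)                      = inj₁ (∈-++⁺ˡ p)
        combine (inj₂ (inj₁ p))               = inj₁ (∈-++⁺ʳ top p)
        combine (inj₂ (inj₂ (inj₁ refl)))     = inj₂ closed
        combine (inj₂ (inj₂ (inj₂ c)))        = inj₂ c

      Side : Cell d → Set
      Side z = ∃[ c ] (axis c ≢ axis a × z ≡ move c x × z ≢ x)

      module _ {occ emp : List (Cell d)} (G : Grown occ emp) (closed : Closed (Known occ emp) x) where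
        private
          K = Known occ emp

          x-known : K x
          x-known = Grown.grows G known

        -- The neighbour of a side child in direction `a` is at the same time a neighbour of the
        -- parent of `x`, decided by `around`. A side child thus has its second decided neighbour
        -- without further choices.
        side-context : ∀ {z pre} → K z → Side z → Context K pre z
        side-context k (c , ne , refl , z≢x) = record
          { known = k
          ; a = opp c ; b = a ; perp = ne
          ; parent = subst K (sym back) x-known
          ; around = λ e _ → inj₁ (subst (K ∘ move e) (sym back) (closed e))
          ; extra = inj₁ (subst K (move-comm c a x ne) (Grown.grows G (unsettle (around c ne)))) }
          where back = opp-move c x z≢x

        side-contexts : ∀ {news pre} → (∀ {z} → z ∈ news → K z) → (∀ {z} → z ∈ news → Side z) → Contexts K pre news
        side-contexts {[]}     k h = []
        side-contexts {z ∷ zs} k h = side-context (k (here refl)) (h (here refl)) ∷ side-contexts (k ∘ there) (h ∘ there)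

        -- Going straight on keeps the axis of the parent, and the neighbours beside this cell need
        -- not be decided yet. The second decided neighbour, in direction `c`, has to be provided
        -- from outside.
        straight-context : ∀ {pre} → K straight → straight ≢ x → ∀ c → axis a ≢ axis c →
                           Settled K pre (move c straight) → Context K pre straight
        straight-context k ne c ac s = record
          { known = k
          ; a = a ; b = c ; perp = ac
          ; parent = subst K (sym back) x-known
          ; around = λ e _ → inj₁ (subst (K ∘ move e) (sym back) (closed e))
          ; extra = s }
          where
          back : move a straight ≡ x
          back = trans (cong (λ e → move e straight) (sym (opp-opp a))) (opp-move (opp a) x ne)

        -- Here the parent is the cell straight ahead, processed earlier, and the second decided
        -- neighbour is `move b x`, known because `x` is closed.
        beyond-context : ∀ {pre} → straight ∈ pre → K straight → K (move b straight) → straight ≢ x →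
                         move b straight ≢ straight → Context K pre (move b straight)
        beyond-context st∈ ks k ne ne′ = record
          { known = k
          ; a = opp b ; b = a ; perp = perp ∘ sym
          ; parent = subst K (sym back) ks
          ; around = λ e _ → inj₂ (straight , st∈ , e , cong (move e) back)
          ; extra = inj₁ (subst K (sym flipped) (closed b)) }
          where
          back : move (opp b) (move b straight) ≡ straight
          back = opp-move b straight ne′
          home : move a straight ≡ x
          home = trans (cong (λ e → move e straight) (sym (opp-opp a))) (opp-move (opp a) x ne)
          flipped : move a (move b straight) ≡ move b x
          flipped = trans (move-comm a b straight perp) (cong (move b) home)

      -- With y = 1/m, the side cells still to be decided contribute (1 + y) each and the cell straight
      -- ahead 1 + y; if x turns out to have no new side cell, the second choice behind the cell
      -- straight ahead adds y².
      weight : ℕ → List (Cell d) → ℕ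
      weight g []      = ω * (suc m ^ suc g * m + m ^ g)
      weight g (_ ∷ _) = ω * (suc m ^ suc g * m)

      -- The recursion behind one `branch`: leaving the side cell empty keeps `news`, occupying it
      -- makes `news` nonempty and thereby removes the y² term.
      weight-split : ∀ g z news → weight g news * m + weight g (z ∷ news) ≡ weight (suc g) news
      weight-split g z []      = expand ω (suc m ^ suc g) m (m ^ g)
        where
        expand : ∀ o p m q → o * (p * m + q) * m + o * (p * m) ≡ o * (suc m * p * m + m * q)
        expand = solve-∀
      weight-split g z (_ ∷ _) = expand ω (suc m ^ suc g) m
        where
        expand : ∀ o p m → o * (p * m) * m + o * (p * m) ≡ o * (suc m * p * m)
        expand = solve-∀

      record Progress (cs : List (Dir d)) (occ emp news : List (Cell d)) (u : ℕ) : Set where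
        field
          grown   : Grown occ emp
          side    : ∀ {z} → z ∈ news → Side z
          news∈   : ∀ {z} → z ∈ news → z ∈ occ
          status  : ∀ {z} → z ∈ occ → Status (Known occ₀ emp₀) news z
          pending : ∀ c → axis c ≢ axis a → Known occ emp (move c x) ⊎ c ∈ cs
          count   : u + (length news + length rest) ≡ f

      module Ahead {occ emp news : List (Cell d)} {u : ℕ} {xs : List (List (Cell d))}
        (Fam : Family occ emp u xs) (P : Progress [] occ emp news u) where
        open Progress P

        closing : ∀ {occ′ emp′} → (∀ {z} → Known occ emp z → Known occ′ emp′ z) → Known occ′ emp′ straight →
                  Closed (Known occ′ emp′) x
        closing f k c with axis c ≟F axis a
        ... | no ne with pending c ne
        ...   | inj₁ q = f q
        closing f k c | yes e with same-axis a c e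
        ... | inj₁ refl = f (Grown.grows grown parent)
        ... | inj₂ refl = k

        no-straight : ∀ {emp′ xs′} → Family occ emp′ u xs′ → (∀ {y} → y ∈ emp → y ∈ emp′) →
                      Known occ emp′ straight → Bound (m ^ (m * f)) ω u xs′
        no-straight {emp′} Fam′ g k = finish Fam′ G closed (side-contexts G closed (inj₁ ∘ news∈) side)
          (λ z∈ → promote G id (status z∈)) count
          where
          G : Grown occ emp′
          G = record { occ-grows = Grown.occ-grows grown ; emp-grows = g ∘ Grown.emp-grows grown }
          closed : Closed (Known occ emp′) x
          closed = closing (known-mono id g) k

      straight-new : ∀ {occ emp} → Grown occ emp → ¬ Known occ emp straight → straight ≢ x
      straight-new G ¬k e = ¬k (subst (Known _ _) (sym e) (Grown.grows G known))

      -- With a new side cell the choice costs 1 + y. Without one, an occupied cell straight ahead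
      -- entails a further choice at `w′`, so the total is 1 + y (1 + y) = 1 + y + y².
      decide-straight : ∀ {occ emp news u xs} → Family occ emp u xs → Progress [] occ emp news u →
                        Bound (m ^ (m * f) * m * m) (weight 0 news) u xs
      decide-straight {occ} {emp} {z ∷ news} {u} Fam P =
        weaken (branch straight Fam no-straight go) (≤-reflexive (expand ω m))
        where
        open Progress P
        open Ahead Fam P
        expand : ∀ o m → (o * m + o) * m ≡ o * (suc m * 1 * m)
        expand = solve-∀
        go : ∀ {u′ xs′} → ¬ Known occ emp straight → u ≡ suc u′ → Family (straight ∷ occ) emp u′ xs′ →
             Bound (m ^ (m * f)) ω u′ xs′
        go {u′} ¬k refl Fam′ = finish {top = (z ∷ news) ++ straight ∷ []} Fam′ G closed
          (contexts-++ (side-contexts G closed (inj₁ ∘ there ∘ news∈) side) λ h _ → ahead (h (here refl)) ∷ [])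
          new-status
          (trans (cong (λ l → u′ + (l + length rest)) (trans (length-++ (z ∷ news)) (+-comm (length (z ∷ news)) 1))) (trans (+-suc u′ _) count))
          where
          G : Grown (straight ∷ occ) emp
          G = record { occ-grows = there ∘ Grown.occ-grows grown ; emp-grows = Grown.emp-grows grown }
          closed : Closed (Known (straight ∷ occ) emp) x
          closed = closing (known-mono there id) (inj₁ (here refl))
          ahead : ∀ {pre} → z ∈ pre → Context (Known (straight ∷ occ) emp) pre straight
          ahead z∈ with side (here refl)
          -- The side cell `z` lies above `straight` in the stack, and the neighbour of `straight`
          -- in direction `c` is also a neighbour of `z`, hence decided when `z` has been processed.
          ... | c , ne , refl , _ = straight-context G closed (inj₁ (here refl)) (straight-new grown ¬k) c (ne ∘ sym)
            (inj₂ (move c x , z∈ , opp a , move-comm c (opp a) x ne))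
          new-status : ∀ {y} → y ∈ straight ∷ occ → Status (Known (straight ∷ occ) emp) ((z ∷ news) ++ straight ∷ []) y
          new-status (here refl) = inj₁ (∈-++⁺ʳ (z ∷ news) (here refl))
          new-status (there p)   = promote G ∈-++⁺ˡ (status p)
      decide-straight {occ} {emp} {[]} {u} Fam P =
        bound-cast (expand ω m)
          (branch straight Fam (λ Fam′ g k → weaken (no-straight Fam′ g k) ≤-refl) go)
        where
        open Progress P
        open Ahead Fam P
        expand : ∀ o m → o * m * m + (o * m + o) ≡ o * (suc m * 1 * m + 1)
        expand = solve-∀
        w′ : Cell d
        w′ = move b straight
        go : ∀ {u′ xs′} → ¬ Known occ emp straight → u ≡ suc u′ → Family (straight ∷ occ) emp u′ xs′ →
             Bound (m ^ (m * f) * m) (ω * m + ω) u′ xs′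
        go {u′} ¬k refl Fam′ = branch w′ Fam′ behind-empty behind-occupied
          where
          st≢x : straight ≢ x
          st≢x = straight-new grown ¬k
          G : ∀ {emp′} → (∀ {y} → y ∈ emp → y ∈ emp′) → Grown (straight ∷ occ) emp′
          G g = record { occ-grows = there ∘ Grown.occ-grows grown ; emp-grows = g ∘ Grown.emp-grows grown }
          behind-empty : ∀ {emp′ xs′} → Family (straight ∷ occ) emp′ u′ xs′ → (∀ {y} → y ∈ emp → y ∈ emp′) →
                         Known (straight ∷ occ) emp′ w′ → Bound (m ^ (m * f)) ω u′ xs′
          behind-empty {emp′} Fam″ g k = finish {top = straight ∷ []} Fam″ (G g) closed
            (straight-context (G g) closed (inj₁ (here refl)) st≢x b perp (inj₁ k) ∷ [])
            new-status (trans (+-suc u′ _) count)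
            where
            closed : Closed (Known (straight ∷ occ) emp′) x
            closed = closing (known-mono there g) (inj₁ (here refl))
            new-status : ∀ {y} → y ∈ straight ∷ occ → Status (Known (straight ∷ occ) emp′) (straight ∷ []) y
            new-status (here refl) = inj₁ (here refl)
            new-status (there p)   = promote (G g) (λ ()) (status p)
          behind-occupied : ∀ {u″ xs″} → ¬ Known (straight ∷ occ) emp w′ → u′ ≡ suc u″ →
                            Family (w′ ∷ straight ∷ occ) emp u″ xs″ → Bound (m ^ (m * f)) ω u″ xs″
          behind-occupied {u″} ¬k′ refl Fam″ = finish {top = straight ∷ w′ ∷ []} Fam″ G′ closed
            ( straight-context G′ closed (inj₁ (there (here refl))) st≢x b perp (inj₁ (inj₁ (here refl)))
            ∷ beyond-context G′ closed (here refl) (inj₁ (there (here refl))) (inj₁ (here refl)) st≢x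
                (λ e → ¬k′ (inj₁ (here e)))
            ∷ [])
            new-status (trans (+-suc u″ _) (trans (cong suc (+-suc u″ _)) count))
            where
            G′ : Grown (w′ ∷ straight ∷ occ) emp
            G′ = record { occ-grows = there ∘ there ∘ Grown.occ-grows grown ; emp-grows = Grown.emp-grows grown }
            closed : Closed (Known (w′ ∷ straight ∷ occ) emp) x
            closed = closing (known-mono (there ∘ there) id) (inj₁ (there (here refl)))
            new-status : ∀ {y} → y ∈ w′ ∷ straight ∷ occ →
                         Status (Known (w′ ∷ straight ∷ occ) emp) (straight ∷ w′ ∷ []) y
            new-status (here refl)         = inj₁ (there (here refl))
            new-status (there (here refl)) = inj₁ (here refl)
            new-status (there (there p))   = promote G′ (λ ()) (status p)

      -- The common denominator: one factor m for each side direction and two for the cells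
      -- `straight` and `move b straight`, times the denominator of the induction hypothesis.
      scale : ℕ → ℕ
      scale zero    = m ^ (m * f) * m * m
      scale (suc g) = scale g * m

      decide-sides : ∀ cs {occ emp news u xs} → (∀ {c} → c ∈ cs → axis c ≢ axis a) → Family occ emp u xs →
                     Progress cs occ emp news u → Bound (scale (length cs)) (weight (length cs) news) u xs
      decide-sides []       off Fam P = decide-straight Fam P
      decide-sides (c ∷ cs) {occ} {emp} {news} {u} off Fam P =
        bound-cast (weight-split (length cs) (move c x) news)
          (branch (move c x) Fam
            (λ Fam′ g k → decide-sides cs (off ∘ there) Fam′ (progress-out g k))
            (λ { ¬k refl Fam′ → decide-sides cs (off ∘ there) Fam′ (progress-in ¬k refl) }))
        where
        open Progress P
        progress-out : ∀ {emp′} → (∀ {y} → y ∈ emp → y ∈ emp′) → Known occ emp′ (move c x) → Progress cs occ emp′ news u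
        progress-out {emp′} g k = record
          { grown = record { occ-grows = Grown.occ-grows grown ; emp-grows = g ∘ Grown.emp-grows grown }
          ; side = side ; news∈ = news∈ ; status = status ; count = count
          ; pending = λ e ne → update e (pending e ne) }
          where
          update : ∀ e → Known occ emp (move e x) ⊎ e ∈ c ∷ cs → Known occ emp′ (move e x) ⊎ e ∈ cs
          update e (inj₁ q)            = inj₁ (known-mono id g q)
          update e (inj₂ (here refl))  = inj₁ k
          update e (inj₂ (there p))    = inj₂ p
        progress-in : ∀ {u′} → ¬ Known occ emp (move c x) → u ≡ suc u′ →
                      Progress cs (move c x ∷ occ) emp (move c x ∷ news) u′
        progress-in {u′} ¬k eq = record
          { grown = record { occ-grows = there ∘ Grown.occ-grows grown ; emp-grows = Grown.emp-grows grown }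
          ; side = λ { (here refl) → c , off (here refl) , refl , (λ e → ¬k (subst (Known occ emp) (sym e) (Grown.grows grown known)))
                     ; (there p) → side p }
          ; news∈ = λ { (here refl) → here refl ; (there p) → there (news∈ p) }
          ; status = λ { (here refl) → inj₁ (here refl) ; (there p) → Data.Sum.map₁ there (status p) }
          ; count = trans (+-suc u′ _) (trans (cong (_+ (length news + length rest)) (sym eq)) count)
          ; pending = λ e ne → update e (pending e ne) }
          where
          update : ∀ e → Known occ emp (move e x) ⊎ e ∈ c ∷ cs → Known (move c x ∷ occ) emp (move e x) ⊎ e ∈ cs
          update e (inj₁ q)            = inj₁ (known-mono there id q)
          update e (inj₂ (here refl))  = inj₁ (inj₁ (here refl))
          update e (inj₂ (there p))    = inj₂ p

      -- An additional side direction multiplies the weight by at least 1, so a bound for fewer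
      -- directions implies the one for m - 1.
      pad : ∀ k {g u xs} → Bound (scale g) (weight g []) u xs → Bound (scale (k + g)) (weight (k + g) []) u xs
      pad zero    B = B
      pad (suc k) {g} B = weaken (pad k B)
        (≤-trans (m≤m+n _ _) (≤-reflexive (weight-split (k + g) x [])))

      scale≡ : ∀ g → scale g ≡ m ^ (m * f) * m ^ (2 + g)
      scale≡ zero    = expand (m ^ (m * f)) m
        where
        expand : ∀ p m → p * m * m ≡ p * (m * (m * 1))
        expand = solve-∀
      scale≡ (suc g) = trans (cong (_* m) (scale≡ g)) (expand (m ^ (m * f)) m (m ^ (2 + g)))
        where
        expand : ∀ p m q → p * q * m ≡ p * (m * q)
        expand = solve-∀

      process : ∀ {u xs} → Family occ₀ emp₀ u xs →
        (∀ {z} → z ∈ occ₀ → z ∈ x ∷ rest ⊎ Closed (Known occ₀ emp₀) z) → u + length rest ≡ f →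
        Bound (m ^ (m * suc f)) (w ^ suc f) u xs
      process {u} {xs} Fam status₀ count₀ = bound (cancelʳ m (s≤s z≤n) (begin
        length xs * m ^ (m * suc f) * m   ≡⟨ trans (*-assoc (length xs) _ m) (cong (length xs *_) scale-eq) ⟩
        length xs * scale (suc m₂)        ≤⟨ Bound.ineq padded ⟩
        weight (suc m₂) [] * m ^ u        ≡⟨ collect ω (suc m ^ m) m (m ^ m₂) (m ^ u) ⟩
        w * ω * m ^ u * m                 ∎))
        where
        g = length (others a b)
        initial-progress : Progress (others a b) occ₀ emp₀ [] u
        initial-progress = record
          { grown = record { occ-grows = id ; emp-grows = id }
          ; side = λ () ; news∈ = λ ()
          ; status = λ z∈ → convert (status₀ z∈)
          ; pending = initial ; count = count₀ }
          where
          convert : ∀ {z} → z ∈ x ∷ rest ⊎ Closed (Known occ₀ emp₀) z → Status (Known occ₀ emp₀) [] z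
          convert (inj₁ (here e))  = inj₂ (inj₂ (inj₁ e))
          convert (inj₁ (there p)) = inj₂ (inj₁ p)
          convert (inj₂ c)         = inj₂ (inj₂ (inj₂ c))
          initial : ∀ c → axis c ≢ axis a → Known occ₀ emp₀ (move c x) ⊎ c ∈ others a b
          initial c ne with c ≟d b
          ... | yes refl = inj₁ (unsettle extra)
          ... | no ne′   = inj₂ (∈-others⁺ a b ne ne′)
        g≤ : g ≤ suc m₂
        g≤ = +-cancelˡ-≤ 3 g (suc m₂) (≤-trans (length-others a b perp) (≤-reflexive dim))
        padded : Bound (scale (suc m₂)) (weight (suc m₂) []) u xs
        padded = subst (λ k → Bound (scale k) (weight k []) u xs) (m∸n+n≡m g≤)
          (pad (suc m₂ ∸ g) (decide-sides (others a b) (λ c∈ → proj₁ (∈-others⁻ a b c∈)) Fam initial-progress))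
        scale-eq : m ^ (m * suc f) * m ≡ scale (suc m₂)
        scale-eq = begin-equality
          m ^ (m * suc f) * m        ≡⟨ cong (λ k → m ^ k * m) (*-suc m f) ⟩
          m ^ (m + m * f) * m        ≡⟨ cong (_* m) (^-distribˡ-+-* m m (m * f)) ⟩
          m ^ m * m ^ (m * f) * m    ≡⟨ reorder (m ^ m) (m ^ (m * f)) m ⟩
          m ^ (m * f) * m ^ (2 + suc m₂) ≡⟨ sym (scale≡ (suc m₂)) ⟩
          scale (suc m₂)             ∎
          where
          reorder : ∀ p q m → p * q * m ≡ q * (m * p)
          reorder = solve-∀
        collect : ∀ o p m q r → o * (p * m + m * q) * r ≡ (p + q) * o * r * m
        collect = solve-∀

    claim : ∀ f → Claim f
    claim f       {stack = []}       Fam Cs status eq = base {f = f} Fam status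
    claim (suc f) {stack = x ∷ rest} {u} Fam (C ∷ Cs) status eq =
      Step.process {f = f} (claim f) C Cs Fam status (suc-injective (trans (sym (+-suc u (length rest))) eq))
    claim zero    {stack = x ∷ rest} {u} Fam Cs status eq = contradiction (trans (sym (+-suc u (length rest))) eq) λ ()

  pairs-length-scaled : {Z : Set} (f : X → List Z) (xs : List X) {M F : ℕ} →
    (∀ {x} → x ∈ xs → length (f x) * M ≤ F) → length (pairs f xs) * M ≤ length xs * F
  pairs-length-scaled f []       h = z≤n
  pairs-length-scaled f (x ∷ xs) {M} {F} h = begin
    length (pairs f (x ∷ xs)) * M                     ≡⟨ cong (_* M) (trans (length-++ (map (x ,_) (f x))) (cong (_+ length (pairs f xs)) (length-map (x ,_) (f x)))) ⟩
    (length (f x) + length (pairs f xs)) * M          ≡⟨ *-distribʳ-+ M (length (f x)) (length (pairs f xs)) ⟩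
    length (f x) * M + length (pairs f xs) * M        ≤⟨ +-mono-≤ (h (here refl)) (pairs-length-scaled f xs (h ∘ there)) ⟩
    F + length xs * F                                 ∎
    where open ≤-Reasoning

  module _ (d′ : ℕ) where
    private
      D m₂ m w : ℕ
      D  = suc (suc d′)
      m₂ = d′ * 2
      m  = 2 + m₂
      w  = suc m ^ m + m ^ m₂

      e₁ e₂ : Dir D
      e₁ = zero , true
      e₂ = suc zero , true

      sideways : List (Dir D)
      sideways = filter (λ c → ¬? (axis c ≟F zero)) (dirs D)

      height-sideways : ∀ (c : Dir D) x → axis c ≢ zero → height (move c x) ≡ height x
      height-sideways (zero , _)      x       ne = contradiction refl ne
      height-sideways (suc i , true)  (y ∷ x) ne = refl
      height-sideways (suc i , false) (y ∷ x) ne = refl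

      height-up : ∀ x → height (move e₁ x) ≡ suc (height x)
      height-up (y ∷ x) = refl

      rooted? : ∀ r (P : List (Cell D)) → Dec (r ∈ P × All (λ c → height c ≤ height r) P)
      rooted? r P = (r ∈? P) ×-dec all? (λ c → height c ≤? height r) P

      rooted : ℕ → Cell D → List (List (Cell D))
      rooted n r = filter (rooted? r) (polycubes D n)

      rooted⁻ : ∀ {n r P} → P ∈ rooted n r → P ∈ polycubes D n × r ∈ P × All (λ c → height c ≤ height r) P
      rooted⁻ {n} {r} = ∈-filter⁻ (rooted? r) {xs = polycubes D n}

      above : Cell D → List (Cell D)
      above r = move e₁ r ∷ map (λ c → move c (move e₁ r)) sideways

      height-above : ∀ r {z} → z ∈ above r → height z ≡ suc (height r)
      height-above r (here refl) = height-up r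
      height-above r (there z∈) with ∈-map⁻ (λ c → move c (move e₁ r)) z∈
      ... | c , c∈ , refl =
        trans (height-sideways c _ (proj₂ (∈-filter⁻ (λ c → ¬? (axis c ≟F zero)) {xs = dirs D} c∈))) (height-up r)

      above-sideways : ∀ r c → axis c ≢ zero → move c (move e₁ r) ∈ above r
      above-sideways r c ne = there (∈-map⁺ _ (∈-filter⁺ (λ c → ¬? (axis c ≟F zero)) (∈-dirs c) ne))

      -- A highest cell `r` starts the exploration: the cell above it is empty and plays the parent,
      -- and the cells beside that one are empty as well, being too high. The second decided
      -- neighbour of `r` is obtained by one preliminary choice at `move e₂ r`.
      rooted-bound : ∀ u r → length (rooted (suc u) r) * m ^ (m * suc u) ≤ w ^ suc u * m ^ suc u
      rooted-bound u r = cancelʳ (m * m) (s≤s z≤n) (begin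
        length (rooted N r) * m ^ (m * N) * (m * m)   ≡⟨ reorder (length (rooted N r)) (m ^ (m * N)) m ⟩
        length (rooted N r) * (m ^ (m * N) * m) * m   ≤⟨ *-monoˡ-≤ m (Bound.ineq (branch (move e₂ r) initial alone second)) ⟩
        (w ^ N * m + w ^ N) * m ^ u * m               ≡⟨ collect (w ^ N) m (m ^ u) ⟩
        -- The preliminary choice costs 1 + y, but only u = N - 1 cells were outstanding; the factor
        -- m thus spared absorbs it, as m + 1 ≤ m².
        w ^ N * (m * m ^ u) * suc m                   ≤⟨ *-monoʳ-≤ (w ^ N * m ^ N) (≤-trans (≤-reflexive (+-comm 1 m)) (≤-trans (+-monoʳ-≤ m (s≤s (z≤n {suc m₂}))) (*-monoˡ-≤-two m))) ⟩
        w ^ N * m ^ N * (m * m)                       ∎)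
        where
        N = suc u
        open ≤-Reasoning
        open Count D N m₂ r refl hiding (m; w)
        *-monoˡ-≤-two : ∀ k → k + k ≤ m * k
        *-monoˡ-≤-two k = ≤-trans (≤-reflexive (cong (k +_) (sym (+-identityʳ k)))) (*-monoˡ-≤ k (s≤s (s≤s (z≤n {m₂}))))
        reorder : ∀ a b c → a * b * (c * c) ≡ a * (b * c) * c
        reorder = solve-∀
        collect : ∀ a b c → (a * b + a) * c * b ≡ a * (b * c) * suc b
        collect = solve-∀
        initial : Family (r ∷ []) (above r) u (rooted N r)
        initial = record
          { uniq-xs = filter-unique _ (polycubes-unique D N)
          ; valid = proj₁ ∘ rooted⁻ {N} {r}
          ; occupied = λ { P∈ (here refl) → proj₁ (proj₂ (rooted⁻ {N} {r} P∈)) }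
          ; empty = λ P∈ c∈ c∈P → 1+n≰n (subst (_≤ height r) (height-above r c∈)
                      (All.lookup (proj₂ (proj₂ (rooted⁻ {N} {r} P∈))) c∈P))
          ; uniq-occ = [] ∷ []
          ; size = refl
          ; root = here refl }
        root-context : ∀ {occ emp} → r ∈ occ → (∀ {y} → y ∈ above r → y ∈ emp) → Known occ emp (move e₂ r) →
                       Context (Known occ emp) [] r
        root-context r∈ g k = record
          { known = inj₁ r∈ ; a = e₁ ; b = e₂ ; perp = λ ()
          ; parent = inj₂ (g (here refl))
          ; around = λ c ne → inj₁ (inj₂ (g (above-sideways r c ne)))
          ; extra = inj₁ k }
        alone : ∀ {emp′ xs′} → Family (r ∷ []) emp′ u xs′ → (∀ {y} → y ∈ above r → y ∈ emp′) →
                Known (r ∷ []) emp′ (move e₂ r) → Bound (m ^ (m * N)) (w ^ N) u xs′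
        alone Fam g k = claim N Fam (root-context (here refl) g k ∷ []) inj₁ (+-comm u 1)
        second : ∀ {u′ xs′} → ¬ Known (r ∷ []) (above r) (move e₂ r) → u ≡ suc u′ →
                 Family (move e₂ r ∷ r ∷ []) (above r) u′ xs′ → Bound (m ^ (m * N)) (w ^ N) u′ xs′
        second {u′} ¬k refl Fam = claim N {stack = r ∷ move e₂ r ∷ []} Fam
          (root-context (there (here refl)) id (inj₁ (here refl)) ∷ record
            { known = inj₁ (here refl) ; a = opp e₂ ; b = e₁ ; perp = λ ()
            ; parent = inj₁ (there (here back))
            ; around = λ c _ → inj₂ (r , here refl , c , cong (move c) back)
            ; extra = inj₁ (inj₂ (subst (_∈ above r) (sym (move-comm e₁ e₂ r λ ())) (above-sideways r e₂ λ ()))) } ∷ [])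
          (λ { (here refl) → inj₁ (there (here refl)) ; (there (here refl)) → inj₁ (here refl) })
          (+-comm u′ 2)
          where
          back : move (opp e₂) (move e₂ r) ≡ r
          back = opp-move e₂ r λ e → ¬k (inj₁ (here e))

    -- Each polycube is counted at one of its highest cells, for which there are at most n^D
    -- positions; cancelling m^n turns w / mᵐ into B = w / mᵐ⁻¹.
    polycount-exponential : ∀ n → polycount D n * m ^ (suc m₂ * n) ≤ n ^ D * w ^ n
    polycount-exponential zero = ≤-trans (≤-reflexive (cong (_* m ^ (suc m₂ * 0)) none)) z≤n
      where
      none : polycount D 0 ≡ 0
      none with polycubes D 0 in eq
      ... | []    = refl
      ... | S ∷ _ = contradiction (subst (S ∈_) (sym eq) (here refl)) polycubes-zero
    polycount-exponential n@(suc u) = cancelʳ (m ^ n) (m^n>0 m n) (begin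
      polycount D n * m ^ (suc m₂ * n) * m ^ n    ≡⟨ *-assoc (polycount D n) _ _ ⟩
      polycount D n * (m ^ (suc m₂ * n) * m ^ n)  ≡⟨ cong (polycount D n *_) (trans (sym (^-distribˡ-+-* m (suc m₂ * n) n)) (cong (m ^_) (+-comm (suc m₂ * n) n))) ⟩
      polycount D n * m ^ (m * n)                 ≤⟨ *-monoˡ-≤ (m ^ (m * n)) (unique-decode-length proj₂ (polycubes-unique D n) choose) ⟩
      length (pairs (rooted n) (box D n)) * m ^ (m * n)
        ≤⟨ pairs-length-scaled (rooted n) (box D n) (λ {r} _ → rooted-bound u r) ⟩
      length (box D n) * (w ^ n * m ^ n)          ≡⟨ cong (_* (w ^ n * m ^ n)) (length-box D n) ⟩
      n ^ D * (w ^ n * m ^ n)                     ≡⟨ sym (*-assoc (n ^ D) (w ^ n) (m ^ n)) ⟩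
      n ^ D * w ^ n * m ^ n                       ∎)
      where
      open ≤-Reasoning
      choose : ∀ {P} → P ∈ polycubes D n → ∃[ c ] (c ∈ pairs (rooted n) (box D n) × P ≡ proj₂ c)
      choose {[]}     P∈ = contradiction (Normal.size (polycube-normal P∈)) λ ()
      choose {c ∷ cs} P∈ with argmax height c cs
      ... | r , r∈ , top = (r , c ∷ cs)
        , ∈-pairs⁺ (rooted n) (sublists-⊆ (box D n) (polycube-sublist P∈) r∈)
            (∈-filter⁺ (rooted? r) P∈ (r∈ , All.tabulate top))
        , refl

-- Rational arithmetic and the partial sums of e.

module Rationals where
  open Asymptotics using (bernoulli; m≤m*n′)
  open import Data.Nat using (ℕ; zero; suc; NonZero; _!; s≤s; z≤n) renaming (_+_ to _+ℕ_; _*_ to _*ℕ_; _^_ to _^ℕ_; _≤_ to _≤ℕ_)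
  import Data.Nat.Properties as ℕ
  open import Data.Nat.Tactic.RingSolver using (solve-∀)
  open import Data.Integer using (+_; -[1+_]; +≤+)
  import Data.Integer as ℤ
  import Data.Integer.Properties as ℤ
  open import Data.Rational using (ℚ; mkℚ; 0ℚ; 1ℚ; _/_; _+_; _*_; _≤_; _<_; Positive; NonNegative; positive; nonNegative; toℚᵘ)
  open import Data.Rational.Properties
  open import Data.Rational.Unnormalised using (mkℚᵘ; *≡*; *≤*) renaming (_≃_ to _≃ᵘ_)
  import Data.Rational.Unnormalised.Properties as ℚᵘ
  open import Data.Product using (∃-syntax; _,_)
  open import Relation.Binary.PropositionalEquality
  open import Function using (_∘_)

  toℚᵘ-ℕtoℚ : ∀ n → toℚᵘ (ℕtoℚ n) ≃ᵘ mkℚᵘ (+ n) 0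
  toℚᵘ-ℕtoℚ n = toℚᵘ-fromℚᵘ (mkℚᵘ (+ n) 0)

  ℕtoℚ-+ : ∀ m n → ℕtoℚ (m +ℕ n) ≡ ℕtoℚ m + ℕtoℚ n
  ℕtoℚ-+ m n = toℚᵘ-injective (ℚᵘ.≃-trans (toℚᵘ-ℕtoℚ (m +ℕ n)) (ℚᵘ.≃-sym
    (ℚᵘ.≃-trans (toℚᵘ-homo-+ (ℕtoℚ m) (ℕtoℚ n)) (ℚᵘ.≃-trans (ℚᵘ.+-cong (toℚᵘ-ℕtoℚ m) (toℚᵘ-ℕtoℚ n))
      (*≡* (trans (ℤ.*-identityʳ _) (trans (cong₂ ℤ._+_ (ℤ.*-identityʳ (+ m)) (ℤ.*-identityʳ (+ n)))
        (sym (ℤ.*-identityʳ (+ (m +ℕ n)))))))))))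

  ℕtoℚ-* : ∀ m n → ℕtoℚ (m *ℕ n) ≡ ℕtoℚ m * ℕtoℚ n
  ℕtoℚ-* m n = toℚᵘ-injective (ℚᵘ.≃-trans (toℚᵘ-ℕtoℚ (m *ℕ n)) (ℚᵘ.≃-sym
    (ℚᵘ.≃-trans (toℚᵘ-homo-* (ℕtoℚ m) (ℕtoℚ n)) (ℚᵘ.≃-trans (ℚᵘ.*-cong (toℚᵘ-ℕtoℚ m) (toℚᵘ-ℕtoℚ n))
      (*≡* (cong (λ z → z ℤ.* + 1) (sym (ℤ.pos-* m n))))))))

  ℕtoℚ-mono : ∀ {m n} → m ≤ℕ n → ℕtoℚ m ≤ ℕtoℚ n
  ℕtoℚ-mono {m} {n} le = toℚᵘ-cancel-≤ (ℚᵘ.≤-respˡ-≃ (ℚᵘ.≃-sym (toℚᵘ-ℕtoℚ m))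
    (ℚᵘ.≤-respʳ-≃ (ℚᵘ.≃-sym (toℚᵘ-ℕtoℚ n)) (*≤* (ℤ.*-monoʳ-≤-nonNeg (+ 1) (+≤+ le)))))

  ℕtoℚ-inverse : ∀ n .{{_ : NonZero n}} → ℕtoℚ n * (+ 1 / n) ≡ 1ℚ
  ℕtoℚ-inverse n@(suc k) = toℚᵘ-injective (ℚᵘ.≃-trans (toℚᵘ-homo-* (ℕtoℚ n) (+ 1 / n))
    (ℚᵘ.≃-trans (ℚᵘ.*-cong (toℚᵘ-ℕtoℚ n) (toℚᵘ-fromℚᵘ (mkℚᵘ (+ 1) k))) (*≡*
      (trans (ℤ.*-identityʳ (+ n ℤ.* + 1)) (trans (ℤ.*-identityʳ (+ n))
        (trans (cong (+_ ∘ suc) (sym (ℕ.+-identityʳ k))) (sym (ℤ.*-identityˡ (+ suc (k +ℕ 0))))))))))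

  ℕtoℚ-nonNegative : ∀ n → NonNegative (ℕtoℚ n)
  ℕtoℚ-nonNegative n = nonNegative (ℕtoℚ-mono {0} {n} z≤n)

  ℕtoℚ-positive : ∀ n → 1 ≤ℕ n → Positive (ℕtoℚ n)
  ℕtoℚ-positive n 1≤n = positive (<-≤-trans (positive⁻¹ 1ℚ) (ℕtoℚ-mono {1} {n} 1≤n))

  -- U x n y = n! xⁿ Σ_{k ≤ n} (y / x)ᵏ / k!
  U : ℕ → ℕ → ℕ → ℕ
  U x zero    y = 1
  U x (suc n) y = suc n *ℕ x *ℕ U x n y +ℕ y ^ℕ suc n

  -- In y, the derivative of `U x (suc n)` is (n + 1) `U x n`. This is the corresponding inequality
  -- for a unit increment, which Bernoulli gives term by term.
  U-suc : ∀ x n y → U x (suc n) y +ℕ suc n *ℕ U x n y ≤ℕ U x (suc n) (suc y)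
  U-suc x zero    y = ℕ.≤-reflexive (base x y)
    where
    base : ∀ x y → 1 *ℕ x *ℕ 1 +ℕ y *ℕ 1 +ℕ 1 *ℕ 1 ≡ 1 *ℕ x *ℕ 1 +ℕ suc y *ℕ 1
    base = solve-∀
  U-suc x (suc n) y = begin
    k *ℕ x *ℕ u +ℕ y ^ℕ k +ℕ k *ℕ (suc n *ℕ x *ℕ U x n y +ℕ p)
      ≡⟨ rearrange k x u (y ^ℕ k) (suc n) (U x n y) p ⟩
    k *ℕ x *ℕ (u +ℕ suc n *ℕ U x n y) +ℕ (y ^ℕ k +ℕ k *ℕ p)
      ≤⟨ ℕ.+-mono-≤ (ℕ.*-monoʳ-≤ (k *ℕ x) (U-suc x n y)) (bernoulli y (suc n)) ⟩
    k *ℕ x *ℕ U x (suc n) (suc y) +ℕ suc y ^ℕ k ∎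
    where
    open ℕ.≤-Reasoning
    k = suc (suc n)
    u = U x (suc n) y
    p = y ^ℕ suc n
    rearrange : ∀ k x u q n v p → k *ℕ x *ℕ u +ℕ q +ℕ k *ℕ (n *ℕ x *ℕ v +ℕ p) ≡
                k *ℕ x *ℕ (u +ℕ n *ℕ v) +ℕ (q +ℕ k *ℕ p)
    rearrange = solve-∀

  -- This reads (1 + 1/x)ⁿ ≤ Σ (n/x)ᵏ / k! over k ≤ n. Keeping x independent of n makes induction on
  -- n possible; `U-suc` raises the last argument from n to n + 1.
  factorial-power≤U : ∀ x n → n ! *ℕ suc x ^ℕ n ≤ℕ U x n n
  factorial-power≤U x zero    = ℕ.≤-refl
  factorial-power≤U x (suc n) = begin
    suc n *ℕ n ! *ℕ (suc x *ℕ suc x ^ℕ n)      ≡⟨ regroup (suc n) (n !) (suc x) (suc x ^ℕ n) ⟩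
    suc n *ℕ suc x *ℕ (n ! *ℕ suc x ^ℕ n)      ≤⟨ ℕ.*-monoʳ-≤ (suc n *ℕ suc x) (factorial-power≤U x n) ⟩
    suc n *ℕ suc x *ℕ U x n n                  ≤⟨ ℕ.m≤m+n _ (n ^ℕ suc n) ⟩
    suc n *ℕ suc x *ℕ U x n n +ℕ n ^ℕ suc n    ≡⟨ expand (suc n) x (U x n n) (n ^ℕ suc n) ⟩
    U x (suc n) n +ℕ suc n *ℕ U x n n          ≤⟨ U-suc x n n ⟩
    U x (suc n) (suc n)                        ∎
    where
    open ℕ.≤-Reasoning
    regroup : ∀ a b c e → a *ℕ b *ℕ (c *ℕ e) ≡ a *ℕ c *ℕ (b *ℕ e)
    regroup = solve-∀
    expand : ∀ a x u p → a *ℕ suc x *ℕ u +ℕ p ≡ a *ℕ x *ℕ u +ℕ p +ℕ a *ℕ u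
    expand = solve-∀

  -- n! times the n-th partial sum of e.
  factorialSum : ℕ → ℕ
  factorialSum zero    = 1
  factorialSum (suc n) = suc n *ℕ factorialSum n +ℕ 1

  U-diagonal : ∀ x n → U x n x ≡ x ^ℕ n *ℕ factorialSum n
  U-diagonal x zero    = refl
  U-diagonal x (suc n) = trans (cong (λ u → suc n *ℕ x *ℕ u +ℕ x ^ℕ suc n) (U-diagonal x n))
    (expand (suc n) x (x ^ℕ n) (factorialSum n))
    where
    expand : ∀ k x p s → k *ℕ x *ℕ (p *ℕ s) +ℕ x *ℕ p ≡ x *ℕ p *ℕ (k *ℕ s +ℕ 1)
    expand = solve-∀

  factorial-eSum : ∀ n → ℕtoℚ (n !) * eSum n ≡ ℕtoℚ (factorialSum n)
  factorial-eSum zero    = *-identityˡ 1ℚ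
  factorial-eSum (suc n) = begin
    ℕtoℚ (suc n !) * (eSum n + e)
      ≡⟨ *-distribˡ-+ (ℕtoℚ (suc n !)) (eSum n) e ⟩
    ℕtoℚ (suc n *ℕ n !) * eSum n + ℕtoℚ (suc n !) * e
      ≡⟨ cong₂ _+_ (trans (cong (_* eSum n) (ℕtoℚ-* (suc n) (n !))) (trans (*-assoc (ℕtoℚ (suc n)) (ℕtoℚ (n !)) (eSum n)) (cong (ℕtoℚ (suc n) *_) (factorial-eSum n))))
           (ℕtoℚ-inverse (suc n !) {{ℕ._!≢0 (suc n)}}) ⟩
    ℕtoℚ (suc n) * ℕtoℚ (factorialSum n) + ℕtoℚ 1
      ≡⟨ cong (_+ ℕtoℚ 1) (sym (ℕtoℚ-* (suc n) (factorialSum n))) ⟩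
    ℕtoℚ (suc n *ℕ factorialSum n) + ℕtoℚ 1
      ≡⟨ sym (ℕtoℚ-+ (suc n *ℕ factorialSum n) 1) ⟩
    ℕtoℚ (factorialSum (suc n)) ∎
    where
    open ≡-Reasoning
    e = (+ 1 / (suc n !)) {{ℕ._!≢0 (suc n)}}

  -- At x = n = m all ratios y / x are 1, so the series becomes the partial sum of e.
  power≤eSum : ∀ m → ℕtoℚ (suc m ^ℕ m) ≤ ℕtoℚ (m ^ℕ m) * eSum m
  power≤eSum m = *-cancelˡ-≤-pos (ℕtoℚ (m !)) {{ℕtoℚ-positive (m !) (ℕ.1≤n! m)}} (begin
    ℕtoℚ (m !) * ℕtoℚ (suc m ^ℕ m)           ≡⟨ sym (ℕtoℚ-* (m !) (suc m ^ℕ m)) ⟩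
    ℕtoℚ (m ! *ℕ suc m ^ℕ m)                 ≤⟨ ℕtoℚ-mono (ℕ.≤-trans (factorial-power≤U m m) (ℕ.≤-reflexive (U-diagonal m m))) ⟩
    ℕtoℚ (m ^ℕ m *ℕ factorialSum m)          ≡⟨ ℕtoℚ-* (m ^ℕ m) (factorialSum m) ⟩
    ℕtoℚ (m ^ℕ m) * ℕtoℚ (factorialSum m)    ≡⟨ cong (ℕtoℚ (m ^ℕ m) *_) (sym (factorial-eSum m)) ⟩
    ℕtoℚ (m ^ℕ m) * (ℕtoℚ (m !) * eSum m)    ≡⟨ sym (*-assoc (ℕtoℚ (m ^ℕ m)) (ℕtoℚ (m !)) (eSum m)) ⟩
    ℕtoℚ (m ^ℕ m) * ℕtoℚ (m !) * eSum m      ≡⟨ cong (_* eSum m) (*-comm (ℕtoℚ (m ^ℕ m)) (ℕtoℚ (m !))) ⟩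
    ℕtoℚ (m !) * ℕtoℚ (m ^ℕ m) * eSum m      ≡⟨ *-assoc (ℕtoℚ (m !)) (ℕtoℚ (m ^ℕ m)) (eSum m) ⟩
    ℕtoℚ (m !) * (ℕtoℚ (m ^ℕ m) * eSum m)    ∎)
    where open ≤-Reasoning

  module _ (k : ℕ) where
    private
      m₂ m w M : ℕ
      m₂ = k *ℕ 2
      m  = 2 +ℕ m₂
      w  = suc m ^ℕ m +ℕ m ^ℕ m₂
      M  = m ^ℕ suc m₂

    base≤boundApprox : ℕtoℚ w ≤ ℕtoℚ M * boundApprox (suc (suc k)) m
    base≤boundApprox = begin
      ℕtoℚ w                                              ≡⟨ ℕtoℚ-+ (suc m ^ℕ m) (m ^ℕ m₂) ⟩
      ℕtoℚ (suc m ^ℕ m) + ℕtoℚ (m ^ℕ m₂)                  ≤⟨ +-mono-≤ (power≤eSum m) (≤-reflexive tail) ⟩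
      ℕtoℚ (m ^ℕ m) * eSum m + ℕtoℚ M * (+ 1 / m)         ≡⟨ cong (_+ ℕtoℚ M * (+ 1 / m)) head ⟩
      ℕtoℚ M * (ℕtoℚ m * eSum m) + ℕtoℚ M * (+ 1 / m)     ≡⟨ sym (*-distribˡ-+ (ℕtoℚ M) (ℕtoℚ m * eSum m) (+ 1 / m)) ⟩
      ℕtoℚ M * (ℕtoℚ m * eSum m + (+ 1 / m))              ≡⟨ cong (ℕtoℚ M *_) (same-bound (double k)) ⟩
      ℕtoℚ M * boundApprox (suc (suc k)) m                ∎
      where
      open ≤-Reasoning
      double : ∀ k → 2 +ℕ k *ℕ 2 ≡ suc k +ℕ suc k
      double = solve-∀
      same-bound : ∀ {j} .{{_ : NonZero j}} → j ≡ suc k +ℕ suc k →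
                   ℕtoℚ j * eSum m + (+ 1 / j) ≡ boundApprox (suc (suc k)) m
      same-bound refl = refl
      head : ℕtoℚ (m ^ℕ m) * eSum m ≡ ℕtoℚ M * (ℕtoℚ m * eSum m)
      head = trans (cong (λ z → ℕtoℚ z * eSum m) (ℕ.*-comm m M))
        (trans (cong (_* eSum m) (ℕtoℚ-* M m)) (*-assoc (ℕtoℚ M) (ℕtoℚ m) (eSum m)))
      tail : ℕtoℚ (m ^ℕ m₂) ≡ ℕtoℚ M * (+ 1 / m)
      tail = trans (sym (*-identityʳ (ℕtoℚ (m ^ℕ m₂)))) (trans (cong (ℕtoℚ (m ^ℕ m₂) *_) (sym (ℕtoℚ-inverse m)))
        (trans (sym (*-assoc (ℕtoℚ (m ^ℕ m₂)) (ℕtoℚ m) (+ 1 / m)))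
          (cong (_* (+ 1 / m)) (trans (sym (ℕtoℚ-* (m ^ℕ m₂) m)) (cong ℕtoℚ (ℕ.*-comm (m ^ℕ m₂) m))))))

  -- The denominator of δ serves: multiplied by it, δ becomes its numerator, a positive integer.
  archimedean : ∀ δ → 0ℚ < δ → ∃[ c ] (1ℚ ≤ ℕtoℚ (suc c) * δ)
  archimedean δ@(mkℚ (+ zero) _ _)   0<δ with () ← ℤ.Positive.pos (positive {δ} 0<δ)
  archimedean δ@(mkℚ (-[1+ _ ]) _ _) 0<δ with () ← ℤ.Positive.pos (positive {δ} 0<δ)
  archimedean δ@(mkℚ (+ suc p) c _) 0<δ = c , toℚᵘ-cancel-≤ (ℚᵘ.≤-respʳ-≃
    (ℚᵘ.≃-sym (ℚᵘ.≃-trans (toℚᵘ-homo-* (ℕtoℚ (suc c)) δ) (ℚᵘ.*-cong (toℚᵘ-ℕtoℚ (suc c)) ℚᵘ.≃-refl)))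
    (*≤* (subst₂ ℤ._≤_ (sym (ℤ.*-identityˡ (+ suc (c +ℕ 0))))
      (trans (ℤ.pos-* (suc c) (suc p)) (sym (ℤ.*-identityʳ (+ suc c ℤ.* + suc p)))) (+≤+ ineq))))
    where
    ineq : suc (c +ℕ 0) ≤ℕ suc c *ℕ suc p
    ineq = ℕ.≤-trans (ℕ.≤-reflexive (cong suc (ℕ.+-identityʳ c))) (ℕ.m≤m*n (suc c) (suc p))

  module _ (c₀ w M : ℕ) {x q δ : ℚ} (1≤M : 1 ≤ℕ M) (0<δ : 0ℚ < δ) (big : 1ℚ ≤ ℕtoℚ (suc c₀) * δ)
    (w≤ : ℕtoℚ w ≤ ℕtoℚ M * x) (le : x + δ ≤ q) where
    private
      c r β : ℕ
      c = 3 *ℕ suc c₀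
      r = c *ℕ M
      β = c *ℕ w

    -- The factor 3 in `c` is there because the ratio bound loses three units: r δ ≥ 3 (c₀ + 1) δ ≥
    -- 3.
    scaled-bound : ℕtoℚ (β +ℕ 3) ≤ ℕtoℚ r * q
    scaled-bound = begin
      ℕtoℚ (β +ℕ 3)                             ≡⟨ ℕtoℚ-+ β 3 ⟩
      ℕtoℚ β + ℕtoℚ 3                           ≤⟨ +-mono-≤ main slack ⟩
      ℕtoℚ r * x + ℕtoℚ r * δ                   ≡⟨ sym (*-distribˡ-+ (ℕtoℚ r) x δ) ⟩
      ℕtoℚ r * (x + δ)                          ≤⟨ *-monoˡ-≤-nonNeg (ℕtoℚ r) {{ℕtoℚ-nonNegative r}} le ⟩
      ℕtoℚ r * q                                ∎
      where
      open ≤-Reasoning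
      main : ℕtoℚ β ≤ ℕtoℚ r * x
      main = begin
        ℕtoℚ (c *ℕ w)                            ≡⟨ ℕtoℚ-* c w ⟩
        ℕtoℚ c * ℕtoℚ w                          ≤⟨ *-monoˡ-≤-nonNeg (ℕtoℚ c) {{ℕtoℚ-nonNegative c}} w≤ ⟩
        ℕtoℚ c * (ℕtoℚ M * x)                    ≡⟨ sym (*-assoc (ℕtoℚ c) (ℕtoℚ M) x) ⟩
        ℕtoℚ c * ℕtoℚ M * x                      ≡⟨ cong (_* x) (sym (ℕtoℚ-* c M)) ⟩
        ℕtoℚ r * x                               ∎
      slack : ℕtoℚ 3 ≤ ℕtoℚ r * δ
      slack = begin
        ℕtoℚ 3                                   ≡⟨ sym (*-identityʳ (ℕtoℚ 3)) ⟩
        ℕtoℚ 3 * 1ℚ                              ≤⟨ *-monoˡ-≤-nonNeg (ℕtoℚ 3) {{ℕtoℚ-nonNegative 3}} big ⟩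
        ℕtoℚ 3 * (ℕtoℚ (suc c₀) * δ)             ≡⟨ sym (*-assoc (ℕtoℚ 3) (ℕtoℚ (suc c₀)) δ) ⟩
        ℕtoℚ 3 * ℕtoℚ (suc c₀) * δ               ≡⟨ cong (_* δ) (sym (ℕtoℚ-* 3 (suc c₀))) ⟩
        ℕtoℚ c * δ                               ≤⟨ *-monoʳ-≤-nonNeg δ {{nonNegative (<⇒≤ 0<δ)}} (ℕtoℚ-mono (m≤m*n′ {c} {M} 1≤M)) ⟩
        ℕtoℚ r * δ                               ∎

    rational-ratio : ∀ a b → r *ℕ a ≤ℕ (β +ℕ 3) *ℕ b → ℕtoℚ a ≤ q * ℕtoℚ b
    rational-ratio a b h = *-cancelˡ-≤-pos (ℕtoℚ r) {{ℕtoℚ-positive r (ℕ.*-mono-≤ (s≤s (z≤n {c₀ +ℕ 2 *ℕ suc c₀})) 1≤M)}} (begin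
      ℕtoℚ r * ℕtoℚ a               ≡⟨ sym (ℕtoℚ-* r a) ⟩
      ℕtoℚ (r *ℕ a)                 ≤⟨ ℕtoℚ-mono h ⟩
      ℕtoℚ ((β +ℕ 3) *ℕ b)          ≡⟨ ℕtoℚ-* (β +ℕ 3) b ⟩
      ℕtoℚ (β +ℕ 3) * ℕtoℚ b        ≤⟨ *-monoʳ-≤-nonNeg (ℕtoℚ b) {{ℕtoℚ-nonNegative b}} scaled-bound ⟩
      ℕtoℚ r * q * ℕtoℚ b           ≡⟨ *-assoc (ℕtoℚ r) q (ℕtoℚ b) ⟩
      ℕtoℚ r * (q * ℕtoℚ b)         ∎)
      where open ≤-Reasoning

open import Data.Nat using (ℕ; suc; _≤_)
open import Data.Nat using (s≤s; z≤n)
open import Data.Product using (∃-syntax)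
open import Data.Product using (_,_; proj₁)
open import Data.Rational using (ℚ; 0ℚ; _+_; _*_) renaming (_≤_ to _≤ℚ_; _<_ to _<ℚ_)

-- Combining the counting results.

module Ratio where
  open Sums using (sumTo; *-swapˡ)
  open Asymptotics using (m≤m*n′; pos^; *-^; module RatioBound)
  open Polycubes
  open Rationals
  open import Data.Nat as ℕ using (z≤n; s≤s) renaming (_+_ to _+ℕ_; _*_ to _*ℕ_; _^_ to _^ℕ_; _≤_ to _≤ℕ_)
  import Data.Nat.Properties as ℕ
  open import Data.List using (length)
  open import Data.Product using (proj₁; proj₂)
  open import Data.Rational using (1ℚ)
  open import Relation.Binary.PropositionalEquality using (sym; trans; cong; subst₂)

  module _ (k c₀ : ℕ) where

    -- `w` / `M` is B, and `c` expands the fraction until 3 / `r` is at most δ. The exponent `g` =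
    -- 2d comes from splitting, where two pieces have to be positioned.
    d m₂ m w M c β r g E : ℕ
    d  = suc (suc k)
    m₂ = k *ℕ 2
    m  = 2 +ℕ m₂
    w  = suc m ^ℕ m +ℕ m ^ℕ m₂
    M  = m ^ℕ suc m₂
    c  = 3 *ℕ suc c₀
    β  = c *ℕ w
    r  = c *ℕ M
    g  = d +ℕ d
    E  = 3 ^ℕ d

    1≤M : 1 ≤ℕ M
    1≤M = ℕ.m^n>0 m (suc m₂)

    1≤c : 1 ≤ℕ c
    1≤c = ℕ.*-mono-≤ (s≤s (z≤n {2})) (s≤s (z≤n {c₀}))

    M≤w : M ≤ℕ w
    M≤w = ℕ.≤-trans (ℕ.^-monoʳ-≤ m (ℕ.n≤1+n (suc m₂)))
      (ℕ.≤-trans (ℕ.^-monoˡ-≤ m (ℕ.n≤1+n m)) (ℕ.m≤m+n (suc m ^ℕ m) (m ^ℕ m₂)))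

    power≤ : ∀ n → n ^ℕ d ≤ℕ (n +ℕ 2) ^ℕ g
    power≤ n = ℕ.≤-trans (ℕ.^-monoˡ-≤ d (ℕ.m≤m+n n 2))
      (ℕ.≤-trans (m≤m*n′ (pos^ d (ℕ.m≤n⇒m≤o+n n (s≤s z≤n)))) (ℕ.≤-reflexive (sym (ℕ.^-distribˡ-+-* (n +ℕ 2) d d))))

    exponential : ∀ n → polycount d n *ℕ r ^ℕ n ≤ℕ (n +ℕ 2) ^ℕ g *ℕ β ^ℕ n
    exponential n = begin
      polycount d n *ℕ r ^ℕ n                             ≡⟨ cong (polycount d n *ℕ_) (trans (*-^ c M n) (cong (c ^ℕ n *ℕ_) (ℕ.^-*-assoc m (suc m₂) n))) ⟩
      polycount d n *ℕ (c ^ℕ n *ℕ m ^ℕ (suc m₂ *ℕ n))     ≡⟨ *-swapˡ (polycount d n) (c ^ℕ n) (m ^ℕ (suc m₂ *ℕ n)) ⟩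
      c ^ℕ n *ℕ (polycount d n *ℕ m ^ℕ (suc m₂ *ℕ n))     ≤⟨ ℕ.*-monoʳ-≤ (c ^ℕ n) (polycount-exponential k n) ⟩
      c ^ℕ n *ℕ (n ^ℕ d *ℕ w ^ℕ n)                        ≡⟨ *-swapˡ (c ^ℕ n) (n ^ℕ d) (w ^ℕ n) ⟩
      n ^ℕ d *ℕ (c ^ℕ n *ℕ w ^ℕ n)                        ≤⟨ ℕ.*-monoˡ-≤ (c ^ℕ n *ℕ w ^ℕ n) (power≤ n) ⟩
      (n +ℕ 2) ^ℕ g *ℕ (c ^ℕ n *ℕ w ^ℕ n)                 ≡⟨ cong ((n +ℕ 2) ^ℕ g *ℕ_) (sym (*-^ c w n)) ⟩
      (n +ℕ 2) ^ℕ g *ℕ β ^ℕ n                             ∎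
      where
      open ℕ.≤-Reasoning

    eventual-ratio : ∃[ n₀ ] ((n : ℕ) → n₀ ≤ n → r *ℕ polycount d (suc n) ≤ℕ (β +ℕ 3) *ℕ polycount d n)
    eventual-ratio = RatioBound.eventual-ratio (polycount d) (λ n j v → length (strata d n j v)) (λ n v → length (with-fulls d n v)) E g β r
      (ℕ.m^n>0 3 d) (ℕ.*-mono-≤ 1≤c 1≤M) (ℕ.*-monoʳ-≤ c M≤w)
      exponential
      (λ s N 1≤s s<N → ℕ.≤-trans (polycount-split d s N 1≤s s<N)
        (ℕ.*-monoˡ-≤ (sumTo (suc s) (λ i → polycount d (suc s +ℕ i) *ℕ polycount d (N ℕ.∸ (s +ℕ i))))
          (ℕ.≤-trans (ℕ.≤-reflexive (sym (ℕ.^-distribˡ-+-* N d d))) (ℕ.^-monoˡ-≤ g (ℕ.m≤m+n N 2)))))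
      (λ j n j≤n → ℕ.≤-trans (polycount-extension (suc k) j n j≤n) (ℕ.*-monoˡ-≤ (polycount d n) (power≤ n)))
      (λ n j v → strata-flip (suc k) n j v (s≤s (s≤s z≤n)))
      (strata≤with-fulls d) (with-fulls≤ d) (polycount≤Σstrata d) (Σstrata≤polycount d) (filling-bound d)

    ratio : ∀ {q δ} → 0ℚ <ℚ δ → 1ℚ ≤ℚ ℕtoℚ (suc c₀) * δ → boundApprox d m + δ ≤ℚ q → ∀ n →
      proj₁ eventual-ratio ≤ n → ℕtoℚ (A d (suc n)) ≤ℚ q * ℕtoℚ (A d n)
    ratio 0<δ big bounded n n₀≤n =
      rational-ratio c₀ w M 1≤M 0<δ big (base≤boundApprox k) bounded (A d (suc n)) (A d n)
        (subst₂ (λ a b → r *ℕ a ≤ℕ (β +ℕ 3) *ℕ b) (length-polycubes d (suc n)) (length-polycubes d n)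
          (proj₂ eventual-ratio n n₀≤n))

-- The number e enters through its partial sums: `q` runs over the rationals strictly above (2d - 2)
-- e + 1/(2d - 2), with `δ` witnessing the gap. The limit of the ratios is thus at most every such
-- `q`, hence at most the bound itself.
theorem4 : (d : ℕ) → 2 ≤ d →
    (q δ : ℚ) → 0ℚ <ℚ δ → ((N : ℕ) → boundApprox d N + δ ≤ℚ q) →
    ∃[ n₀ ] ((n : ℕ) → n₀ ≤ n → ℕtoℚ (A d (suc n)) ≤ℚ q * ℕtoℚ (A d n))
theorem4 (suc (suc k)) (s≤s (s≤s z≤n)) q δ 0<δ bounded =
  let (c₀ , big) = Rationals.archimedean δ 0<δ
  in proj₁ (Ratio.eventual-ratio k c₀) , Ratio.ratio k c₀ 0<δ big (bounded (Ratio.m k c₀))
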